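{- For every integer $t>1$ there exists $n_0$ such that for all $n\ge n_0$, $$\mathrm{ex}_3(n,F_t^3)=\binom{n}{3}-\binom{n-t}{3}.$$
   Context: For an $r$-uniform hypergraph ($r$-graph) $\mathcal{F}$, $\mathrm{ex}_r(n,\mathcal{F})$ denotes the maximum number of hyperedges in an $n$-vertex $r$-graph that does not contain $\mathcal{F}$ as a subhypergraph. The $t$-fan $F_t$ is the graph on $2t+1$ vertices consisting of $t$ triangles which pairwise intersect in exactly one common vertex. For a graph $F$, its $r$-expansion $F^r$ is the $r$-graph obtained from $F$ by adding $r-2$ new vertices to each edge of $F$, where all the $(r-2)|E(F)|$ new vertices are distinct from each other and not in $V(F)$; thus $F_t^3$ is the 3-graph obtained by enlarging each of the $3t$ edges of $F_t$ by its own new vertex. -}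

module Defs where

open import Data.Nat using (ℕ)
open import Data.Fin using (Fin)
open import Data.Fin.Subset using (Subset; ∣_∣; ⁅_⁆; _∪_)
open import Data.List using (List; length)
open import Data.List.Relation.Unary.All using (All)
open import Data.List.Relation.Unary.Unique.Propositional using (Unique)
open import Data.List.Membership.Propositional using (_∈_)
open import Data.Product using (Σ; _×_)
open import Relation.Binary.PropositionalEquality using (_≡_)
open import Relation.Nullary using (¬_)
open import Function.Definitions using (Injective)

record 3Graph (n : ℕ) : Set where
  field
    edges    : List (Subset n)
    uniform  : All (λ e → ∣ e ∣ ≡ 3) edges
    distinct : Unique edges
open 3Graph public

e : ∀ {n} → 3Graph n → ℕ
e H = length (edges H)

-- Vertices of the 3-expansion F_t^3 of the t-fan F_t.
-- center : the common vertex; a i, b i : the other two vertices of triangle i;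
-- ca i, cb i, ab i : the new vertices added to edges {center,a i}, {center,b i}, {a i,b i}.
data FanVertex (t : ℕ) : Set where
  center : FanVertex t
  a b    : Fin t → FanVertex t
  ca cb ab : Fin t → FanVertex t

triple : ∀ {n} → Fin n → Fin n → Fin n → Subset n
triple x y z = ⁅ x ⁆ ∪ (⁅ y ⁆ ∪ ⁅ z ⁆)

ContainsExpandedFan : ∀ {n} → ℕ → 3Graph n → Set
ContainsExpandedFan {n} t H =
  Σ (FanVertex t → Fin n) λ φ →
    Injective _≡_ _≡_ φ ×
    ((i : Fin t) →
        (triple (φ center) (φ (a i)) (φ (ca i)) ∈ edges H)
      × (triple (φ center) (φ (b i)) (φ (cb i)) ∈ edges H)
      × (triple (φ (a i)) (φ (b i)) (φ (ab i)) ∈ edges H))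

ExFanIs : ℕ → ℕ → ℕ → Set
ExFanIs t n m =
  ((H : 3Graph n) → ¬ ContainsExpandedFan t H → e H Data.Nat.≤ m)
  × Σ (3Graph n) (λ H → ¬ ContainsExpandedFan t H × e H ≡ m)

{-# OPTIONS --safe #-}
module Submission where

-- Upper bound. Write d(xy) for the codegree of a pair and let every pair of codegree at most t, 2t, 3t
-- give weight 6, 3, 2 to each edge containing it, so that no pair gives more than 6t in total. Call
-- an edge bad if it receives less than 6; its three codegrees then exceed t, 2t, 3t in some order.
-- If the link of a vertex c contained many disjoint pairs uv with cuv bad, then t of them would be
-- the triangles of a fan centred at c: expansion vertices are chosen greedily, first for all sides of
-- small codegree, then for the middle ones, then for the large ones. So in the link of every vertex
-- the bad edges are covered by O(1) vertices, and there are only O(n) bad edges. This gives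
-- e(H) ≤ t n² / 2 + O(n), and if e(H) is at least the claimed bound, then all but O(n) pairs lose no
-- weight. The saturated codegrees 2t and 3t are excluded by a variant of the greedy choice, so all but
-- O(n) pairs have codegree exactly t and lie only in edges whose other two pairs have huge
-- codegree. Hence there is a set T of t vertices forming the common neighbourhood of almost all
-- pairs, and all but O(1) exceptional vertices have large codegree with every vertex of T.
-- Fans centred in T show that an edge disjoint from T contains at least two exceptional vertices,
-- and fans centred at an exceptional vertex show that such edges are fewer than the edges which
-- its small codegree with T destroys.
--
-- Lower bound. Every set of vertices meeting all edges of the expanded t-fan has more than t elements.

open import Data.Empty using (⊥; ⊥-elim)
open import Data.Fin using (Fin)
open import Data.Fin.Patterns using (0F; 1F; 2F; 3F; 4F)
import Data.Fin.Properties as Fin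
open import Data.List using (List; []; _∷_; _++_; length; filter; allFin; concatMap; map; tabulate; lookup)
open import Data.List.Properties using (length-++; length-map; length-tabulate)
open import Data.List.Membership.Propositional using (_∈_; _∉_; find; lose)
open import Data.List.Membership.Propositional.Properties
  using (∈-allFin; ∈-filter⁺; ∈-filter⁻; ∈-++⁺ˡ; ∈-++⁺ʳ; ∈-++⁻; ∈-∃++; ∈-map⁻; ∈-lookup)
open import Data.List.Relation.Unary.Any as Any using (here; there)
open import Data.List.Relation.Unary.All as All using (All; []; _∷_)
open import Data.List.Relation.Unary.AllPairs using (AllPairs; []; _∷_)
open import Data.List.Relation.Unary.Unique.Propositional using (Unique)
import Data.List.Relation.Unary.Unique.Propositional.Properties as Uniq
open import Data.List.Relation.Binary.Pointwise using (Pointwise; []; _∷_)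
open import Data.List.Relation.Binary.Permutation.Propositional
  using (_↭_; ↭-sym; ↭-trans; ↭-refl; prep; swap; ↭⇒↭ₛ)
import Data.List.Relation.Binary.Permutation.Propositional.Properties as Perm
import Data.List.Relation.Binary.Permutation.Setoid.Properties as PermS
open import Data.Nat
  using (ℕ; zero; suc; pred; _+_; _*_; _∸_; _^_; _≤_; _<_; z≤n; s≤s; s≤s⁻¹; _≤?_; _<?_; _≟_; >-nonZero)
open import Data.Nat.Combinatorics using (_C_; nC1≡n; nCk+nC[k+1]≡[n+1]C[k+1])
open import Data.Nat.Properties hiding (_≟_; _≤?_; _<?_)
open import Data.Nat.Tactic.RingSolver using (solve-∀)
open import Data.Product using (Σ; ∃; _×_; _,_; proj₁; proj₂)
open import Data.Sum as Sum using (_⊎_; inj₁; inj₂; [_,_]′)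
open import Data.Unit using (⊤; tt)
open import Algebra.Properties.CommutativeSemigroup +-commutativeSemigroup using (interchange)
open import Function using (_∘_; id; case_of_)
open import Relation.Binary.PropositionalEquality
  using (_≡_; _≢_; refl; sym; trans; cong; cong₂; subst; setoid; module ≡-Reasoning)
open import Relation.Nullary using (¬_; Dec; yes; no; contradiction)
open import Relation.Nullary.Decidable using (_×-dec_; _⊎-dec_; _→-dec_; ¬?; decidable-stable; from-yes)
open import Relation.Unary using (Decidable)

-- The thresholds come from the greedy rounds: by the end of the three rounds at most `t`, `2t` and
-- `3t` expansion vertices are in use. The weights 6, 3, 2 make a pair of codegree exactly `t`, `2t`
-- or `3t` pay `6 * t` in total. The double count is therefore tight for three types of edges, with
-- codegrees (t, large, large), (2t, 2t, large) and (3t, 3t, 3t), although only the first is typical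
-- of the extremal graph. When `c u v` is itself an edge, each side of the triangle loses one
-- expansion vertex to the opposite corner. Bad edges can afford this, since their codegrees are
-- strictly above the thresholds; the other two tight types miss by just this one vertex, and the
-- variant of the greedy choice makes up for it. There is no induction on `n`: an error of order `n`
-- in the first count suffices to find `T`. The final comparison is exact because each exceptional
-- vertex costs, on balance, a number of triples of order `n`, while the triples inside the
-- exceptional set are bounded in number. Counts run over ordered triples, so the bound is proved
-- for six times the number of edges.

private variable
  A B A′ : Set

-- A certificate for linear inequalities: `a ≤ b` is a sum of multiples of known inequalities, `s`
-- is the remaining slack, and the equation is an identity left to the ring solver.
linear : ∀ {a b x y} s → a ≤ b → x + b + s ≡ y + a → x ≤ y
linear {a} {b} {x} {y} s a≤b eq = +-cancelʳ-≤ a x y (begin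
  x + a ≤⟨ +-monoʳ-≤ x a≤b ⟩
  x + b ≤⟨ m≤m+n (x + b) s ⟩
  x + b + s  ≡⟨ eq ⟩
  y + a ∎)
  where open ≤-Reasoning

-- Finite sums of natural numbers and indicators.

∑ : List A → (A → ℕ) → ℕ
∑ [] f = 0
∑ (x ∷ xs) f = f x + ∑ xs f

𝟙 : Dec A → ℕ
𝟙 (yes _) = 1
𝟙 (no _)  = 0

𝟙-yes : (a? : Dec A) → A → 𝟙 a? ≡ 1
𝟙-yes (yes _) _ = refl
𝟙-yes (no ¬a) a = contradiction a ¬a

𝟙-no : (a? : Dec A) → ¬ A → 𝟙 a? ≡ 0
𝟙-no (yes a) ¬a = contradiction a ¬a
𝟙-no (no _)  _  = refl

𝟙≤1 : (a? : Dec A) → 𝟙 a? ≤ 1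
𝟙≤1 (yes _) = ≤-refl
𝟙≤1 (no _)  = z≤n

𝟙-mono : (a? : Dec A) (b? : Dec B) → (A → B) → 𝟙 a? ≤ 𝟙 b?
𝟙-mono (yes a) b? f = ≤-reflexive (sym (𝟙-yes b? (f a)))
𝟙-mono (no _)  b? f = z≤n

𝟙-cong : (a? : Dec A) (b? : Dec B) → (A → B) → (B → A) → 𝟙 a? ≡ 𝟙 b?
𝟙-cong a? b? f g = ≤-antisym (𝟙-mono a? b? f) (𝟙-mono b? a? g)

𝟙≤ : (a? : Dec A) {m : ℕ} → (A → 1 ≤ m) → 𝟙 a? ≤ m
𝟙≤ (yes a) f = f a
𝟙≤ (no _)  f = z≤n

𝟙-⊎ : (a? : Dec A) (b? : Dec B) (c? : Dec A′) → (A → B ⊎ A′) → 𝟙 a? ≤ 𝟙 b? + 𝟙 c?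
𝟙-⊎ a? b? c? f = 𝟙≤ a? λ a → case (f a)
  where
  case : _ → 1 ≤ 𝟙 b? + 𝟙 c?
  case (inj₁ b) = ≤-trans (≤-reflexive (sym (𝟙-yes b? b))) (m≤m+n _ _)
  case (inj₂ c) = ≤-trans (≤-reflexive (sym (𝟙-yes c? c))) (m≤n+m _ (𝟙 b?))

𝟙-× : (a? : Dec A) (b? : Dec B) → 𝟙 (a? ×-dec b?) ≡ 𝟙 a? * 𝟙 b?
𝟙-× (yes _) (yes _) = refl
𝟙-× (yes _) (no _)  = refl
𝟙-× (no _)  _ = refl

∑-mono∈ : ∀ {f g : A → ℕ} (xs : List A) → (∀ {x} → x ∈ xs → f x ≤ g x) → ∑ xs f ≤ ∑ xs g
∑-mono∈ [] f≤g = z≤n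
∑-mono∈ (x ∷ xs) f≤g = +-mono-≤ (f≤g (here refl)) (∑-mono∈ xs (f≤g ∘ there))

∑-mono : ∀ {f g : A → ℕ} (xs : List A) → (∀ x → f x ≤ g x) → ∑ xs f ≤ ∑ xs g
∑-mono xs f≤g = ∑-mono∈ xs λ {x} _ → f≤g x

∑-cong : ∀ {f g : A → ℕ} (xs : List A) → (∀ x → f x ≡ g x) → ∑ xs f ≡ ∑ xs g
∑-cong [] f≡g = refl
∑-cong (x ∷ xs) f≡g = cong₂ _+_ (f≡g x) (∑-cong xs f≡g)

∑-+ : ∀ (xs : List A) (f g : A → ℕ) → ∑ xs (λ x → f x + g x) ≡ ∑ xs f + ∑ xs g
∑-+ [] f g = refl
∑-+ (x ∷ xs) f g = trans (cong (f x + g x +_) (∑-+ xs f g)) (interchange (f x) (g x) _ _)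

∑-*ˡ : ∀ (xs : List A) k (f : A → ℕ) → ∑ xs (λ x → k * f x) ≡ k * ∑ xs f
∑-*ˡ [] k f = sym (*-zeroʳ k)
∑-*ˡ (x ∷ xs) k f = trans (cong (k * f x +_) (∑-*ˡ xs k f)) (sym (*-distribˡ-+ k (f x) _))

∑-*ʳ : ∀ (xs : List A) k (f : A → ℕ) → ∑ xs (λ x → f x * k) ≡ ∑ xs f * k
∑-*ʳ xs k f = trans (∑-cong xs λ x → *-comm (f x) k) (trans (∑-*ˡ xs k f) (*-comm k _))

∑-const : ∀ (xs : List A) k → ∑ xs (λ _ → k) ≡ length xs * k
∑-const [] k = refl
∑-const (x ∷ xs) k = cong (k +_) (∑-const xs k)

∑-zero : ∀ (xs : List A) → ∑ xs (λ _ → 0) ≡ 0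
∑-zero xs = trans (∑-const xs 0) (*-zeroʳ (length xs))

∑-swap : ∀ (xs : List A) (ys : List B) (f : A → B → ℕ) →
         ∑ xs (λ x → ∑ ys (f x)) ≡ ∑ ys (λ y → ∑ xs (λ x → f x y))
∑-swap [] ys f = sym (∑-zero ys)
∑-swap (x ∷ xs) ys f =
  trans (cong (∑ ys (f x) +_) (∑-swap xs ys f)) (sym (∑-+ ys (f x) _))

∑-∈≤ : ∀ {xs : List A} {x} (f : A → ℕ) → x ∈ xs → f x ≤ ∑ xs f
∑-∈≤ f (here refl) = m≤m+n _ _
∑-∈≤ {xs = y ∷ _} f (there x∈xs) = ≤-trans (∑-∈≤ f x∈xs) (m≤n+m _ (f y))

∑-bound : ∀ (xs : List A) (f : A → ℕ) k → (∀ {x} → x ∈ xs → f x ≤ k) → ∑ xs f ≤ length xs * k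
∑-bound xs f k f≤k = ≤-trans (∑-mono∈ xs f≤k) (≤-reflexive (∑-const xs k))

length-filter : ∀ {P : A → Set} (P? : Decidable P) xs → length (filter P? xs) ≡ ∑ xs (𝟙 ∘ P?)
length-filter P? [] = refl
length-filter P? (x ∷ xs) with P? x
... | yes _ = cong suc (length-filter P? xs)
... | no _  = length-filter P? xs

∑-pigeonhole : ∀ (xs : List A) (f : A → ℕ) k → 1 ≤ length xs → ∑ xs f ≤ k * length xs →
               ∃ λ x → x ∈ xs × f x ≤ k
∑-pigeonhole (x ∷ xs) f k _ = go x xs
  where
  go : ∀ x xs → ∑ (x ∷ xs) f ≤ k * length (x ∷ xs) → ∃ λ y → y ∈ x ∷ xs × f y ≤ k
  go x xs le with f x ≤? k
  go x xs le | yes fx≤k = x , here refl , fx≤k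
  go x [] le | no  fx≰k = contradiction
    (≤-trans (≤-reflexive (sym (+-identityʳ _))) (≤-trans le (≤-reflexive (*-identityʳ k)))) fx≰k
  go x (y ∷ ys) le | no  fx≰k
    with z , z∈ , fz≤k ← go y ys (+-cancelˡ-≤ k _ _
           (≤-trans (+-monoˡ-≤ _ (<⇒≤ (≰⇒> fx≰k))) (≤-trans le (≤-reflexive (*-suc k (length (y ∷ ys)))))))
    = z , there z∈ , fz≤k

-- Counting and choosing vertices.

module Vertices {n : ℕ} where

  V : Set
  V = Fin n

  𝕍 : List V
  𝕍 = allFin n

  open import Data.List.Membership.DecPropositional (Fin._≟_ {n}) public using (_∈?_)

  # : {P : V → Set} → Decidable P → ℕ
  # P? = ∑ 𝕍 (λ x → 𝟙 (P? x))

  private variable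
    P Q R : V → Set

  length-𝕍 : length 𝕍 ≡ n
  length-𝕍 = length-tabulate (λ x → x)

  #≤n : (P? : Decidable P) → # P? ≤ n
  #≤n P? = ≤-trans (∑-bound 𝕍 _ 1 λ _ → 𝟙≤1 (P? _))
                   (≤-reflexive (trans (*-identityʳ _) length-𝕍))

  #-mono : (P? : Decidable P) (Q? : Decidable Q) → (∀ {x} → P x → Q x) → # P? ≤ # Q?
  #-mono P? Q? f = ∑-mono 𝕍 λ x → 𝟙-mono (P? x) (Q? x) f

  #-cong : (P? : Decidable P) (Q? : Decidable Q) → (∀ {x} → P x → Q x) → (∀ {x} → Q x → P x) → # P? ≡ # Q?
  #-cong P? Q? f g = ≤-antisym (#-mono P? Q? f) (#-mono Q? P? g)

  #-⊎ : (P? : Decidable P) (Q? : Decidable Q) (R? : Decidable R) →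
        (∀ {x} → P x → Q x ⊎ R x) → # P? ≤ # Q? + # R?
  #-⊎ P? Q? R? f = ≤-trans (∑-mono 𝕍 λ x → 𝟙-⊎ (P? x) (Q? x) (R? x) f)
                           (≤-reflexive (∑-+ 𝕍 _ _))

  ∑-unique : ∀ {xs : List V} → Unique xs → ∀ y → ∑ xs (λ x → 𝟙 (x Fin.≟ y)) ≤ 1
  ∑-unique [] y = z≤n
  ∑-unique {x ∷ xs} (x∉xs ∷ u) y with x Fin.≟ y
  ... | no _     = ∑-unique u y
  ... | yes refl = s≤s (≤-reflexive (trans (zeros xs x∉xs) refl))
    where
    zeros : ∀ ys → All (x ≢_) ys → ∑ ys (λ z → 𝟙 (z Fin.≟ x)) ≡ 0
    zeros [] [] = refl
    zeros (z ∷ ys) (p ∷ ps) = cong₂ _+_ (𝟙-no (z Fin.≟ x) (p ∘ sym)) (zeros ys ps)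

  ∑-∈? : ∀ {xs : List V} → Unique xs → ∀ ys → ∑ xs (λ x → 𝟙 (x ∈? ys)) ≤ length ys
  ∑-∈? {xs} u [] = ≤-reflexive (∑-zero xs)
  ∑-∈? {xs} u (y ∷ ys) = begin
    ∑ xs (λ x → 𝟙 (x ∈? (y ∷ ys))) ≤⟨ ∑-mono xs (λ x → 𝟙-⊎ (x ∈? (y ∷ ys)) (x Fin.≟ y) (x ∈? ys) λ
                                                             { (here p) → inj₁ p ; (there p) → inj₂ p }) ⟩
    ∑ xs (λ x → 𝟙 (x Fin.≟ y) + 𝟙 (x ∈? ys)) ≡⟨ ∑-+ xs _ _ ⟩
    ∑ xs (λ x → 𝟙 (x Fin.≟ y)) + ∑ xs (λ x → 𝟙 (x ∈? ys)) ≤⟨ +-mono-≤ (∑-unique u y) (∑-∈? u ys) ⟩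
    suc (length ys) ∎
    where open ≤-Reasoning

  #-∈ : ∀ ys → # (_∈? ys) ≤ length ys
  #-∈ ys = ∑-∈? (Uniq.allFin⁺ n) ys

  #-⊆ : (P? : Decidable P) → ∀ ys → (∀ {x} → P x → x ∈ ys) → # P? ≤ length ys
  #-⊆ P? ys f = ≤-trans (#-mono P? (_∈? ys) f) (#-∈ ys)

  elements : Decidable P → List V
  elements P? = filter P? 𝕍

  length-elements : (P? : Decidable P) → length (elements P?) ≡ # P?
  length-elements P? = length-filter P? 𝕍

  ∈-elements⁺ : (P? : Decidable P) → ∀ {x} → P x → x ∈ elements P?
  ∈-elements⁺ P? = ∈-filter⁺ P? (∈-allFin _)

  ∈-elements⁻ : (P? : Decidable P) → ∀ {x} → x ∈ elements P? → P x
  ∈-elements⁻ P? x∈ = proj₂ (∈-filter⁻ P? {xs = 𝕍} x∈)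

  elements-unique : (P? : Decidable P) → Unique (elements P?)
  elements-unique P? = Uniq.filter⁺ P? (Uniq.allFin⁺ n)

  length≤# : (P? : Decidable P) → ∀ {xs} → Unique xs → (∀ {x} → x ∈ xs → P x) → length xs ≤ # P?
  length≤# P? {xs} u f = begin
    length xs ≡⟨ trans (sym (*-identityʳ _)) (sym (∑-const xs 1)) ⟩
    ∑ xs (λ _ → 1) ≤⟨ ∑-mono∈ xs (λ {x} x∈ → ≤-reflexive (sym (𝟙-yes (x ∈? elements P?) (∈-elements⁺ P? (f x∈))))) ⟩
    ∑ xs (λ x → 𝟙 (x ∈? elements P?)) ≤⟨ ∑-∈? u (elements P?) ⟩
    length (elements P?) ≡⟨ length-elements P? ⟩
    # P? ∎
    where open ≤-Reasoning

  -- The step to which all greedy choices below reduce: there are more options than forbidden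
  -- vertices.
  pickFrom : ∀ {xs : List V} → Unique xs → ∀ ys → length ys < length xs → ∃ λ x → x ∈ xs × x ∉ ys
  pickFrom {xs} u ys ys<xs with Any.any? (λ x → ¬? (x ∈? ys)) xs
  ... | yes p = find p
  pickFrom {xs} u ys ys<xs | no ¬p = contradiction ys<xs (≤⇒≯ (begin
    length xs ≡⟨ trans (sym (*-identityʳ _)) (sym (∑-const xs 1)) ⟩
    ∑ xs (λ _ → 1) ≤⟨ ∑-mono∈ xs (λ {x} x∈ → ≤-reflexive (sym (𝟙-yes (x ∈? ys) (member x∈)))) ⟩
    ∑ xs (λ x → 𝟙 (x ∈? ys))    ≤⟨ ∑-∈? u ys ⟩
    length ys ∎))
    where
    open ≤-Reasoning
    member : ∀ {x} → x ∈ xs → x ∈ ys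
    member {x} x∈ with x ∈? ys
    ... | yes p = p
    ... | no q  = contradiction (lose x∈ q) ¬p

  pick : (P? : Decidable P) → ∀ ys → length ys < # P? → ∃ λ x → P x × x ∉ ys
  pick P? ys lt with pickFrom (elements-unique P?) ys (subst (length ys <_) (sym (length-elements P?)) lt)
  ... | x , x∈ , x∉ = x , ∈-elements⁻ P? x∈ , x∉

  pickMany : (P? : Decidable P) → ∀ k → k ≤ # P? →
             ∃ λ xs → length xs ≡ k × Unique xs × (∀ {x} → x ∈ xs → P x)
  pickMany P? zero    _  = [] , refl , [] , λ ()
  pickMany P? (suc k) lt with pickMany P? k (≤-trans (n≤1+n k) lt)
  ... | xs , refl , u , f with pick P? xs lt
  ...   | x , px , x∉xs = x ∷ xs , refl , All.tabulate (λ { y∈ refl → x∉xs y∈ }) ∷ u ,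
                          λ { (here refl) → px ; (there p) → f p }

  #-minus : (P? : Decidable P) → ∀ ys → # P? ≤ # (λ x → P? x ×-dec ¬? (x ∈? ys)) + length ys
  #-minus {P} P? ys = ≤-trans (#-⊎ P? (λ x → P? x ×-dec ¬? (x ∈? ys)) (_∈? ys) split)
                          (+-monoʳ-≤ _ (#-∈ ys))
    where
    split : ∀ {x} → P x → (P x × x ∉ ys) ⊎ x ∈ ys
    split {x} px with x ∈? ys
    ... | yes p = inj₂ p
    ... | no q  = inj₁ (px , q)

  #-pos : (P? : Decidable P) → ∀ {x} → P x → 1 ≤ # P?
  #-pos P? {x} px = ≤-trans (≤-reflexive (sym (𝟙-yes (P? x) px))) (∑-∈≤ (λ x → 𝟙 (P? x)) (∈-allFin x))

-- Duplicate-free lists, and independent sets in digraphs of bounded out-degree.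

Unique-resp-↭ : ∀ {xs ys : List A} → xs ↭ ys → Unique xs → Unique ys
Unique-resp-↭ p = PermS.Unique-resp-↭ (setoid _) (↭⇒↭ₛ p)

Unique-∷ : ∀ {x : A} {xs} → x ∉ xs → Unique xs → Unique (x ∷ xs)
Unique-∷ x∉xs u = All.tabulate (λ { y∈ refl → x∉xs y∈ }) ∷ u

allPairs-∈ : ∀ {R : A → A → Set} → (∀ {x y} → R x y → R y x) →
             ∀ {xs x y} → AllPairs R xs → x ∈ xs → y ∈ xs → x ≡ y ⊎ R x y
allPairs-∈ s (r ∷ rs) (here refl) (here refl) = inj₁ refl
allPairs-∈ s (r ∷ rs) (here refl) (there y∈)  = inj₂ (All.lookup r y∈)
allPairs-∈ s (r ∷ rs) (there x∈)  (here refl) = inj₂ (s (All.lookup r x∈))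
allPairs-∈ s (r ∷ rs) (there x∈)  (there y∈)  = allPairs-∈ s rs x∈ y∈

∑-filter≤ : ∀ {P : A → Set} (P? : Decidable P) xs (f : A → ℕ) → ∑ (filter P? xs) f ≤ ∑ xs f
∑-filter≤ P? [] f = z≤n
∑-filter≤ P? (x ∷ xs) f with P? x
... | yes _ = +-monoʳ-≤ (f x) (∑-filter≤ P? xs f)
... | no _  = ≤-trans (∑-filter≤ P? xs f) (m≤n+m _ (f x))

module _ {R : A → A → Set} (R? : ∀ x y → Dec (R x y)) (D : ℕ) where

  private
    far? : ∀ x y → Dec (¬ R x y × ¬ R y x)
    far? x y = ¬? (R? x y) ×-dec ¬? (R? y x)

    split : ∀ x y → 1 ≤ 𝟙 (far? x y) + (𝟙 (R? x y) + 𝟙 (R? y x))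
    split x y with R? x y | R? y x
    ... | yes _ | yes _ = s≤s z≤n
    ... | yes _ | no _  = s≤s z≤n
    ... | no _  | yes _ = s≤s z≤n
    ... | no _  | no _  = s≤s z≤n

    far-many : ∀ k xs x → ∑ xs (λ y → 𝟙 (R? x y)) ≤ D → ∑ xs (λ y → 𝟙 (R? y x)) ≤ D →
               suc k * suc (D + D) ≤ length xs → k * suc (D + D) ≤ length (filter (far? x) xs)
    far-many k xs x out≤D in≤D long = linear 1 (begin
      suc k * suc (D + D) ≤⟨ long ⟩
      length xs ≡⟨ trans (sym (*-identityʳ _)) (sym (∑-const xs 1)) ⟩
      ∑ xs (λ _ → 1) ≤⟨ ∑-mono xs (split x) ⟩
      ∑ xs (λ y → 𝟙 (far? x y) + (𝟙 (R? x y) + 𝟙 (R? y x))) ≡⟨ trans (∑-+ xs _ _) (cong₂ _+_ (sym (length-filter (far? x) xs)) (∑-+ xs _ _)) ⟩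
      length (filter (far? x) xs) + (∑ xs (λ y → 𝟙 (R? x y)) + ∑ xs (λ y → 𝟙 (R? y x)))
        ≤⟨ +-monoʳ-≤ (length (filter (far? x) xs)) (+-mono-≤ out≤D in≤D) ⟩
      length (filter (far? x) xs) + (D + D) ∎)
      (arith k D (length (filter (far? x) xs)))
      where
      open ≤-Reasoning
      arith : ∀ k D l → k * suc (D + D) + (l + (D + D)) + 1 ≡ l + suc k * suc (D + D)
      arith = solve-∀

  -- Averaging yields an element of in-degree at most D; delete its neighbours and repeat.
  independent : ∀ k xs → (∀ {x} → x ∈ xs → ∑ xs (λ y → 𝟙 (R? x y)) ≤ D) → k * suc (D + D) ≤ length xs →
                ∃ λ ys → length ys ≡ k × (∀ {y} → y ∈ ys → y ∈ xs) × AllPairs (λ x y → ¬ R x y × ¬ R y x) ys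
  independent zero    xs out _ = [] , refl , (λ ()) , []
  independent (suc k) xs out long
    with x , x∈ , in≤D ← ∑-pigeonhole xs (λ x → ∑ xs (λ y → 𝟙 (R? y x))) D (≤-trans (s≤s z≤n) long)
           (≤-trans (≤-reflexive (∑-swap xs xs (λ x y → 𝟙 (R? y x))))
             (≤-trans (∑-bound xs _ D out) (≤-reflexive (*-comm (length xs) D))))
    with ys , refl , ys⊆ , free ← independent k (filter (far? x) xs)
           (λ {y} y∈ → ≤-trans (∑-filter≤ (far? x) xs _) (out (proj₁ (∈-filter⁻ (far? x) {xs = xs} y∈))))
           (far-many k xs x (out x∈) in≤D long)
    = x ∷ ys , refl ,
      (λ { (here refl) → x∈ ; (there y∈) → proj₁ (∈-filter⁻ (far? x) {xs = xs} (ys⊆ y∈)) }) ,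
      All.tabulate (λ y∈ → proj₂ (∈-filter⁻ (far? x) {xs = xs} (ys⊆ y∈))) ∷ free

-- Fans, candidates for their triangles, and the greedy choice of expansion vertices.

module Fans {n : ℕ} (H : Fin n → Fin n → Fin n → Set) where

  open Vertices {n}

  record Triangle (c : V) : Set where
    constructor triangle
    field
      {a b p q r} : V
      Hcap : H c a p
      Hcbq : H c b q
      Habr : H a b r

  corners : ∀ {c} → Triangle c → List V
  corners τ = a ∷ b ∷ p ∷ q ∷ r ∷ []
    where open Triangle τ

  -- One duplicate-free list encodes the injectivity of the whole embedding, so that assembling a
  -- fan amounts to permuting lists.
  Fan : ℕ → Set
  Fan t = ∃ λ c → Σ (List (Triangle c)) λ τs → length τs ≡ t × Unique (c ∷ concatMap corners τs)

  -- A pair {u , v} together with sets of possible expansion vertices for the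
  -- three sides of the triangle c u v, listed in some order.
  record Candidate (c : V) : Set where
    field
      u v : V
      S₀ S₁ S₂ : List V
      unique₀ : Unique S₀
      unique₁ : Unique S₁
      unique₂ : Unique S₂
      u≢c : u ≢ c
      v≢c : v ≢ c
      u≢v : u ≢ v
      fresh : ∀ {x} → x ∈ S₀ ++ S₁ ++ S₂ → x ∉ c ∷ u ∷ v ∷ []
      -- The corners are fixed only up to order, so that the three sets can be sorted by size.
      complete : ∀ {x₀ x₁ x₂} → x₀ ∈ S₀ → x₁ ∈ S₁ → x₂ ∈ S₂ →
                       Σ (Triangle c) λ τ → corners τ ↭ u ∷ v ∷ x₀ ∷ x₁ ∷ x₂ ∷ []

    ends sets area : List V
    ends = u ∷ v ∷ []
    sets = S₀ ++ S₁ ++ S₂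
    area = ends ++ sets

  open Candidate

  module _ {c : V} where

    -- Asymmetric: the ends of one candidate against the whole area of the other. The sets of two
    -- candidates may overlap, since distinct representatives are chosen from them later.
    Clash : Candidate c → Candidate c → Set
    Clash κ κ′ = u κ′ ∈ area κ ⊎ v κ′ ∈ area κ

    clash? : ∀ κ κ′ → Dec (Clash κ κ′)
    clash? κ κ′ = (u κ′ ∈? area κ) ⊎-dec (v κ′ ∈? area κ)

    Apart : Candidate c → Candidate c → Set
    Apart κ κ′ = ¬ Clash κ κ′ × ¬ Clash κ′ κ

    apart-sym : ∀ {κ κ′} → Apart κ κ′ → Apart κ′ κ
    apart-sym (p , q) = q , p

    apart-ends : ∀ {κ κ′ x} → Apart κ κ′ → x ∈ ends κ′ → x ∉ area κ
    apart-ends (p , _) (here refl) = p ∘ inj₁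
    apart-ends (p , _) (there (here refl)) = p ∘ inj₂

    ∑-ends : ∀ (κs : List (Candidate c)) f →
             ∑ (concatMap ends κs) f ≡ ∑ κs (λ κ → f (u κ) + f (v κ))
    ∑-ends [] f = refl
    ∑-ends (κ ∷ κs) f = trans (cong (λ z → f (u κ) + (f (v κ) + z)) (∑-ends κs f)) (sym (+-assoc (f (u κ)) _ _))

    module _ {G : V → V → Set} (G? : ∀ x y → Dec (G x y)) (D : ℕ) {P : Candidate c → Set}
             (candidate : ∀ {x y} → G x y → Σ (Candidate c) λ κ → ends κ ≡ x ∷ y ∷ [] × length (area κ) ≤ D × P κ)
             where

      Cover : ℕ → Set
      Cover k = ∃ λ L → length L ≤ k × (∀ {x y} → G x y → x ∈ L ⊎ y ∈ L)

      Small : Candidate c → Set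
      Small κ = length (area κ) ≤ D × P κ

      -- A greedy matching among the good pairs; once it cannot be extended, its ends form a cover.
      matching : ∀ m → (∃ λ κs → length κs ≡ m × Unique (concatMap ends κs) × (∀ {κ} → κ ∈ κs → Small κ))
                     ⊎ Cover (m * 2)
      matching zero = inj₁ ([] , refl , [] , λ ())
      matching (suc m) with matching m
      ... | inj₂ (L , L≤ , cov) = inj₂ (L , ≤-trans L≤ (m≤n+m _ 2) , cov)
      ... | inj₁ (κs , refl , u , small)
        with Fin.any? (λ x → Fin.any? (λ y → G? x y ×-dec ¬? (x ∈? concatMap ends κs) ×-dec ¬? (y ∈? concatMap ends κs)))
      ... | no ¬p = inj₂ (concatMap ends κs , ≤-trans (≤-reflexive (len κs)) (m≤n+m _ 2) , covers)
        where
        len : ∀ κs → length (concatMap (ends {c}) κs) ≡ length κs * 2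
        len [] = refl
        len (κ ∷ κs) = cong (suc ∘ suc) (len κs)
        covers : ∀ {x y} → G x y → x ∈ concatMap ends κs ⊎ y ∈ concatMap ends κs
        covers {x} {y} g with x ∈? concatMap ends κs | y ∈? concatMap ends κs
        ... | yes p | _     = inj₁ p
        ... | no _  | yes q = inj₂ q
        ... | no p  | no q  = contradiction (x , y , g , p , q) ¬p
      ... | yes (x , y , g , x∉ , y∉) with candidate g
      ...   | κ , refl , sm = inj₁ (κ ∷ κs , refl ,
              Unique-∷ (λ { (here p) → u≢v κ p ; (there p) → x∉ p }) (Unique-∷ y∉ u) ,
              λ { (here refl) → sm ; (there p) → small p })

      -- The ends of the candidates are all distinct, so each vertex of `area κ` accounts for at
      -- most one clash.
      clash-degree : ∀ κs → Unique (concatMap ends κs) → (∀ {κ} → κ ∈ κs → Small κ) →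
                     ∀ {κ} → κ ∈ κs → ∑ κs (λ κ′ → 𝟙 (clash? κ κ′)) ≤ D
      clash-degree κs uniq small {κ} κ∈ = begin
        ∑ κs (λ κ′ → 𝟙 (clash? κ κ′)) ≤⟨ ∑-mono κs (λ κ′ → 𝟙-⊎ (clash? κ κ′) (u κ′ ∈? area κ) (v κ′ ∈? area κ) (λ x → x)) ⟩
        ∑ κs (λ κ′ → 𝟙 (u κ′ ∈? area κ) + 𝟙 (v κ′ ∈? area κ))  ≡⟨ ∑-ends κs (λ x → 𝟙 (x ∈? area κ)) ⟨
        ∑ (concatMap ends κs) (λ x → 𝟙 (x ∈? area κ)) ≤⟨ ∑-∈? uniq (area κ) ⟩
        length (area κ) ≤⟨ proj₁ (small κ∈) ⟩
        D ∎
        where open ≤-Reasoning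

      -- The dichotomy behind every cover: a long matching contains `k` pairwise apart candidates,
      -- because the clash digraph has out-degree at most `D`, and a short one covers all good
      -- pairs.
      select : ∀ k → (∃ λ κs → length κs ≡ k × (∀ {κ} → κ ∈ κs → P κ) × AllPairs Apart κs)
                   ⊎ Cover (k * suc (D + D) * 2)
      select k with matching (k * suc (D + D))
      ... | inj₂ cov = inj₂ cov
      ... | inj₁ (κs , len , uniq , small)
        with κs′ , len′ , sub , ap ← independent clash? D k κs (clash-degree κs uniq small) (≤-reflexive (sym len))
        = inj₁ (κs′ , len′ , proj₂ ∘ small ∘ sub , ap)

    representatives : ∀ m (S : Candidate c → List V) (κs : List (Candidate c)) (ys : List V) →
                      (∀ {κ} → κ ∈ κs → Unique (S κ) × m ≤ length (S κ)) → length ys + length κs ≤ m →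
                      ∃ λ xs → Pointwise (λ x κ → x ∈ S κ) xs κs × length xs ≡ length κs × (Unique ys → Unique (xs ++ ys))
    representatives m S [] ys big fits = [] , [] , refl , λ u → u
    representatives m S (κ ∷ κs) ys big fits
      with x , x∈ , x∉ ← pickFrom (proj₁ (big (here refl))) ys
             (≤-trans (s≤s (m≤m+n _ _)) (≤-trans (≤-reflexive (sym (+-suc _ _))) (≤-trans fits (proj₂ (big (here refl))))))
      with xs , xs∈ , len , uniq ← representatives m S κs (x ∷ ys) (big ∘ there) (≤-trans (≤-reflexive (sym (+-suc _ _))) fits)
      = x ∷ xs , x∈ ∷ xs∈ , cong suc len , λ u → Unique-resp-↭ (Perm.shift x xs ys) (uniq (Unique-∷ x∉ u))

    pointwise-∈ : ∀ {S : Candidate c → List V} {xs κs x} → Pointwise (λ x κ → x ∈ S κ) xs κs → x ∈ xs →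
                  ∃ λ κ → κ ∈ κs × x ∈ S κ
    pointwise-∈ (p ∷ ps) (here refl) = _ , here refl , p
    pointwise-∈ (p ∷ ps) (there x∈) with κ , κ∈ , q ← pointwise-∈ ps x∈ = κ , there κ∈ , q

    triangles : ∀ {κs xs ys zs} → Pointwise (λ x κ → x ∈ S₀ κ) xs κs → Pointwise (λ x κ → x ∈ S₁ κ) ys κs →
                Pointwise (λ x κ → x ∈ S₂ κ) zs κs →
                Σ (List (Triangle c)) λ τs → length τs ≡ length κs ×
                  concatMap corners τs ↭ concatMap ends κs ++ (xs ++ (ys ++ zs))
    triangles [] [] [] = [] , refl , ↭-refl
    triangles {κ ∷ κs} {x ∷ xs} {y ∷ ys} {z ∷ zs} (p ∷ ps) (q ∷ qs) (r ∷ rs)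
      with τ , τ↭ ← complete κ p q r | τs , len , τs↭ ← triangles ps qs rs
      = τ ∷ τs , cong suc len , ↭-trans (Perm.++⁺ τ↭ τs↭)
          (prep _ (prep _ (↭-trans
            (solve 7 (λ x y z e xs ys zs → (x ⊕ (y ⊕ z)) ⊕ (e ⊕ (xs ⊕ (ys ⊕ zs))) ⊜ e ⊕ ((x ⊕ xs) ⊕ ((y ⊕ ys) ⊕ (z ⊕ zs)))) ↭-refl
              (x ∷ []) (y ∷ []) (z ∷ []) (concatMap ends κs) xs ys zs)
            ↭-refl)))
      where open import Algebra.Solver.CommutativeMonoid (Perm.++-commutativeMonoid {A = V})

    -- Ends and representatives cannot collide: `fresh` separates the sets of a candidate from its
    -- own ends and from `c`, and `Apart` separates them from the ends of the others.
    fan : ∀ {κs xs ys zs} → AllPairs Apart κs → Pointwise (λ x κ → x ∈ S₀ κ) xs κs →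
          Pointwise (λ x κ → x ∈ S₁ κ) ys κs → Pointwise (λ x κ → x ∈ S₂ κ) zs κs →
          Unique (xs ++ (ys ++ zs)) → Fan (length κs)
    fan {κs} {xs} {ys} {zs} ap ps qs rs uniq with τs , len , τs↭ ← triangles ps qs rs
      = c , τs , len , Unique-resp-↭ (prep c (↭-sym τs↭)) (Unique-∷ c∉ (Uniq.++⁺ (ends-unique ap) uniq disjoint))
      where
      ∈-ends : ∀ κs {x} → x ∈ concatMap ends κs → ∃ λ κ → κ ∈ κs × x ∈ ends κ
      ∈-ends (κ ∷ κs) (here refl) = κ , here refl , here refl
      ∈-ends (κ ∷ κs) (there (here refl)) = κ , here refl , there (here refl)
      ∈-ends (κ ∷ κs) (there (there x∈)) with κ′ , κ′∈ , p ← ∈-ends κs x∈ = κ′ , there κ′∈ , p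
      ends-unique : ∀ {κs} → AllPairs Apart κs → Unique (concatMap ends κs)
      ends-unique [] = []
      ends-unique {κ ∷ κs} (as ∷ aps) = Unique-∷ (λ { (here p) → u≢v κ p ; (there p) → other (here refl) p })
                                          (Unique-∷ (other (there (here refl))) (ends-unique aps))
        where
        other : ∀ {x} → x ∈ ends κ → x ∉ concatMap ends κs
        other x∈ x∈′ with κ′ , κ′∈ , p ← ∈-ends κs x∈′ = apart-ends {κ} {κ′} (All.lookup as κ′∈) p (∈-++⁺ˡ x∈)
      ∈-sets : ∀ {x} → x ∈ xs ++ (ys ++ zs) → ∃ λ κ → κ ∈ κs × x ∈ sets κ
      ∈-sets x∈ with ∈-++⁻ xs x∈
      ... | inj₁ x∈₀ with κ , κ∈ , p ← pointwise-∈ ps x∈₀ = κ , κ∈ , ∈-++⁺ˡ p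
      ... | inj₂ x∈′ with ∈-++⁻ ys x∈′
      ...   | inj₁ x∈₁ with κ , κ∈ , p ← pointwise-∈ qs x∈₁ = κ , κ∈ , ∈-++⁺ʳ (S₀ κ) (∈-++⁺ˡ p)
      ...   | inj₂ x∈₂ with κ , κ∈ , p ← pointwise-∈ rs x∈₂ = κ , κ∈ , ∈-++⁺ʳ (S₀ κ) (∈-++⁺ʳ (S₁ κ) p)
      disjoint : ∀ {x} → ¬ (x ∈ concatMap ends κs × x ∈ xs ++ (ys ++ zs))
      disjoint (x∈e , x∈s) with κ , κ∈ , p ← ∈-ends κs x∈e | κ′ , κ′∈ , q ← ∈-sets x∈s
        with allPairs-∈ (λ {κ} {κ′} → apart-sym {κ} {κ′}) ap κ∈ κ′∈
      ... | inj₁ refl = fresh κ q (there p)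
      ... | inj₂ a    = apart-ends {κ′} {κ} (apart-sym {κ} {κ′} a) p (∈-++⁺ʳ (ends κ′) q)
      c∉ : c ∉ concatMap ends κs ++ (xs ++ (ys ++ zs))
      c∉ c∈ with ∈-++⁻ (concatMap ends κs) c∈
      ... | inj₂ c∈s with κ , _ , q ← ∈-sets c∈s = fresh κ q (here refl)
      ... | inj₁ c∈e with ∈-ends κs c∈e
      ...   | κ , _ , here p = u≢c κ (sym p)
      ...   | κ , _ , there (here p) = v≢c κ (sym p)

    -- Greedy choice in three rounds; in each round the sets outgrow the vertices already used.
    strong-fan : ∀ {t κs} → length κs ≡ t → AllPairs Apart κs →
                 (∀ {κ} → κ ∈ κs → t ≤ length (S₀ κ) × t + t ≤ length (S₁ κ) × t + t + t ≤ length (S₂ κ)) → Fan t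
    strong-fan {t} {κs} refl ap big
      with xs , xs∈ , xl , xu ← representatives t S₀ κs [] (λ {κ} κ∈ → unique₀ κ , proj₁ (big κ∈)) ≤-refl
      with ys , ys∈ , yl , yu ← representatives (t + t) S₁ κs xs (λ {κ} κ∈ → unique₁ κ , proj₁ (proj₂ (big κ∈)))
                                  (≤-reflexive (cong (_+ t) xl))
      with zs , zs∈ , zl , zu ← representatives (t + t + t) S₂ κs (ys ++ xs) (λ {κ} κ∈ → unique₂ κ , proj₂ (proj₂ (big κ∈)))
                                  (≤-reflexive (cong (_+ t) (trans (length-++ ys) (cong₂ _+_ yl xl))))
      = fan ap xs∈ ys∈ zs∈ (Unique-resp-↭
          (solve 3 (λ x y z → z ⊕ (y ⊕ x) ⊜ x ⊕ (y ⊕ z)) ↭-refl xs ys zs)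
          (zu (yu (Unique-resp-↭ (Perm.++-identityʳ xs) (xu [])))))
      where open import Algebra.Solver.CommutativeMonoid (Perm.++-commutativeMonoid {A = V})

    -- The same greedy choice with sets smaller by one: the vertex s, reserved for κ₀,
    -- does not count as used, because it lies in no other set.
    weak-fan : ∀ {t₁ κ₀ κs s} → let t = suc t₁ in 1 ≤ t₁ → length κs ≡ t₁ → AllPairs Apart (κ₀ ∷ κs) →
               s ∈ S₀ κ₀ → (∀ {κ} → κ ∈ κs → s ∉ sets κ) → (∀ {κ} → κ ∈ κs → t₁ ≤ length (S₀ κ)) →
               (∀ {κ} → κ ∈ κ₀ ∷ κs → t + t₁ ≤ length (S₁ κ) × t + t + t₁ ≤ length (S₂ κ)) → Fan t
    weak-fan {t₁} {κ₀} {κs} {s} 1≤t₁ refl ap s∈ s∉ big₀ big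
      with xs , xs∈ , xl , xu ← representatives t₁ S₀ κs [] (λ {κ} κ∈ → unique₀ κ , big₀ κ∈) ≤-refl
      -- Within `κ₀` the vertex `s` does count as used, since it may lie in `S₁ κ₀` or `S₂ κ₀`; here
      -- `1 ≤ t₁`, that is `t > 1`, provides the missing place.
      with y , y∈ , y∉ ← pickFrom (unique₁ κ₀) (s ∷ xs) (≤-trans (≤-trans (≤-reflexive (cong (suc ∘ suc) xl))
                            (≤-trans (≤-reflexive (+-comm 1 (suc t₁))) (+-monoʳ-≤ (suc t₁) 1≤t₁))) (proj₁ (big (here refl))))
      with ys , ys∈ , yl , yu ← representatives (suc t₁ + t₁) S₁ κs (y ∷ xs)
                                  (λ {κ} κ∈ → unique₁ κ , proj₁ (big (there κ∈))) (≤-reflexive (cong (λ m → suc (m + t₁)) xl))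
      with z , z∈ , z∉ ← pickFrom (unique₂ κ₀) (s ∷ ys ++ y ∷ xs) (≤-trans (s≤s (s≤s (≤-reflexive (trans (length-++ ys) (cong₂ _+_ yl (cong suc xl))))))
                            (≤-trans (≤-reflexive (+-comm 1 (suc (t₁ + suc t₁)))) (≤-trans (+-monoʳ-≤ (suc (t₁ + suc t₁)) 1≤t₁) (proj₂ (big (here refl))))))
      with zs , zs∈ , zl , zu ← representatives (suc t₁ + suc t₁ + t₁) S₂ κs (z ∷ ys ++ y ∷ xs)
                                  (λ {κ} κ∈ → unique₂ κ , proj₂ (big (there κ∈)))
                                  (≤-reflexive (cong (λ m → suc (m + t₁)) (trans (length-++ ys) (cong₂ _+_ yl (cong suc xl)))))
      = fan ap (s∈ ∷ xs∈) (y∈ ∷ ys∈) (z∈ ∷ zs∈) (Unique-resp-↭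
          (solve 6 (λ s x y z Y Z → s ⊕ (Z ⊕ (z ⊕ (Y ⊕ (y ⊕ x)))) ⊜ (s ⊕ x) ⊕ ((y ⊕ Y) ⊕ (z ⊕ Z))) ↭-refl (s ∷ []) xs (y ∷ []) (z ∷ []) ys zs)
          (Unique-∷ s∉all (zu (Unique-∷ (z∉ ∘ there) (yu (Unique-∷ (y∉ ∘ there) (Unique-resp-↭ (Perm.++-identityʳ xs) (xu []))))))))
      where
      open import Algebra.Solver.CommutativeMonoid (Perm.++-commutativeMonoid {A = V})
      s∉all : s ∉ zs ++ z ∷ ys ++ y ∷ xs
      s∉all p with ∈-++⁻ zs p
      ... | inj₁ q with κ , κ∈ , r ← pointwise-∈ zs∈ q = s∉ κ∈ (∈-++⁺ʳ (S₀ κ) (∈-++⁺ʳ (S₁ κ) r))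
      ... | inj₂ (here q) = z∉ (here (sym q))
      ... | inj₂ (there q) with ∈-++⁻ ys q
      ...   | inj₁ q′ with κ , κ∈ , r ← pointwise-∈ ys∈ q′ = s∉ κ∈ (∈-++⁺ʳ (S₀ κ) (∈-++⁺ˡ r))
      ...   | inj₂ (here q′) = y∉ (here (sym q′))
      ...   | inj₂ (there q′) with κ , κ∈ , r ← pointwise-∈ xs∈ q′ = s∉ κ∈ (∈-++⁺ˡ r)

-- Sums over ordered triples, and counting triples covered at every vertex.

module TripleSums {n : ℕ} where

  open Vertices {n}

  ∑³ : (V → V → V → ℕ) → ℕ
  ∑³ f = ∑ 𝕍 λ x → ∑ 𝕍 λ y → ∑ 𝕍 λ z → f x y z

  ∑³-mono : ∀ {f g} → (∀ x y z → f x y z ≤ g x y z) → ∑³ f ≤ ∑³ g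
  ∑³-mono le = ∑-mono 𝕍 λ x → ∑-mono 𝕍 λ y → ∑-mono 𝕍 λ z → le x y z

  ∑³-cong : ∀ {f g} → (∀ x y z → f x y z ≡ g x y z) → ∑³ f ≡ ∑³ g
  ∑³-cong eq = ∑-cong 𝕍 λ x → ∑-cong 𝕍 λ y → ∑-cong 𝕍 λ z → eq x y z

  ∑³-+ : ∀ f g → ∑³ (λ x y z → f x y z + g x y z) ≡ ∑³ f + ∑³ g
  ∑³-+ f g = trans (∑-cong 𝕍 λ x → trans (∑-cong 𝕍 λ y → ∑-+ 𝕍 _ _) (∑-+ 𝕍 _ _)) (∑-+ 𝕍 _ _)

  ∑³-* : ∀ k f → ∑³ (λ x y z → k * f x y z) ≡ k * ∑³ f
  ∑³-* k f = trans (∑-cong 𝕍 λ x → trans (∑-cong 𝕍 λ y → ∑-*ˡ 𝕍 k _) (∑-*ˡ 𝕍 k _)) (∑-*ˡ 𝕍 k _)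

  ∑³-flip : ∀ f → ∑³ (λ x y z → f y x z) ≡ ∑³ f
  ∑³-flip f = ∑-swap 𝕍 𝕍 (λ x y → ∑ 𝕍 λ z → f y x z)

  ∑³-rot : ∀ f → ∑³ (λ x y z → f x z y) ≡ ∑³ f
  ∑³-rot f = ∑-cong 𝕍 λ x → ∑-swap 𝕍 𝕍 (λ y z → f x z y)

  ∑³-cycle : ∀ f → ∑³ (λ x y z → f z x y) ≡ ∑³ f
  ∑³-cycle f = trans (∑³-rot (λ x y z → f y x z)) (∑³-flip f)

  -- Each vertex has at most B heavy partners. A triple with at most one heavy pair has
  -- a vertex in no heavy pair; any other triple is a path of two heavy pairs.
  module _ {Q : V → V → V → Set} (Q? : ∀ x y z → Dec (Q x y z))
           (Q-flip : ∀ {x y z} → Q x y z → Q y x z) (Q-rot : ∀ {x y z} → Q x y z → Q x z y) (B : ℕ)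
           (cover : ∀ c → ∃ λ L → length L ≤ B × (∀ {x y} → Q c x y → x ∈ L ⊎ y ∈ L)) where

    private
      q : V → V → ℕ
      q x y = # (Q? x y)

      Heavy : V → V → Set
      Heavy x y = B < q x y

      heavy? : ∀ x y → Dec (Heavy x y)
      heavy? x y = B <? q x y

      heavy-sym : ∀ {x y} → Heavy x y → Heavy y x
      heavy-sym {x} {y} = subst (B <_) (#-cong (Q? x y) (Q? y x) Q-flip Q-flip)

      light? : ∀ c x y → Dec (Q c x y × ¬ Heavy c x × ¬ Heavy c y)
      light? c x y = Q? c x y ×-dec ¬? (heavy? c x) ×-dec ¬? (heavy? c y)

      α β : V → V → V → ℕ
      α c x y = 𝟙 (light? c x y)
      β c x y = 𝟙 (heavy? c x) * 𝟙 (heavy? c y)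

      -- If `x` is outside the cover of `c`, every `y` completing `c` and `x` lies in the cover; so
      -- there are at most `B` of them and `x` is not heavy.
      heavy-few : ∀ c → # (heavy? c) ≤ B
      heavy-few c with L , L≤ , cov ← cover c = ≤-trans (#-⊆ (heavy? c) L inL) L≤
        where
        inL : ∀ {x} → Heavy c x → x ∈ L
        inL {x} hv with x ∈? L
        ... | yes p = p
        ... | no x∉ = contradiction hv (≤⇒≯ (≤-trans (#-⊆ (Q? c x) L λ Qz → [ (λ p → contradiction p x∉) , id ]′ (cov Qz)) L≤))

      ∑β : ∑³ β ≤ n * (B * B)
      ∑β = begin
        ∑³ β ≡⟨ ∑-cong 𝕍 (λ c → trans (∑-cong 𝕍 λ x → ∑-*ˡ 𝕍 (𝟙 (heavy? c x)) (λ y → 𝟙 (heavy? c y))) (∑-*ʳ 𝕍 (# (heavy? c)) (λ x → 𝟙 (heavy? c x)))) ⟩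
        ∑ 𝕍 (λ c → # (heavy? c) * # (heavy? c)) ≤⟨ ∑-bound 𝕍 _ (B * B) (λ {c} _ → *-mono-≤ (heavy-few c) (heavy-few c)) ⟩
        length 𝕍 * (B * B) ≡⟨ cong (_* (B * B)) length-𝕍 ⟩
        n * (B * B) ∎
        where open ≤-Reasoning

      -- A light triple at `c` has one of its other two vertices in the cover, and that vertex, not
      -- being a heavy partner, has at most `B` completions. This gives `B * B` for either position.
      ∑α : ∑³ α ≤ n * (B * B + B * B)
      ∑α = ≤-trans (∑-bound 𝕍 _ (B * B + B * B) (λ {c} _ → at c)) (≤-reflexive (cong (_* (B * B + B * B)) length-𝕍))
        where
        at : ∀ c → ∑ 𝕍 (λ x → ∑ 𝕍 (λ y → α c x y)) ≤ B * B + B * B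
        at c with L , L≤ , cov ← cover c = begin
          ∑ 𝕍 (λ x → ∑ 𝕍 (λ y → α c x y))
            ≤⟨ ∑-mono 𝕍 (λ x → ∑-mono 𝕍 λ y → 𝟙-⊎ (light? c x y) (first? x y) (first? y x)
                 λ { (Qy , ¬x , ¬y) → [ (λ x∈ → inj₁ (x∈ , Qy , ¬x)) , (λ y∈ → inj₂ (y∈ , Q-rot Qy , ¬y)) ]′ (cov Qy) }) ⟩
          ∑ 𝕍 (λ x → ∑ 𝕍 (λ y → 𝟙 (first? x y) + 𝟙 (first? y x)))
            ≡⟨ trans (∑-cong 𝕍 λ x → ∑-+ 𝕍 _ _) (trans (∑-+ 𝕍 _ _) (cong (∑ 𝕍 (λ x → # (first? x)) +_) (∑-swap 𝕍 𝕍 (λ x y → 𝟙 (first? y x))))) ⟩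
          ∑ 𝕍 (λ x → # (first? x)) + ∑ 𝕍 (λ x → # (first? x))   ≤⟨ +-mono-≤ sum≤ sum≤ ⟩
          B * B + B * B ∎
          where
          open ≤-Reasoning
          first? : ∀ x y → Dec (x ∈ L × Q c x y × ¬ Heavy c x)
          first? x y = (x ∈? L) ×-dec Q? c x y ×-dec ¬? (heavy? c x)
          row : ∀ x → # (first? x) ≤ 𝟙 (x ∈? L) * B
          row x with x ∈? L | heavy? c x
          ... | no _  | _ = ≤-reflexive (∑-zero 𝕍)
          ... | yes _ | yes hv = ≤-trans (∑-mono 𝕍 λ y → 𝟙≤ (yes _ ×-dec Q? c x y ×-dec no _) λ { (_ , _ , ¬hv) → contradiction hv ¬hv })
                                  (≤-trans (≤-reflexive (∑-zero 𝕍)) z≤n)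
          ... | yes _ | no ¬hv = ≤-trans (∑-mono 𝕍 λ y → 𝟙-mono (yes _ ×-dec Q? c x y ×-dec yes _) (Q? c x y) (proj₁ ∘ proj₂))
                                  (≤-trans (≮⇒≥ ¬hv) (≤-reflexive (sym (+-identityʳ B))))
          sum≤ : ∑ 𝕍 (λ x → # (first? x)) ≤ B * B
          sum≤ = ≤-trans (∑-mono 𝕍 row) (≤-trans (≤-reflexive (∑-*ʳ 𝕍 B _)) (*-monoˡ-≤ B (≤-trans (#-∈ L) L≤)))

      one : ∀ {A : Set} (a? : Dec A) → A → ∀ {m} → 𝟙 a? ≤ m → 1 ≤ m
      one a? a = subst (_≤ _) (𝟙-yes a? a)

      six : ∀ c x y → 𝟙 (Q? c x y) ≤ (α c x y + (α x c y + α y c x)) + (β c x y + (β x c y + β y c x))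
      six c x y = 𝟙≤ (Q? c x y) go
        where
        S = (α c x y + (α x c y + α y c x)) + (β c x y + (β x c y + β y c x))
        pre : ∀ {m} → m ≤ α c x y + (α x c y + α y c x) → m ≤ S
        pre le = ≤-trans le (m≤m+n (α c x y + (α x c y + α y c x)) (β c x y + (β x c y + β y c x)))
        post : ∀ {m} → m ≤ β c x y + (β x c y + β y c x) → m ≤ S
        post le = ≤-trans le (m≤n+m (β c x y + (β x c y + β y c x)) (α c x y + (α x c y + α y c x)))
        1st : ∀ k l m → k ≤ k + (l + m)
        1st k l m = m≤m+n k (l + m)
        2nd : ∀ k l m → l ≤ k + (l + m)
        2nd k l m = ≤-trans (m≤m+n l m) (m≤n+m (l + m) k)
        3rd : ∀ k l m → m ≤ k + (l + m)
        3rd k l m = ≤-trans (m≤n+m m l) (m≤n+m (l + m) k)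
        path : ∀ z {u v} → Heavy z u → Heavy z v → 1 ≤ β z u v
        path z {u} {v} p q = ≤-reflexive (sym (cong₂ _*_ (𝟙-yes (heavy? z u) p) (𝟙-yes (heavy? z v) q)))
        go : Q c x y → 1 ≤ S
        go Qy = decide (heavy? c x) (heavy? c y) (heavy? x y)
          where
          decide : Dec (Heavy c x) → Dec (Heavy c y) → Dec (Heavy x y) → 1 ≤ S
          decide (yes p) (yes q) _ = ≤-trans (path c p q) (post (1st (β c x y) (β x c y) (β y c x)))
          decide (yes p) (no _)  (yes r) = ≤-trans (path x (heavy-sym p) r) (post (2nd (β c x y) (β x c y) (β y c x)))
          decide (no _)  (yes q) (yes r) = ≤-trans (path y (heavy-sym q) (heavy-sym r)) (post (3rd (β c x y) (β x c y) (β y c x)))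
          decide (no p)  (no q)  _ = one (light? c x y) (Qy , p , q) (pre (1st (α c x y) (α x c y) (α y c x)))
          decide (no p)  (yes _) (no r)  = one (light? x c y) (Q-flip Qy , p ∘ heavy-sym , r) (pre (2nd (α c x y) (α x c y) (α y c x)))
          decide (yes _) (no q)  (no r)  = one (light? y c x) (Q-flip (Q-rot Qy) , q ∘ heavy-sym , r ∘ heavy-sym) (pre (3rd (α c x y) (α x c y) (α y c x)))

    -- Per vertex, three rotations of `α` cost `2 * (B * B)` each and three of `β` cost `B * B`
    -- each; hence the factor 9.
    covered-count : ∑³ (λ x y z → 𝟙 (Q? x y z)) ≤ 9 * (B * B) * n
    covered-count = begin
      ∑³ (λ x y z → 𝟙 (Q? x y z)) ≤⟨ ∑³-mono six ⟩
      ∑³ (λ c x y → (α c x y + (α x c y + α y c x)) + (β c x y + (β x c y + β y c x)))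
        ≡⟨ trans (∑³-+ _ _) (cong₂ _+_ (thrice α) (thrice β)) ⟩
      (∑³ α + (∑³ α + ∑³ α)) + (∑³ β + (∑³ β + ∑³ β)) ≤⟨ +-mono-≤ (+-mono-≤ ∑α (+-mono-≤ ∑α ∑α)) (+-mono-≤ ∑β (+-mono-≤ ∑β ∑β)) ⟩
      _ ≡⟨ arith n (B * B) ⟩
      9 * (B * B) * n ∎
      where
      open ≤-Reasoning
      thrice : ∀ f → ∑³ (λ c x y → f c x y + (f x c y + f y c x)) ≡ ∑³ f + (∑³ f + ∑³ f)
      thrice f = trans (∑³-+ f _) (cong (∑³ f +_) (trans (∑³-+ _ _) (cong₂ _+_ (∑³-flip f) (∑³-cycle f))))
      arith : ∀ n b → (n * (b + b) + (n * (b + b) + n * (b + b))) + (n * b + (n * b + n * b)) ≡ 9 * b * n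
      arith = solve-∀

-- Exact counts, Markov's inequality and homogeneous subsets.

module _ {n : ℕ} where

  open Vertices {n}

  unique-⊆ : ∀ {xs ys : List V} → Unique xs → (∀ {x} → x ∈ xs → x ∈ ys) → length xs ≤ length ys
  unique-⊆ {xs} {ys} u sub = begin
    length xs ≡⟨ trans (sym (*-identityʳ _)) (sym (∑-const xs 1)) ⟩
    ∑ xs (λ _ → 1) ≤⟨ ∑-mono∈ xs (λ {x} x∈ → ≤-reflexive (sym (𝟙-yes (x ∈? ys) (sub x∈)))) ⟩
    ∑ xs (λ x → 𝟙 (x ∈? ys))   ≤⟨ ∑-∈? u ys ⟩
    length ys ∎
    where open ≤-Reasoning

  module _ {P : V → Set} (P? : Decidable P) where

    #-full : ∀ {xs} → Unique xs → (∀ {x} → x ∈ xs → P x) → # P? ≤ length xs → ∀ {x} → P x → x ∈ xs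
    #-full {xs} u sub le {x} px with x ∈? xs
    ... | yes p = p
    ... | no q  = contradiction (length≤# P? (Unique-∷ q u) λ { (here refl) → px ; (there p) → sub p }) (≤⇒≯ le)

    #-exhausts : ∀ {xs} → (∀ {x} → P x → x ∈ xs) → length xs ≤ # P? → ∀ {x} → x ∈ xs → P x
    #-exhausts {xs} sub le {x} x∈ with P? x
    ... | yes p = p
    ... | no q  = contradiction
      (unique-⊆ (Unique-∷ (q ∘ ∈-elements⁻ P?) (elements-unique P?)) λ { (here refl) → x∈ ; (there p) → sub (∈-elements⁻ P? p) })
      (≤⇒≯ (≤-trans le (≤-reflexive (sym (length-elements P?)))))

    ∑-sub : ∀ {xs} → Unique xs → ∑ xs (λ x → 𝟙 (P? x)) ≤ # P?
    ∑-sub {xs} u = ≤-trans (≤-reflexive (sym (length-filter P? xs)))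
      (length≤# P? (Uniq.filter⁺ P? u) λ x∈ → proj₂ (∈-filter⁻ P? {xs = xs} x∈))

  markov : ∀ (f : V → ℕ) k → # (λ x → k ≤? f x) * k ≤ ∑ 𝕍 f
  markov f k = ≤-trans (≤-reflexive (sym (∑-*ʳ 𝕍 k _))) (∑-mono 𝕍 point)
    where
    point : ∀ x → 𝟙 (k ≤? f x) * k ≤ f x
    point x with k ≤? f x
    ... | yes p = ≤-trans (≤-reflexive (+-identityʳ k)) p
    ... | no _  = z≤n

  filter-partition : ∀ {P : V → Set} (P? : Decidable P) zs →
                     length zs ≡ length (filter P? zs) + length (filter (λ x → ¬? (P? x)) zs)
  filter-partition P? [] = refl
  filter-partition P? (z ∷ zs) with P? z
  ... | yes _ = cong suc (filter-partition P? zs)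
  ... | no _  = trans (cong suc (filter-partition P? zs)) (sym (+-suc _ _))

  majority : ∀ {P : V → Set} (P? : Decidable P) zs →
             length zs ≤ 2 * length (filter P? zs) ⊎ length zs ≤ 2 * length (filter (λ x → ¬? (P? x)) zs)
  majority P? zs with ≤-total (length (filter P? zs)) (length (filter (λ x → ¬? (P? x)) zs))
  ... | inj₁ le = inj₂ (≤-trans (≤-reflexive (filter-partition P? zs)) (+-mono-≤ le (m≤m+n _ 0)))
  ... | inj₂ le = inj₁ (≤-trans (≤-reflexive (filter-partition P? zs)) (+-monoʳ-≤ _ (≤-trans le (m≤m+n _ 0))))

  module _ {R : V → V → Set} (R? : ∀ l x → Dec (R l x)) where

    Homogeneous : List V → List V → Set
    Homogeneous ls xs = ∃ λ ys → Unique ys × (∀ {y} → y ∈ ys → y ∈ xs) × length xs ≤ 2 ^ length ls * length ys ×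
                          (∀ {l x y} → l ∈ ls → x ∈ ys → y ∈ ys → R l x → R l y)

    -- Each `l` keeps the majority side of `R l`, which costs a factor 2. The purpose is to give
    -- many vertices the same neighbourhood.
    homogeneous : ∀ ls xs → Unique xs → Homogeneous ls xs
    homogeneous [] xs u = xs , u , id , ≤-reflexive (sym (+-identityʳ _)) , λ ()
    homogeneous (l ∷ ls) xs u = halve (homogeneous ls xs u)
      where
      no? : Decidable (λ x → ¬ R l x)
      no? x = ¬? (R? l x)
      double : ∀ {p a b} → length xs ≤ p * a → a ≤ 2 * b → length xs ≤ 2 * p * b
      double {p} {a} {b} le a≤ = ≤-trans le (≤-trans (*-monoʳ-≤ p a≤) (≤-reflexive (arith p b)))
        where
        arith : ∀ p b → p * (2 * b) ≡ 2 * p * b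
        arith = solve-∀
      halve : Homogeneous ls xs → Homogeneous (l ∷ ls) xs
      halve (zs , u , sub , big , hom) with majority (R? l) zs
      ... | inj₁ le = filter (R? l) zs , Uniq.filter⁺ (R? l) u , sub ∘ proj₁ ∘ ∈-filter⁻ (R? l) {xs = zs} , double {2 ^ length ls} big le ,
                      λ { (here refl) p q r → proj₂ (∈-filter⁻ (R? l) {xs = zs} q)
                        ; (there l∈) p q → hom l∈ (proj₁ (∈-filter⁻ (R? l) {xs = zs} p)) (proj₁ (∈-filter⁻ (R? l) {xs = zs} q)) }
      ... | inj₂ le = filter no? zs , Uniq.filter⁺ no? u , sub ∘ proj₁ ∘ ∈-filter⁻ no? {xs = zs} , double {2 ^ length ls} big le ,
                      λ { (here refl) p q r → contradiction r (proj₂ (∈-filter⁻ no? {xs = zs} p))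
                        ; (there l∈) p q → hom l∈ (proj₁ (∈-filter⁻ no? {xs = zs} p)) (proj₁ (∈-filter⁻ no? {xs = zs} q)) }

  ∑-zero-∈ : ∀ (xs : List V) (f : V → ℕ) → ∑ xs f < length xs → ∃ λ x → x ∈ xs × f x ≡ 0
  ∑-zero-∈ (x ∷ xs) f lt with f x in eq
  ... | zero  = x , here refl , eq
  ... | suc k with y , y∈ , p ← ∑-zero-∈ xs f (≤-trans (s≤s (m≤n+m _ k)) (s≤s⁻¹ lt)) = y , there y∈ , p

-- Triples with one vertex of each class.

is : Fin 3 → Fin 3 → ℕ
is i j = 𝟙 (i Fin.≟ j)

-- The classes 0, 1, 2 will be the kernel, the exceptional and the plain vertices. The sum runs over
-- the six orders of a triple, at most one of which shows the classes in the order 0, 1, 2.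
pattern₀₁₂ patterns : Fin 3 → Fin 3 → Fin 3 → ℕ
pattern₀₁₂ i j k = is i 0F * is j 1F * is k 2F
patterns i j k = pattern₀₁₂ i j k + (pattern₀₁₂ i k j + (pattern₀₁₂ j i k + (pattern₀₁₂ j k i + (pattern₀₁₂ k i j + pattern₀₁₂ k j i))))

patterns-exclusive : ∀ i j k → patterns i j k ≡ 0 ⊎
                     (patterns i j k ≤ 1 × i ≢ j × i ≢ k × j ≢ k × (i ≡ 0F ⊎ j ≡ 0F ⊎ k ≡ 0F))
patterns-exclusive = from-yes (Fin.all? λ i → Fin.all? λ j → Fin.all? λ k → (patterns i j k ≟ 0) ⊎-dec
  ((patterns i j k ≤? 1) ×-dec ¬? (i Fin.≟ j) ×-dec ¬? (i Fin.≟ k) ×-dec ¬? (j Fin.≟ k) ×-dec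
    ((i Fin.≟ 0F) ⊎-dec (j Fin.≟ 0F) ⊎-dec (k Fin.≟ 0F))))

-- All that matters about these constants is that they depend on t alone.
module Constants (t : ℕ) where

  t₁ 2t 3t K D₀ D₁ : ℕ
  t₁ = pred t
  2t = t + t
  3t = t + t + t
  -- A fan with `t` triangles has `5 * t + 1` vertices, so a codegree above `K` leaves room for any
  -- greedy choice inside a fan.
  K  = 6 * t + 6
  D₀ = 2 + (t + (2t + 3t))
  D₁ = 2 + (t₁ + (t + t₁ + (2t + t₁)))

  -- Opaque, with only the defining equations released, so that type checking never unfolds the
  -- constants.
  abstract
    B₀ B₁ C₃ C₇ C₆ C₀ C₈ CY C₉ C₁₀ : ℕ
    B₀ = t * suc (D₀ + D₀) * 2
    B₁ = t₁ * suc (D₁ + D₁) * 2 + (3 + (t + t₁ + (2t + t₁)) + (3t + (3t + 3t)))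
    C₃ = 36 * (t * t) + 54 * (B₀ * B₀)
    C₇ = B₁ + B₁ * 3t
    C₆ = C₃ + (9 * (B₀ * B₀) + (C₃ + C₃ * K)) + (C₇ + C₇)
    C₀ = 2 * suc C₆
    C₈ = B₀ + C₀
    CY = 4 * 2 ^ C₀
    C₉ = C₆ * CY * suc C₈
    C₁₀ = 2 * suc C₉

    B₀-def : B₀ ≡ t * suc (D₀ + D₀) * 2
    B₀-def = refl
    B₁-def : B₁ ≡ t₁ * suc (D₁ + D₁) * 2 + (3 + (t + t₁ + (2t + t₁)) + (3t + (3t + 3t)))
    B₁-def = refl
    C₃-def : C₃ ≡ 36 * (t * t) + 54 * (B₀ * B₀)
    C₃-def = refl
    C₇-def : C₇ ≡ B₁ + B₁ * 3t
    C₇-def = refl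
    C₆-def : C₆ ≡ C₃ + (9 * (B₀ * B₀) + (C₃ + C₃ * K)) + (C₇ + C₇)
    C₆-def = refl
    C₀-def : C₀ ≡ 2 * suc C₆
    C₀-def = refl
    C₈-def : C₈ ≡ B₀ + C₀
    C₈-def = refl
    CY-def : CY ≡ 4 * 2 ^ C₀
    CY-def = refl
    C₉-def : C₉ ≡ C₆ * CY * suc C₈
    C₉-def = refl
    C₁₀-def : C₁₀ ≡ 2 * suc C₉
    C₁₀-def = refl

record Setting (n t : ℕ) : Set₁ where
  open Vertices {n} using (V)
  field
    H     : V → V → V → Set
    H?    : ∀ x y z → Dec (H x y z)
    flip  : ∀ {x y z} → H x y z → H y x z
    rot   : ∀ {x y z} → H x y z → H x z y
    irr   : ∀ {x y z} → H x y z → x ≢ y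
    1<t   : 1 < t
    free  : ¬ Fans.Fan H t

-- Codegrees, and covers of the strong and weak pairs in a link.

module Core {n t : ℕ} (𝒮 : Setting n t) where

  open Setting 𝒮 public
  open Vertices {n} public
  open Fans H public
  open TripleSums {n}
  open Constants t public
  open Candidate

  t≡ : t ≡ suc t₁
  t≡ = sym (suc-pred t {{>-nonZero (<⇒≤ 1<t)}})

  1≤t₁ : 1 ≤ t₁
  1≤t₁ = s≤s⁻¹ (≤-trans 1<t (≤-reflexive t≡))

  irr′ : ∀ {x y z} → H x y z → x ≢ z
  irr′ = irr ∘ rot

  irr″ : ∀ {x y z} → H x y z → y ≢ z
  irr″ = irr′ ∘ flip

  d : V → V → ℕ
  d x y = # (H? x y)

  d-sym : ∀ x y → d x y ≡ d y x
  d-sym x y = #-cong (H? x y) (H? y x) flip flip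

  off? : ∀ x y ws → Decidable (λ z → H x y z × z ∉ ws)
  off? x y ws z = H? x y z ×-dec ¬? (z ∈? ws)

  d-off : ∀ x y ws → d x y ≤ # (off? x y ws) + length ws
  d-off x y ws = #-minus (H? x y) ws

  d-off₁ : ∀ x y w → d x y ≤ suc (# (off? x y (w ∷ [])))
  d-off₁ x y w = ≤-trans (d-off x y (w ∷ [])) (≤-reflexive (+-comm _ 1))

  module _ {c : V} where

    swap₀₁ swap₁₂ : Candidate c → Candidate c
    swap₀₁ κ = record
      { Candidate κ ; S₀ = S₁ κ ; S₁ = S₀ κ ; unique₀ = unique₁ κ ; unique₁ = unique₀ κ
      ; fresh    = fresh κ ∘ Perm.∈-resp-↭ (Perm.shifts (S₁ κ) (S₀ κ))
      ; complete = λ p q r → let τ , τ↭ = complete κ q p r in τ , ↭-trans τ↭ (prep _ (prep _ (swap _ _ ↭-refl)))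
      }
    swap₁₂ κ = record
      { Candidate κ ; S₁ = S₂ κ ; S₂ = S₁ κ ; unique₁ = unique₂ κ ; unique₂ = unique₁ κ
      ; fresh    = fresh κ ∘ Perm.∈-resp-↭ (Perm.++⁺ˡ (S₀ κ) (Perm.++-comm (S₂ κ) (S₁ κ)))
      ; complete = λ p q r → let τ , τ↭ = complete κ p r q in τ , ↭-trans τ↭ (prep _ (prep _ (prep _ (swap _ _ ↭-refl))))
      }

    Sizes : ℕ → ℕ → ℕ → Candidate c → Set
    Sizes i j k κ = length (S₀ κ) ≡ i × length (S₁ κ) ≡ j × length (S₂ κ) ≡ k

    length-area : ∀ {i j k κ} → Sizes i j k κ → length (area κ) ≡ 2 + (i + (j + k))
    length-area {κ = κ} (refl , refl , refl) =
      cong (2 +_) (trans (length-++ (S₀ κ)) (cong (length (S₀ κ) +_) (length-++ (S₁ κ))))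

    mkCandidate : ∀ {u v} → u ≢ c → v ≢ c → u ≢ v → ∀ {A B C} → Unique A → Unique B → Unique C →
                  (∀ {x} → x ∈ A → H c u x × x ≢ v) → (∀ {x} → x ∈ B → H c v x × x ≢ u) →
                  (∀ {x} → x ∈ C → H u v x × x ≢ c) → Candidate c
    mkCandidate {u} {v} u≢c v≢c u≢v {A} {B} {C} uA uB uC fA fB fC = record
      { u = u ; v = v ; S₀ = A ; S₁ = B ; S₂ = C ; unique₀ = uA ; unique₁ = uB ; unique₂ = uC
      ; u≢c = u≢c ; v≢c = v≢c ; u≢v = u≢v ; fresh = fresh′
      ; complete = λ p q r → triangle (proj₁ (fA p)) (proj₁ (fB q)) (proj₁ (fC r)) , ↭-refl }
      where
      fresh′ : ∀ {x} → x ∈ A ++ B ++ C → x ∉ c ∷ u ∷ v ∷ []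
      fresh′ x∈ bad with ∈-++⁻ A x∈
      fresh′ x∈ (here refl) | inj₁ p = irr′ (proj₁ (fA p)) refl
      fresh′ x∈ (there (here refl)) | inj₁ p = irr″ (proj₁ (fA p)) refl
      fresh′ x∈ (there (there (here refl))) | inj₁ p = proj₂ (fA p) refl
      ... | inj₂ q with ∈-++⁻ B q
      fresh′ x∈ (here refl) | inj₂ q | inj₁ p = irr′ (proj₁ (fB p)) refl
      fresh′ x∈ (there (here refl)) | inj₂ q | inj₁ p = proj₂ (fB p) refl
      fresh′ x∈ (there (there (here refl))) | inj₂ q | inj₁ p = irr″ (proj₁ (fB p)) refl
      fresh′ x∈ (here refl) | inj₂ q | inj₂ p = proj₂ (fC p) refl
      fresh′ x∈ (there (here refl)) | inj₂ q | inj₂ p = irr′ (proj₁ (fC p)) refl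
      fresh′ x∈ (there (there (here refl))) | inj₂ q | inj₂ p = irr″ (proj₁ (fC p)) refl

    -- Trimming the sets to exact sizes fixes the length of `area`. The last component records the
    -- origin of a set vertex: it comes from the link of a pair at `c`, or from the side `u v` and
    -- then avoids `ws`.
    sizedCandidate : ∀ {u v} → u ≢ c → v ≢ c → u ≢ v → ∀ ws {i j k} → i ≤ # (off? c u (v ∷ [])) →
                     j ≤ # (off? c v (u ∷ [])) → k ≤ # (off? u v (c ∷ ws)) →
                     Σ (Candidate c) λ κ → ends κ ≡ u ∷ v ∷ [] × Sizes i j k κ ×
                       (∀ {x} → x ∈ sets κ → H c u x ⊎ H c v x ⊎ x ∉ ws)
    sizedCandidate {u} {v} u≢c v≢c u≢v ws {i} {j} {k} i≤ j≤ k≤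
      with A , la , uA , fA ← pickMany (off? c u (v ∷ [])) i i≤
         | B , lb , uB , fB ← pickMany (off? c v (u ∷ [])) j j≤
         | C , lc , uC , fC ← pickMany (off? u v (c ∷ ws)) k k≤
      = mkCandidate u≢c v≢c u≢v uA uB uC
          (λ p → proj₁ (fA p) , proj₂ (fA p) ∘ here) (λ p → proj₁ (fB p) , proj₂ (fB p) ∘ here)
          (λ p → proj₁ (fC p) , proj₂ (fC p) ∘ here) ,
        refl , (la , lb , lc) , origin
      where
      origin : ∀ {x} → x ∈ A ++ B ++ C → H c u x ⊎ H c v x ⊎ x ∉ ws
      origin x∈ with ∈-++⁻ A x∈
      ... | inj₁ p = inj₁ (proj₁ (fA p))
      ... | inj₂ q with ∈-++⁻ B q
      ...   | inj₁ p = inj₂ (inj₁ (proj₁ (fB p)))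
      ...   | inj₂ p = inj₂ (inj₂ (proj₂ (fC p) ∘ there))

  -- The three sides of the triangle c u v can be sorted to have at least t, 2t, 3t expansion vertices.
  Strong : V → V → V → Set
  Strong c u v = u ≢ c × v ≢ c × u ≢ v × t ≤ α × t ≤ β × t ≤ γ ×
                 (2t ≤ α ⊎ 2t ≤ β) × (2t ≤ α ⊎ 2t ≤ γ) × (2t ≤ β ⊎ 2t ≤ γ) × (3t ≤ α ⊎ 3t ≤ β ⊎ 3t ≤ γ)
    where
    α = # (off? c u (v ∷ []))
    β = # (off? c v (u ∷ []))
    γ = # (off? u v (c ∷ []))

  strong? : ∀ c u v → Dec (Strong c u v)
  strong? c u v = ¬? (u Fin.≟ c) ×-dec ¬? (v Fin.≟ c) ×-dec ¬? (u Fin.≟ v) ×-dec (t ≤? α) ×-dec (t ≤? β) ×-dec (t ≤? γ)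
    ×-dec ((2t ≤? α) ⊎-dec (2t ≤? β)) ×-dec ((2t ≤? α) ⊎-dec (2t ≤? γ)) ×-dec ((2t ≤? β) ⊎-dec (2t ≤? γ))
    ×-dec ((3t ≤? α) ⊎-dec (3t ≤? β) ⊎-dec (3t ≤? γ))
    where
    α = # (off? c u (v ∷ []))
    β = # (off? c v (u ∷ []))
    γ = # (off? u v (c ∷ []))

  strong-candidate : ∀ {c u v} → Strong c u v →
                     Σ (Candidate c) λ κ → ends κ ≡ u ∷ v ∷ [] × length (area κ) ≤ D₀ × Sizes t 2t 3t κ
  strong-candidate {c} {u} {v} (u≢c , v≢c , u≢v , tα , tβ , tγ , αβ , αγ , βγ , large) = order large αβ αγ βγ
    where
    α = # (off? c u (v ∷ []))
    β = # (off? c v (u ∷ []))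
    γ = # (off? u v (c ∷ []))
    base : ∀ {i j k} → i ≤ α → j ≤ β → k ≤ γ → Σ (Candidate c) λ κ → ends κ ≡ u ∷ v ∷ [] × Sizes i j k κ
    base i j k with κ , e , s , _ ← sizedCandidate u≢c v≢c u≢v [] i j k = κ , e , s
    done : (Σ (Candidate c) λ κ → ends κ ≡ u ∷ v ∷ [] × Sizes t 2t 3t κ) →
           Σ (Candidate c) λ κ → ends κ ≡ u ∷ v ∷ [] × length (area κ) ≤ D₀ × Sizes t 2t 3t κ
    done (κ , e , s) = κ , e , ≤-reflexive (length-area {κ = κ} s) , s
    order : 3t ≤ α ⊎ 3t ≤ β ⊎ 3t ≤ γ → 2t ≤ α ⊎ 2t ≤ β → 2t ≤ α ⊎ 2t ≤ γ → 2t ≤ β ⊎ 2t ≤ γ → _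
    order (inj₂ (inj₂ 3γ)) (inj₂ 2β) _ _ with κ , e , i , j , k ← base tα 2β 3γ = done (κ , e , i , j , k)
    order (inj₂ (inj₂ 3γ)) (inj₁ 2α) _ _ with κ , e , i , j , k ← base 2α tβ 3γ = done (swap₀₁ κ , e , j , i , k)
    order (inj₂ (inj₁ 3β)) _ (inj₂ 2γ) _ with κ , e , i , j , k ← base tα 3β 2γ = done (swap₁₂ κ , e , i , k , j)
    order (inj₂ (inj₁ 3β)) _ (inj₁ 2α) _ with κ , e , i , j , k ← base 2α 3β tγ = done (swap₀₁ (swap₁₂ κ) , e , k , i , j)
    order (inj₁ 3α) _ _ (inj₁ 2β) with κ , e , i , j , k ← base 3α 2β tγ = done (swap₁₂ (swap₀₁ (swap₁₂ κ)) , e , k , j , i)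
    order (inj₁ 3α) _ _ (inj₂ 2γ) with κ , e , i , j , k ← base 3α tβ 2γ = done (swap₁₂ (swap₀₁ κ) , e , j , k , i)

  abstract
    -- `t` pairwise apart strong candidates would form a fan, so `select` can only return the cover.
    strong-cover : ∀ c → ∃ λ L → length L ≤ B₀ × (∀ {u v} → Strong c u v → u ∈ L ⊎ v ∈ L)
    strong-cover c with select (strong? c) D₀ strong-candidate t
    ... | inj₂ (L , L≤ , cov) = L , ≤-trans L≤ (≤-reflexive (sym B₀-def)) , cov
    ... | inj₁ (κs , len , sizes , ap) = contradiction
      (strong-fan len ap λ κ∈ → let i , j , k = sizes κ∈ in ≤-reflexive (sym i) , ≤-reflexive (sym j) , ≤-reflexive (sym k)) free

  -- The weights are 3 + 3 + 0, with the two small sides meeting at `c`, or 2 + 2 + 2. Removing the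
  -- opposite corner leaves `2t - 1` or `3t - 1` expansion vertices on the saturated sides, one
  -- short of what `Strong` asks.
  Weak : V → V → V → Set
  Weak c u v = H c u v × ((d c u ≡ 2t × d c v ≡ 2t × K < d u v) ⊎ (d c u ≡ 3t × d c v ≡ 3t × d u v ≡ 3t))

  weak? : ∀ c u v → Dec (Weak c u v)
  weak? c u v = H? c u v ×-dec
    (((d c u ≟ 2t) ×-dec (d c v ≟ 2t) ×-dec (K <? d u v)) ⊎-dec ((d c u ≟ 3t) ×-dec (d c v ≟ 3t) ×-dec (d u v ≟ 3t)))

  weak-sym : ∀ {c u v} → Weak c u v → Weak c v u
  weak-sym {c} {u} {v} (h , inj₁ (p , q , r)) = rot h , inj₁ (q , p , subst (K <_) (d-sym u v) r)
  weak-sym {c} {u} {v} (h , inj₂ (p , q , r)) = rot h , inj₂ (q , p , trans (sym (d-sym u v)) r)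

  weak≤3t : ∀ {c u v} → Weak c u v → d c u ≤ 3t
  weak≤3t (_ , inj₁ (p , _)) = ≤-trans (≤-reflexive p) (m≤m+n 2t t)
  weak≤3t (_ , inj₂ (p , _)) = ≤-reflexive p

  private
    lower₂ : ∀ {m} → 2t ≤ suc m → t + t₁ ≤ m
    lower₂ le = s≤s⁻¹ (≤-trans (≤-reflexive (trans (sym (+-suc t t₁)) (cong (t +_) (sym t≡)))) le)

    lower₃ : ∀ {m} → 3t ≤ suc m → 2t + t₁ ≤ m
    lower₃ le = s≤s⁻¹ (≤-trans (≤-reflexive (trans (sym (+-suc 2t t₁)) (cong (2t +_) (sym t≡)))) le)

    lowerK : ∀ {m} → K < m + 4 → 2t + t₁ ≤ m
    lowerK {m} lt = ≤-trans (+-monoʳ-≤ 2t (≤-trans (n≤1+n t₁) (≤-reflexive (sym t≡))))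
      (linear (3 * t + 3) lt (arith t m))
      where
      arith : ∀ t m → t + t + t + (m + 4) + (3 * t + 3) ≡ m + suc (6 * t + 6)
      arith = solve-∀

    lower₁ : ∀ {m} → 3t ≤ m + 4 → t₁ ≤ m
    lower₁ {m} le = linear 1 (+-mono-≤ le (+-mono-≤ 1≤t₁ 1≤t₁))
                      (trans (arith t₁ m) (cong (λ t → m + ((t + t + t) + (1 + 1))) (sym t≡)))
      where
      arith : ∀ k m → k + (m + 4 + (k + k)) + 1 ≡ m + ((suc k + suc k + suc k) + (1 + 1))
      arith = solve-∀

    2t≤3t : 2t ≤ 3t
    2t≤3t = m≤m+n 2t t

    K≥3t : ∀ {m} → K < suc m → 3t ≤ suc m
    K≥3t {m} lt = linear (3 * t + 7) lt (arith t m)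
      where
      arith : ∀ t m → t + t + t + suc m + (3 * t + 7) ≡ suc m + suc (6 * t + 6)
      arith = solve-∀

    weak-size₁ : ∀ {c x y} → Weak c x y → t + t₁ ≤ # (off? c y (x ∷ []))
    weak-size₁ {c} {x} {y} (_ , inj₁ (_ , p , _)) = lower₂ (≤-trans (≤-reflexive (sym p)) (d-off₁ c y x))
    weak-size₁ {c} {x} {y} (_ , inj₂ (_ , p , _)) = lower₂ (≤-trans 2t≤3t (≤-trans (≤-reflexive (sym p)) (d-off₁ c y x)))

    weak-size₂ : ∀ {c x y} → Weak c x y → 2t + t₁ ≤ # (off? x y (c ∷ []))
    weak-size₂ {c} {x} {y} (_ , inj₁ (_ , _ , p)) = lower₃ (K≥3t (≤-trans p (d-off₁ x y c)))
    weak-size₂ {c} {x} {y} (_ , inj₂ (_ , _ , p)) = lower₃ (≤-trans (≤-reflexive (sym p)) (d-off₁ x y c))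

  -- `κ₀` expands the side `c x` by `s`, which the second weak edge supplies. Pairs meeting `L₀` are
  -- put aside: if `s`, `x` or `y` lay in the link of `c u`, then `u` would lie in the link of
  -- `c s`, `c x` or `c y`, all contained in `L₀`. On the side `u v` these three vertices are
  -- excluded outright.
  module WeakCover {c x y s : V} (w : Weak c x y) (w′ : Weak c x s) (y≢s : y ≢ s)
    {Y Z : List V} (lY : length Y ≡ t + t₁) (uY : Unique Y) (fY : ∀ {z} → z ∈ Y → H c y z × z ∉ x ∷ [])
    (lZ : length Z ≡ 2t + t₁) (uZ : Unique Z) (fZ : ∀ {z} → z ∈ Z → H x y z × z ∉ c ∷ []) where

    h  = proj₁ w
    h′ = proj₁ w′

    κ₀ : Candidate c
    κ₀ = mkCandidate (irr h ∘ sym) (irr′ h ∘ sym) (irr″ h) {s ∷ []} ([] ∷ []) uY uZ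
           (λ { (here refl) → h′ , y≢s ∘ sym }) (λ p → proj₁ (fY p) , proj₂ (fY p) ∘ here)
           (λ p → proj₁ (fZ p) , proj₂ (fZ p) ∘ here)
    L₀ : List V
    L₀ = area κ₀ ++ (elements (H? c x) ++ (elements (H? c y) ++ elements (H? c s)))
    G : V → V → Set
    G u v = Weak c u v × u ∉ L₀ × v ∉ L₀
    G? : ∀ u v → Dec (G u v)
    G? u v = weak? c u v ×-dec ¬? (u ∈? L₀) ×-dec ¬? (v ∈? L₀)
    P : Candidate c → Set
    P κ = Sizes t₁ (t + t₁) (2t + t₁) κ × s ∉ sets κ × Apart κ₀ κ
    apart : ∀ {u v} κ → ends κ ≡ u ∷ v ∷ [] → G u v → (∀ {z} → z ∈ sets κ → H c u z ⊎ H c v z ⊎ z ∉ x ∷ y ∷ s ∷ []) →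
            s ∉ sets κ × Apart κ₀ κ
    apart {u} {v} κ refl (_ , u∉ , v∉) origin =
      no-s , [ u∉ ∘ ∈-++⁺ˡ , v∉ ∘ ∈-++⁺ˡ ]′ , [ no-x , no-y ]′
      where
      not : ∀ {z} → z ∈ x ∷ y ∷ s ∷ [] → (∀ {w} → H c w z → w ∈ L₀) → z ∉ sets κ
      not z∈ link z∈s with origin z∈s
      ... | inj₁ p = u∉ (link p)
      ... | inj₂ (inj₁ p) = v∉ (link p)
      ... | inj₂ (inj₂ p) = p z∈
      no-s = not (there (there (here refl))) λ p →
        ∈-++⁺ʳ (area κ₀) (∈-++⁺ʳ (elements (H? c x)) (∈-++⁺ʳ (elements (H? c y)) (∈-elements⁺ (H? c s) (rot p))))
      no-x : x ∉ area κ
      no-x (here refl) = u∉ (here refl)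
      no-x (there (here refl)) = v∉ (here refl)
      no-x (there (there p))   = not (here refl) (λ q → ∈-++⁺ʳ (area κ₀) (∈-++⁺ˡ (∈-elements⁺ (H? c x) (rot q)))) p
      no-y : y ∉ area κ
      no-y (here refl) = u∉ (there (here refl))
      no-y (there (here refl)) = v∉ (there (here refl))
      no-y (there (there p))   = not (there (here refl))
        (λ q → ∈-++⁺ʳ (area κ₀) (∈-++⁺ʳ (elements (H? c x)) (∈-++⁺ˡ (∈-elements⁺ (H? c y) (rot q))))) p
    Result : V → V → Set
    Result u v = Σ (Candidate c) λ κ → ends κ ≡ u ∷ v ∷ [] × length (area κ) ≤ D₁ × P κ
    Choice : V → V → ℕ → ℕ → ℕ → Set
    Choice u v i j k = Σ (Candidate c) λ κ → ends κ ≡ u ∷ v ∷ [] × Sizes i j k κ ×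
                         (∀ {z} → z ∈ sets κ → H c u z ⊎ H c v z ⊎ z ∉ x ∷ y ∷ s ∷ [])
    direct : ∀ {u v} → G u v → Choice u v t₁ (t + t₁) (2t + t₁) → Result u v
    direct g (κ , e , sz , origin) = κ , e , ≤-reflexive (length-area {κ = κ} sz) , sz , apart κ e g origin
    rotated : ∀ {u v} → G u v → Choice u v (t + t₁) (2t + t₁) t₁ → Result u v
    rotated {u} {v} g (κ , e , (i , j , k) , origin) = direct g (swap₀₁ (swap₁₂ κ) , e , (k , i , j) ,
      (origin ∘ Perm.∈-resp-↭ (↭-trans (Perm.shifts (S₂ κ) (S₀ κ)) (Perm.++⁺ˡ (S₀ κ) (Perm.++-comm (S₂ κ) (S₁ κ))))))
    candidate : ∀ {u v} → G u v → Result u v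
    candidate {u} {v} g@((h , inj₁ (p , q , r)) , _) = direct g
      (sizedCandidate (irr h ∘ sym) (irr′ h ∘ sym) (irr″ h) (x ∷ y ∷ s ∷ [])
        (≤-trans (m≤n+m t₁ t) (lower₂ (≤-trans (≤-reflexive (sym p)) (d-off₁ c u v))))
        (lower₂ (≤-trans (≤-reflexive (sym q)) (d-off₁ c v u)))
        (lowerK (≤-trans r (d-off u v (c ∷ x ∷ y ∷ s ∷ [])))))
    -- The side `u v` has to avoid four vertices, so here it serves as the smallest set;
    -- `t₁ ≤ 3t - 4` because `t > 1`.
    candidate {u} {v} g@((h , inj₂ (p , q , r)) , _) = rotated g
      (sizedCandidate (irr h ∘ sym) (irr′ h ∘ sym) (irr″ h) (x ∷ y ∷ s ∷ [])
        (lower₂ (≤-trans 2t≤3t (≤-trans (≤-reflexive (sym p)) (d-off₁ c u v))))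
        (lower₃ (≤-trans (≤-reflexive (sym q)) (d-off₁ c v u)))
        (lower₁ (≤-trans (≤-reflexive (sym r)) (d-off u v (c ∷ x ∷ y ∷ s ∷ [])))))
    covered : (∃ λ κs → length κs ≡ t₁ × (∀ {κ} → κ ∈ κs → P κ) × AllPairs Apart κs) ⊎ Cover G? D₁ candidate (t₁ * suc (D₁ + D₁) * 2) →
              ∃ λ L → length L ≤ B₁ × (∀ {u v} → Weak c u v → u ∈ L ⊎ v ∈ L)
    covered (inj₁ (κs , len , all , ap)) = contradiction
      (subst Fan (sym t≡) (weak-fan {κ₀ = κ₀} {κs} {s} 1≤t₁ len (All.tabulate (λ κ∈ → proj₂ (proj₂ (all κ∈))) ∷ ap) (here refl)
        (λ κ∈ → proj₁ (proj₂ (all κ∈))) (λ κ∈ → ≤-reflexive (sym (proj₁ (proj₁ (all κ∈)))))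
        λ { (here refl) → subst₂′ (sym lY) (sym lZ) ; {κ} (there κ∈) → let _ , j , k = proj₁ (all κ∈) in subst₂′ (sym j) (sym k) })) free
      where
      subst₂′ : ∀ {a b} → t + t₁ ≡ a → 2t + t₁ ≡ b → suc t₁ + t₁ ≤ a × suc t₁ + suc t₁ + t₁ ≤ b
      subst₂′ p q = ≤-reflexive (trans (cong (_+ t₁) (sym t≡)) p) , ≤-reflexive (trans (cong (λ t → t + t + t₁) (sym t≡)) q)
    covered (inj₂ (L , L≤ , cov)) = L ++ L₀ , ≤-trans (≤-reflexive (length-++ L)) (≤-trans (+-mono-≤ L≤ L₀≤) (≤-reflexive (sym B₁-def))) , cov′
      where
      E≤ : ∀ {z} → d c z ≤ 3t → length (elements (H? c z)) ≤ 3t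
      E≤ le = ≤-trans (≤-reflexive (length-elements (H? c _))) le
      L₀≤ : length L₀ ≤ 3 + (t + t₁ + (2t + t₁)) + (3t + (3t + 3t))
      L₀≤ = begin
        length L₀ ≡⟨ trans (length-++ (area κ₀)) (cong₂ _+_ (length-area {κ = κ₀} (refl , lY , lZ))
                       (trans (length-++ (elements (H? c x))) (cong (_ +_) (length-++ (elements (H? c y)))))) ⟩
        _ ≤⟨ +-monoʳ-≤ (3 + (t + t₁ + (2t + t₁))) (+-mono-≤ (E≤ (weak≤3t w)) (+-mono-≤ (E≤ (weak≤3t (weak-sym w))) (E≤ (weak≤3t (weak-sym w′))))) ⟩
        _ ∎
        where open ≤-Reasoning
      cov′ : ∀ {u v} → Weak c u v → u ∈ L ++ L₀ ⊎ v ∈ L ++ L₀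
      cov′ {u} {v} w with u ∈? L₀ | v ∈? L₀
      ... | yes p | _     = inj₁ (∈-++⁺ʳ L p)
      ... | no _  | yes q = inj₂ (∈-++⁺ʳ L q)
      ... | no p  | no q with cov (w , p , q)
      ...   | inj₁ r = inj₁ (∈-++⁺ˡ r)
      ...   | inj₂ r = inj₂ (∈-++⁺ˡ r)

  abstract
    weak-cover : ∀ {c x y s} → Weak c x y → Weak c x s → y ≢ s →
                 ∃ λ L → length L ≤ B₁ × (∀ {u v} → Weak c u v → u ∈ L ⊎ v ∈ L)
    weak-cover {c} {x} {y} {s} w w′ y≢s
      with Y , lY , uY , fY ← pickMany (off? c y (x ∷ [])) (t + t₁) (weak-size₁ w)
         | Z , lZ , uZ , fZ ← pickMany (off? x y (c ∷ [])) (2t + t₁) (weak-size₂ w)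
      = covered (select G? D₁ candidate t₁)
      where open WeakCover w w′ y≢s lY uY fY lZ uZ fZ

  -- Discharging.

  1≤t : 1 ≤ t
  1≤t = <⇒≤ 1<t

  private
    t≤2t : t ≤ 2t
    t≤2t = m≤m+n t t
    t<2t : t < 2t
    t<2t = ≤-trans (≤-reflexive (+-comm 1 t)) (+-monoʳ-≤ t 1≤t)
    2t<3t : 2t < 3t
    2t<3t = ≤-trans (≤-reflexive (+-comm 1 2t)) (+-monoʳ-≤ 2t 1≤t)

  3t≤K : 3t ≤ K
  3t≤K = m+n≤o⇒m≤o 3t {3 * t + 6} (≤-reflexive (arith t))
    where
    arith : ∀ t → t + t + t + (3 * t + 6) ≡ 6 * t + 6
    arith = solve-∀

  -- 6, 3, 2 or 0, according to the first of t, 2t, 3t that bounds m.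
  f : ℕ → ℕ
  f m = 3 * 𝟙 (m ≤? t) + (𝟙 (m ≤? 2t) + 2 * 𝟙 (m ≤? 3t))

  data View (m : ℕ) : ℕ → Set where
    at-6 : m ≤ t → View m 6
    at-3 : t < m → m ≤ 2t → View m 3
    at-2 : 2t < m → m ≤ 3t → View m 2
    at-0 : 3t < m → View m 0

  view : ∀ m → View m (f m)
  view m with m ≤? t | m ≤? 2t | m ≤? 3t
  ... | yes p | yes _ | yes _ = at-6 p
  ... | yes p | no q  | _     = contradiction (≤-trans p t≤2t) q
  ... | yes p | yes q | no r  = contradiction (≤-trans q 2t≤3t) r
  ... | no p  | yes q | yes _ = at-3 (≰⇒> p) q
  ... | no p  | yes q | no r  = contradiction (≤-trans q 2t≤3t) r
  ... | no p  | no q  | yes r = at-2 (≰⇒> q) r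
  ... | no p  | no q  | no r  = at-0 (≰⇒> r)

  private
    split₁ : ∀ m → t < m ⊎ 6 ≤ f m
    split₁ m with f m | view m
    ... | _ | at-6 _   = inj₂ ≤-refl
    ... | _ | at-3 p _ = inj₁ p
    ... | _ | at-2 p _ = inj₁ (<-trans t<2t p)
    ... | _ | at-0 p   = inj₁ (<-trans t<2t (<-trans 2t<3t p))

    split₂ : ∀ m → 2t < m ⊎ 3 ≤ f m
    split₂ m with f m | view m
    ... | _ | at-6 _   = inj₂ (m≤m+n 3 3)
    ... | _ | at-3 _ _ = inj₂ ≤-refl
    ... | _ | at-2 p _ = inj₁ p
    ... | _ | at-0 p   = inj₁ (<-trans 2t<3t p)

    split₃ : ∀ m → 3t < m ⊎ 2 ≤ f m
    split₃ m with f m | view m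
    ... | _ | at-6 _   = inj₂ (m≤m+n 2 4)
    ... | _ | at-3 _ _ = inj₂ (m≤m+n 2 1)
    ... | _ | at-2 _ _ = inj₂ ≤-refl
    ... | _ | at-0 p   = inj₁ p

  Nice : ℕ → Set
  Nice m = m ≡ t ⊎ m ≡ 2t ⊎ m ≡ 3t

  nice? : ∀ m → Dec (Nice m)
  nice? m = (m ≟ t) ⊎-dec (m ≟ 2t) ⊎-dec (m ≟ 3t)

  -- The products `t * 6`, `2t * 3` and `3t * 2` are the only tight cases; any other codegree, a
  -- large one included, leaves at least one unit unpaid. The indicator keeps this unit for the
  -- stability argument.
  capacity : ∀ m → m * f m + 𝟙 (¬? (nice? m)) ≤ 6 * t
  capacity m with f m | view m
  ... | _ | at-6 m≤t with nice? m
  ...   | yes _ = ≤-trans (≤-reflexive (trans (+-identityʳ _) (*-comm m 6))) (*-monoʳ-≤ 6 m≤t)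
  ...   | no ¬p = linear 5 (*-monoʳ-≤ 6 (≤∧≢⇒< m≤t (¬p ∘ inj₁))) (arith m t)
    where
    arith : ∀ m t → m * 6 + 1 + 6 * t + 5 ≡ 6 * t + 6 * suc m
    arith = solve-∀
  capacity m | _ | at-3 _ m≤2t with nice? m
  ...   | yes _ = ≤-trans (≤-reflexive (trans (+-identityʳ _) (*-comm m 3))) (≤-trans (*-monoʳ-≤ 3 m≤2t) (≤-reflexive (arith t)))
    where
    arith : ∀ t → 3 * (t + t) ≡ 6 * t
    arith = solve-∀
  ...   | no ¬p = linear 2 (*-monoʳ-≤ 3 (≤∧≢⇒< m≤2t (¬p ∘ inj₂ ∘ inj₁))) (arith m t)
    where
    arith : ∀ m t → m * 3 + 1 + 3 * (t + t) + 2 ≡ 6 * t + 3 * suc m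
    arith = solve-∀
  capacity m | _ | at-2 _ m≤3t with nice? m
  ...   | yes _ = ≤-trans (≤-reflexive (trans (+-identityʳ _) (*-comm m 2))) (≤-trans (*-monoʳ-≤ 2 m≤3t) (≤-reflexive (arith t)))
    where
    arith : ∀ t → 2 * (t + t + t) ≡ 6 * t
    arith = solve-∀
  ...   | no ¬p = linear 1 (*-monoʳ-≤ 2 (≤∧≢⇒< m≤3t (¬p ∘ inj₂ ∘ inj₂))) (arith m t)
    where
    arith : ∀ m t → m * 2 + 1 + 2 * (t + t + t) + 1 ≡ 6 * t + 2 * suc m
    arith = solve-∀
  capacity m | _ | at-0 _ = ≤-trans (+-mono-≤ (≤-reflexive (*-zeroʳ m)) (𝟙≤1 (¬? (nice? m))))
                              (≤-trans 1≤t (m≤m+n t (5 * t)))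

  F : V → V → V → ℕ
  F x y z = f (d x y) + (f (d x z) + f (d y z))

  F-flip : ∀ x y z → F y x z ≡ F x y z
  F-flip x y z = cong₂ _+_ (cong f (d-sym y x)) (+-comm (f (d y z)) _)

  F-rot : ∀ x y z → F x z y ≡ F x y z
  F-rot x y z = trans (cong (λ m → f (d x z) + (f (d x y) + f m)) (d-sym z y)) (arith (f (d x z)) (f (d x y)) (f (d y z)))
    where
    arith : ∀ a b c → a + (b + c) ≡ b + (a + c)
    arith = solve-∀

  Bad Waste : V → V → V → Set
  Bad   x y z = H x y z × F x y z < 6
  Waste x y z = H x y z × 6 < F x y z

  bad? : ∀ x y z → Dec (Bad x y z)
  bad? x y z = H? x y z ×-dec (F x y z <? 6)

  waste? : ∀ x y z → Dec (Waste x y z)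
  waste? x y z = H? x y z ×-dec (6 <? F x y z)

  bad-flip : ∀ {x y z} → Bad x y z → Bad y x z
  bad-flip {x} {y} {z} (h , lt) = flip h , subst (_< 6) (sym (F-flip x y z)) lt

  bad-rot : ∀ {x y z} → Bad x y z → Bad x z y
  bad-rot {x} {y} {z} (h , lt) = rot h , subst (_< 6) (sym (F-rot x y z)) lt

  -- Weight below 6 means that no side pays 6, no two sides pay 3 and not all three pay 2. The
  -- resulting strict inequalities absorb the loss of the opposite corner in `off?`.
  bad⇒strong : ∀ {c u v} → Bad c u v → Strong c u v
  bad⇒strong {c} {u} {v} (h , lt) =
    irr h ∘ sym , irr′ h ∘ sym , irr″ h ,
    lift (one (split₁ (d c u)) λ p → ≤-trans p (m≤m+n _ _)) ,
    lift (one (split₁ (d c v)) λ p → ≤-trans p (≤-trans (m≤m+n _ _) (m≤n+m _ (f (d c u))))) ,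
    lift (one (split₁ (d u v)) λ p → ≤-trans p (≤-trans (m≤n+m _ (f (d c v))) (m≤n+m _ (f (d c u))))) ,
    Sum.map lift lift (two (split₂ (d c u)) (split₂ (d c v)) λ p q → +-mono-≤ p (≤-trans q (m≤m+n _ _))) ,
    Sum.map lift lift (two (split₂ (d c u)) (split₂ (d u v)) λ p q → +-mono-≤ p (≤-trans q (m≤n+m _ (f (d c v))))) ,
    Sum.map lift lift (two (split₂ (d c v)) (split₂ (d u v)) λ p q → ≤-trans (+-mono-≤ p q) (m≤n+m _ (f (d c u)))) ,
    Sum.map lift (Sum.map lift lift) (three (split₃ (d c u)) (split₃ (d c v)) (split₃ (d u v)))
    where
    lift : ∀ {k x y w} → k < d x y → k ≤ # (off? x y (w ∷ []))
    lift {k} {x} {y} {w} p = s≤s⁻¹ (≤-trans p (d-off₁ x y w))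
    one : ∀ {A B : Set} → A ⊎ B → (B → 6 ≤ F c u v) → A
    one (inj₁ a) _ = a
    one (inj₂ b) k = contradiction lt (≤⇒≯ (k b))
    two : ∀ {A B A′ B′ : Set} → A ⊎ B → A′ ⊎ B′ → (B → B′ → 6 ≤ F c u v) → A ⊎ A′
    two (inj₁ a) _ _ = inj₁ a
    two (inj₂ _) (inj₁ a) _  = inj₂ a
    two (inj₂ b) (inj₂ b′) k = contradiction lt (≤⇒≯ (k b b′))
    three : ∀ {A A′ A″ : Set} → A ⊎ 2 ≤ f (d c u) → A′ ⊎ 2 ≤ f (d c v) → A″ ⊎ 2 ≤ f (d u v) → A ⊎ A′ ⊎ A″
    three (inj₁ a) _ _ = inj₁ a
    three (inj₂ _) (inj₁ a) _ = inj₂ (inj₁ a)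
    three (inj₂ _) (inj₂ _) (inj₁ a)  = inj₂ (inj₂ a)
    three (inj₂ p) (inj₂ q) (inj₂ r)  = contradiction lt (≤⇒≯ (+-mono-≤ p (+-mono-≤ q r)))

  -- `W` is what all ordered pairs pay in total. The diagonal is included in `NN` and `W`; it has
  -- only `n` members.
  N° N Wst NN W : ℕ
  N°  = ∑³ (λ x y z → 𝟙 (bad? x y z))
  N   = ∑³ (λ x y z → 𝟙 (H? x y z))
  Wst = ∑³ (λ x y z → 𝟙 (waste? x y z))
  NN  = ∑ 𝕍 λ x → ∑ 𝕍 λ y → 𝟙 (¬? (nice? (d x y)))
  W   = ∑ 𝕍 λ x → ∑ 𝕍 λ y → d x y * f (d x y)

  bad-few : N° ≤ 9 * (B₀ * B₀) * n
  bad-few = covered-count bad? bad-flip bad-rot B₀ λ c →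
    let L , L≤ , cov = strong-cover c in L , L≤ , cov ∘ bad⇒strong

  edge-weight : ∀ x y z → 6 * 𝟙 (H? x y z) + 𝟙 (waste? x y z) ≤ 𝟙 (H? x y z) * F x y z + 6 * 𝟙 (bad? x y z)
  edge-weight x y z with H? x y z
  ... | no _  = z≤n
  ... | yes h = split (6 <? F x y z) (F x y z <? 6)
    where
    split : ∀ (p? : Dec (6 < F x y z)) (q? : Dec (F x y z < 6)) →
            6 + 𝟙 (yes h ×-dec p?) ≤ F x y z + 0 + 6 * 𝟙 (yes h ×-dec q?)
    split (yes p) q? = ≤-trans p (≤-trans (m≤m+n _ 0) (m≤m+n _ _))
    split (no p)  (yes q) = m≤n+m 6 _
    split (no p)  (no q)  = ≤-trans (≮⇒≥ q) (≤-trans (m≤m+n _ 0) (m≤m+n _ 0))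

  weight-sum : ∑³ (λ x y z → 𝟙 (H? x y z) * F x y z) ≡ W + (W + W)
  weight-sum = begin
    ∑³ (λ x y z → h x y z * F x y z)
      ≡⟨ ∑³-cong (λ x y z → trans (*-distribˡ-+ (h x y z) _ _) (cong (h x y z * f (d x y) +_) (*-distribˡ-+ (h x y z) _ _))) ⟩
    ∑³ (λ x y z → h x y z * f (d x y) + (h x y z * f (d x z) + h x y z * f (d y z)))
      ≡⟨ trans (∑³-+ _ _) (cong₂ _+_ first (trans (∑³-+ _ _) (cong₂ _+_ second third))) ⟩
    W + (W + W) ∎
    where
    open ≡-Reasoning
    h : V → V → V → ℕ
    h x y z = 𝟙 (H? x y z)
    first : ∑³ (λ x y z → h x y z * f (d x y)) ≡ W
    first = ∑-cong 𝕍 λ x → ∑-cong 𝕍 λ y → ∑-*ʳ 𝕍 (f (d x y)) (h x y)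
    second : ∑³ (λ x y z → h x y z * f (d x z)) ≡ W
    second = trans (∑³-cong λ x y z → cong (_* f (d x z)) (𝟙-cong (H? x y z) (H? x z y) rot rot))
               (trans (∑³-rot (λ x y z → h x y z * f (d x y))) first)
    third : ∑³ (λ x y z → h x y z * f (d y z)) ≡ W
    third = trans (∑³-cong λ x y z → cong₂ _*_ (𝟙-cong (H? x y z) (H? z y x) (flip ∘ rot ∘ flip) (flip ∘ rot ∘ flip)) (cong f (d-sym y z)))
              (trans (∑³-flip λ x y z → h z x y * f (d z x))
                (trans (∑³-cycle (λ x y z → h x y z * f (d x y))) first))

  pair-weight : W + NN ≤ n * (n * (6 * t))
  pair-weight = begin
    W + NN ≡⟨ sym (trans (∑-cong 𝕍 λ x → ∑-+ 𝕍 _ _) (∑-+ 𝕍 _ _)) ⟩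
    ∑ 𝕍 (λ x → ∑ 𝕍 λ y → d x y * f (d x y) + 𝟙 (¬? (nice? (d x y)))) ≤⟨ ∑-bound 𝕍 _ _ (λ {x} _ → ∑-bound 𝕍 _ _ λ {y} _ → capacity (d x y)) ⟩
    length 𝕍 * (length 𝕍 * (6 * t)) ≡⟨ cong (λ l → l * (l * (6 * t))) length-𝕍 ⟩
    n * (n * (6 * t)) ∎
    where open ≤-Reasoning

  -- Each of the three positions of a pair inside a triple contributes `W` to the weight received.
  -- The excess `Wst` and the imperfect pairs `NN` are kept on the left, so that a lower bound on
  -- `N` bounds them.
  discharge : 6 * N + Wst + 3 * NN ≤ 3 * (n * (n * (6 * t))) + 6 * N°
  discharge = linear 0 (+-mono-≤ total (*-monoʳ-≤ 3 pair-weight)) (arith (6 * N) Wst NN W (n * (n * (6 * t))) (6 * N°))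
    where
    total : 6 * N + Wst ≤ W + (W + W) + 6 * N°
    total = begin
      6 * N + Wst ≡⟨ sym (trans (∑³-+ _ _) (cong (_+ Wst) (∑³-* 6 _))) ⟩
      ∑³ (λ x y z → 6 * 𝟙 (H? x y z) + 𝟙 (waste? x y z)) ≤⟨ ∑³-mono edge-weight ⟩
      ∑³ (λ x y z → 𝟙 (H? x y z) * F x y z + 6 * 𝟙 (bad? x y z)) ≡⟨ trans (∑³-+ _ _) (cong₂ _+_ weight-sum (∑³-* 6 _)) ⟩
      W + (W + W) + 6 * N° ∎
      where open ≤-Reasoning
    arith : ∀ a w e W c b → a + w + 3 * e + (W + (W + W) + b + 3 * c) + 0 ≡ 3 * c + b + (a + w + 3 * (W + e))
    arith = solve-∀

  module _ {m : ℕ} (n≡ : n ≡ m + t) (dense : 3 * t * (m * m) ≤ N) where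

    -- With `n = m + t` the main terms differ by `18t(n² - m²) = 36t²n - 18t³`, which is linear in
    -- `n`. This is the first summand of `C₃`; the second pays for the bad edges.
    waste-few : Wst + 3 * NN ≤ C₃ * n
    waste-few = linear {b = 3 * (n * (n * (6 * t))) + 6 * N° + (6 * N + (54 * (B₀ * B₀) * n + 18 * (t * t * t)))} 0
      (+-mono-≤ discharge (+-mono-≤ (*-monoʳ-≤ 6 dense) (+-mono-≤ (≤-trans (*-monoʳ-≤ 6 bad-few) (≤-reflexive (arith₁ (B₀ * B₀) n))) (z≤n {18 * (t * t * t)}))))
      (trans (cong (λ n → Wst + 3 * NN + (3 * (n * (n * (6 * t))) + 6 * N° + (6 * N + (54 * (B₀ * B₀) * n + 18 * (t * t * t)))) + 0) n≡)
        (trans (arith Wst NN m t N° N (B₀ * B₀))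
          (cong₂ (λ c n → c * n + (6 * N + Wst + 3 * NN + (6 * (3 * t * (m * m)) + (6 * N° + 0)))) (sym C₃-def) (sym n≡))))
      where
      arith₁ : ∀ b n → 6 * (9 * b * n) ≡ 54 * b * n
      arith₁ = solve-∀
      arith : ∀ w e m t b N B →
        w + 3 * e + (3 * ((m + t) * ((m + t) * (6 * t))) + 6 * b + (6 * N + (54 * B * (m + t) + 18 * (t * t * t)))) + 0
        ≡ (36 * (t * t) + 54 * B) * (m + t) + (6 * N + w + 3 * e + (6 * (3 * t * (m * m)) + (6 * b + 0)))
      arith = solve-∀

  -- Clean pairs, and why only O(n) pairs are dirty.

  Clean : V → V → Set
  Clean c x = d c x ≡ t × (∀ y → H c x y → K < d c y × K < d x y)

  clean? : ∀ c x → Dec (Clean c x)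
  clean? c x = (d c x ≟ t) ×-dec Fin.all? λ y → H? c x y →-dec ((K <? d c y) ×-dec (K <? d x y))

  dirty? : ∀ c x → Dec (¬ Clean c x)
  dirty? c x = ¬? (clean? c x)

  dirt : V → ℕ
  dirt c = # (dirty? c)

  large⇒dirty : ∀ {c x} → K < d c x → ¬ Clean c x
  large⇒dirty p (e , _) = contradiction p (≤⇒≯ (≤-trans (≤-reflexive e) (≤-trans (≤-trans (m≤m+n t t) (m≤m+n 2t t)) 3t≤K)))

  Mid : ℕ → Set
  Mid m = ¬ Nice m × m ≤ K

  mid? : ∀ m → Dec (Mid m)
  mid? m = ¬? (nice? m) ×-dec (m ≤? K)

  MidEdge : V → V → V → Set
  MidEdge x y z = H x y z × Mid (d x y)

  midEdge? : ∀ x y z → Dec (MidEdge x y z)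
  midEdge? x y z = H? x y z ×-dec mid? (d x y)

  Exc : V → V → V → Set
  Exc x y z = Bad x y z ⊎ Waste x y z ⊎ MidEdge x y z ⊎ MidEdge x z y ⊎ MidEdge y z x

  exc? : ∀ x y z → Dec (Exc x y z)
  exc? x y z = bad? x y z ⊎-dec waste? x y z ⊎-dec midEdge? x y z ⊎-dec midEdge? x z y ⊎-dec midEdge? y z x

  -- Two weak edges through one pair are the input that `weak-cover` requires.
  Fork : V → V → Set
  Fork c x = ∃ λ y → ∃ λ z → Weak c x y × Weak c x z × y ≢ z

  fork? : ∀ c x → Dec (Fork c x)
  fork? c x = Fin.any? λ y → Fin.any? λ z → weak? c x y ×-dec weak? c x z ×-dec ¬? (y Fin.≟ z)

  private
    data Typical (m : ℕ) : ℕ → Set where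
      is-t   : m ≡ t → Typical m 6
      is-2t   : m ≡ 2t → Typical m 3
      is-3t : m ≡ 3t → Typical m 2
      is-large  : K < m → Typical m 0

    typical : ∀ m → ¬ Mid m → Typical m (f m)
    typical m ¬mid with f m | view m | nice? m
    ... | _ | at-6 p   | no q = contradiction (q , ≤-trans p (≤-trans t≤2t (≤-trans 2t≤3t 3t≤K))) ¬mid
    ... | _ | at-3 _ p | no q = contradiction (q , ≤-trans p (≤-trans 2t≤3t 3t≤K)) ¬mid
    ... | _ | at-2 _ p | no q = contradiction (q , ≤-trans p 3t≤K) ¬mid
    ... | _ | at-0 _   | no q = is-large (≰⇒> λ p → ¬mid (q , p))
    ... | _ | at-6 p   | yes (inj₁ e) = is-t e
    ... | _ | at-6 p   | yes (inj₂ (inj₁ e)) = is-t (≤-antisym p (≤-trans t≤2t (≤-reflexive (sym e))))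
    ... | _ | at-6 p   | yes (inj₂ (inj₂ e)) = is-t (≤-antisym p (≤-trans t≤2t (≤-trans 2t≤3t (≤-reflexive (sym e)))))
    ... | _ | at-3 l p | yes (inj₁ e) = contradiction l (≤⇒≯ (≤-reflexive e))
    ... | _ | at-3 l p | yes (inj₂ (inj₁ e)) = is-2t e
    ... | _ | at-3 l p | yes (inj₂ (inj₂ e)) = is-2t (≤-antisym p (≤-trans 2t≤3t (≤-reflexive (sym e))))
    ... | _ | at-2 l p | yes (inj₁ e) = contradiction l (≤⇒≯ (≤-trans (≤-reflexive e) t≤2t))
    ... | _ | at-2 l p | yes (inj₂ (inj₁ e)) = contradiction l (≤⇒≯ (≤-reflexive e))
    ... | _ | at-2 l p | yes (inj₂ (inj₂ e)) = is-3t e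
    ... | _ | at-0 l   | yes (inj₁ e) = contradiction l (≤⇒≯ (≤-trans (≤-reflexive e) (≤-trans t≤2t 2t≤3t)))
    ... | _ | at-0 l   | yes (inj₂ (inj₁ e)) = contradiction l (≤⇒≯ (≤-trans (≤-reflexive e) 2t≤3t))
    ... | _ | at-0 l   | yes (inj₂ (inj₂ e)) = contradiction l (≤⇒≯ (≤-reflexive e))

    -- Without exceptional edges at `c x`, the three weights of each edge are taken from 6, 3, 2, 0
    -- and add up to 6. Up to order this leaves 6 + 0 + 0, 3 + 3 + 0 and 2 + 2 + 2.
    module Regular {c x : V} (¬exc : ∀ {y} → ¬ Exc c x y) where

      F≡6 : ∀ {y} → H c x y → F c x y ≡ 6
      F≡6 h = ≤-antisym (≮⇒≥ λ lt → ¬exc (inj₂ (inj₁ (h , lt)))) (≮⇒≥ λ lt → ¬exc (inj₁ (h , lt)))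

      sides : ∀ {y} → H c x y → Typical (d c x) (f (d c x)) × Typical (d c y) (f (d c y)) × Typical (d x y) (f (d x y))
      sides h = typical _ (λ m → ¬exc (inj₂ (inj₂ (inj₁ (h , m))))) ,
                typical _ (λ m → ¬exc (inj₂ (inj₂ (inj₂ (inj₁ (rot h , m)))))) ,
                typical _ (λ m → ¬exc (inj₂ (inj₂ (inj₂ (inj₂ (rot (flip h) , m))))))

      t-case : d c x ≡ t → Clean c x
      t-case e = e , λ y h → go y (sides h) (F≡6 h)
        where
        go : ∀ y {i j k} → Typical (d c x) i × Typical (d c y) j × Typical (d x y) k → i + (j + k) ≡ 6 → K < d c y × K < d x y
        go y (is-t _   , is-large p , is-large q) _ = p , q
        go y (is-2t p   , _ , _) _ = contradiction (trans (sym e) p) (<⇒≢ (m<m+n t (≤-trans (s≤s z≤n) (≤-reflexive (sym t≡)))))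
        go y (is-3t p , _ , _) _ = contradiction (trans (sym e) p) (<⇒≢ (≤-trans (m<m+n t (≤-trans (s≤s z≤n) (≤-reflexive (sym t≡)))) 2t≤3t))
        go y (is-large p  , _ , _) _ = contradiction (e , λ _ _ → contradiction p (≤⇒≯ (≤-trans (≤-reflexive e) (≤-trans t≤2t (≤-trans 2t≤3t 3t≤K))))) (large⇒dirty p)

      weak-either : d c x ≡ 2t ⊎ d c x ≡ 3t → ∀ {y} → H c x y → Weak c x y ⊎ Weak x c y
      weak-either e {y} h = go (sides h) (F≡6 h)
        where
        2t≢t : 2t ≢ t
        2t≢t p = <⇒≢ (m<m+n t (≤-trans (s≤s z≤n) (≤-reflexive (sym t≡)))) (sym p)
        3t≢t : 3t ≢ t
        3t≢t p = <⇒≢ (≤-trans (m<m+n t (≤-trans (s≤s z≤n) (≤-reflexive (sym t≡)))) 2t≤3t) (sym p)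
        not-one : d c x ≢ t
        not-one p = [ (λ q → 2t≢t (trans (sym q) p)) , (λ q → 3t≢t (trans (sym q) p)) ]′ e
        not-many : ¬ K < d c x
        not-many p = contradiction p (≤⇒≯ ([ (λ q → ≤-trans (≤-reflexive q) (≤-trans 2t≤3t 3t≤K)) , (λ q → ≤-trans (≤-reflexive q) 3t≤K) ]′ e))
        go : ∀ {i j k} → Typical (d c x) i × Typical (d c y) j × Typical (d x y) k → i + (j + k) ≡ 6 → Weak c x y ⊎ Weak x c y
        go (is-t p   , _ , _) _ = contradiction p not-one
        go (is-large p  , _ , _) _ = contradiction p not-many
        go (is-2t p   , is-2t q   , is-large r) _  = inj₁ (h , inj₁ (p , q , r))
        go (is-2t p   , is-large r  , is-2t q) _   = inj₂ (flip h , inj₁ (trans (d-sym x c) p , q , r))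
        go (is-3t p , is-3t q , is-3t r) _ = inj₁ (h , inj₂ (p , q , r))
        go (is-2t _   , is-t _   , is-t _)   ()
        go (is-2t _   , is-t _   , is-2t _)   ()
        go (is-2t _   , is-t _   , is-3t _) ()
        go (is-2t _   , is-t _   , is-large _)  ()
        go (is-2t _   , is-2t _   , is-t _)   ()
        go (is-2t _   , is-2t _   , is-2t _)   ()
        go (is-2t _   , is-2t _   , is-3t _) ()
        go (is-2t _   , is-3t _ , is-t _)   ()
        go (is-2t _   , is-3t _ , is-2t _)   ()
        go (is-2t _   , is-3t _ , is-3t _) ()
        go (is-2t _   , is-3t _ , is-large _)  ()
        go (is-2t _   , is-large _  , is-t _)   ()
        go (is-2t _   , is-large _  , is-3t _) ()
        go (is-2t _   , is-large _  , is-large _)  ()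
        go (is-3t _ , is-t _   , is-t _)   ()
        go (is-3t _ , is-t _   , is-2t _)   ()
        go (is-3t _ , is-t _   , is-3t _) ()
        go (is-3t _ , is-t _   , is-large _)  ()
        go (is-3t _ , is-2t _   , is-t _)   ()
        go (is-3t _ , is-2t _   , is-2t _)   ()
        go (is-3t _ , is-2t _   , is-3t _) ()
        go (is-3t _ , is-2t _   , is-large _)  ()
        go (is-3t _ , is-3t _ , is-t _)   ()
        go (is-3t _ , is-3t _ , is-2t _)   ()
        go (is-3t _ , is-3t _ , is-large _)  ()
        go (is-3t _ , is-large _  , is-t _)   ()
        go (is-3t _ , is-large _  , is-2t _)   ()
        go (is-3t _ , is-large _  , is-3t _) ()
        go (is-3t _ , is-large _  , is-large _)  ()

      -- Of three edges at {c , x}, two lean the same way.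
      fork-either : d c x ≡ 2t ⊎ d c x ≡ 3t → Fork c x ⊎ Fork x c
      fork-either e with pickMany (H? c x) 3 (≤-trans (three≤ t₁ 1≤t₁) (≤-trans (≤-reflexive (cong (λ t → t + t) (sym t≡)))
                       ([ (λ q → ≤-reflexive (sym q)) , (λ q → ≤-trans 2t≤3t (≤-reflexive (sym q))) ]′ e)))
        where
        three≤ : ∀ k → 1 ≤ k → 3 ≤ suc k + suc k
        three≤ (suc k) _ = s≤s (s≤s (≤-trans (s≤s z≤n) (≤-reflexive (sym (+-suc k (suc k))))))
      ... | y₁ ∷ y₂ ∷ y₃ ∷ [] , refl , (n₁₂ ∷ n₁₃ ∷ []) ∷ (n₂₃ ∷ []) ∷ _ , H∈
        = go (weak-either e (H∈ (here refl))) (weak-either e (H∈ (there (here refl)))) (weak-either e (H∈ (there (there (here refl)))))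
        where
        go : Weak c x y₁ ⊎ Weak x c y₁ → Weak c x y₂ ⊎ Weak x c y₂ → Weak c x y₃ ⊎ Weak x c y₃ → Fork c x ⊎ Fork x c
        go (inj₁ p) (inj₁ q) _ = inj₁ (y₁ , y₂ , p , q , n₁₂)
        go (inj₁ p) (inj₂ _) (inj₁ r) = inj₁ (y₁ , y₃ , p , r , n₁₃)
        go (inj₁ _) (inj₂ q) (inj₂ r) = inj₂ (y₂ , y₃ , q , r , n₂₃)
        go (inj₂ _) (inj₁ q) (inj₁ r) = inj₁ (y₂ , y₃ , q , r , n₂₃)
        go (inj₂ p) (inj₁ _) (inj₂ r) = inj₂ (y₁ , y₃ , p , r , n₁₃)
        go (inj₂ p) (inj₂ q) _ = inj₂ (y₁ , y₂ , p , q , n₁₂)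

  dirty-cases : ∀ {c x} → ¬ Clean c x → ¬ Nice (d c x) ⊎ (∃ λ y → Exc c x y) ⊎ Fork c x ⊎ Fork x c
  dirty-cases {c} {x} ¬cl with nice? (d c x) | Fin.any? (exc? c x)
  ... | no p  | _     = inj₁ p
  ... | yes _ | yes q = inj₂ (inj₁ q)
  ... | yes (inj₁ e) | no q = contradiction (Regular.t-case (λ p → q (_ , p)) e) ¬cl
  ... | yes (inj₂ e) | no q = inj₂ (inj₂ (Regular.fork-either (λ p → q (_ , p)) e))

  -- A single fork at `c` yields a cover `L` of all weak pairs in its link. Every `x` with a fork
  -- lies in `L`, or in the link of `c y` for some `y` in `L` with codegree at most `3t`.
  fork-few : ∀ c → # (fork? c) ≤ C₇
  fork-few c with Fin.any? (fork? c)
  ... | no ¬p = ≤-trans (∑-mono 𝕍 λ x → 𝟙≤ (fork? c x) {0} λ p → contradiction (x , p) ¬p) (≤-trans (≤-reflexive (∑-zero 𝕍)) z≤n)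
  ... | yes (_ , _ , _ , w , w′ , y≢z) with L , L≤ , cov ← weak-cover w w′ y≢z = begin
    # (fork? c) ≤⟨ ∑-mono 𝕍 (λ x → 𝟙≤ (fork? c x) (point x)) ⟩
    ∑ 𝕍 (λ x → 𝟙 (x ∈? L) + ∑ L (λ y → 𝟙 (near? y x))) ≡⟨ trans (∑-+ 𝕍 _ _) (cong (# (_∈? L) +_) (∑-swap 𝕍 L (λ x y → 𝟙 (near? y x)))) ⟩
    # (_∈? L) + ∑ L (λ y → # (near? y)) ≤⟨ +-mono-≤ (#-∈ L) (∑-bound L _ 3t λ {y} _ → degree y) ⟩
    length L + length L * 3t ≤⟨ +-mono-≤ L≤ (*-monoˡ-≤ 3t L≤) ⟩
    B₁ + B₁ * 3t ≡⟨ C₇-def ⟨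
    C₇ ∎
    where
    open ≤-Reasoning
    near? : ∀ y x → Dec (H c y x × d c y ≤ 3t)
    near? y x = H? c y x ×-dec (d c y ≤? 3t)
    degree : ∀ y → # (near? y) ≤ 3t
    degree y with d c y ≤? 3t
    ... | yes p = ≤-trans (∑-mono 𝕍 λ x → 𝟙-mono (H? c y x ×-dec yes p) (H? c y x) proj₁) p
    ... | no q  = ≤-trans (∑-mono 𝕍 λ x → 𝟙≤ (H? c y x ×-dec no q) {0} λ r → contradiction (proj₂ r) q) (≤-trans (≤-reflexive (∑-zero 𝕍)) z≤n)
    point : ∀ x → Fork c x → 1 ≤ 𝟙 (x ∈? L) + ∑ L (λ y → 𝟙 (near? y x))
    point x (y , _ , w , _) with cov w
    ... | inj₁ x∈ = ≤-trans (≤-reflexive (sym (𝟙-yes (x ∈? L) x∈))) (m≤m+n _ _)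
    ... | inj₂ y∈ = ≤-trans (≤-trans (≤-reflexive (sym (𝟙-yes (near? y x) (rot (proj₁ w) , weak≤3t (weak-sym w))))) (∑-∈≤ (λ y → 𝟙 (near? y x)) y∈))
                      (m≤n+m _ (𝟙 (x ∈? L)))

  -- A pair of middle codegree is counted by `NN` and lies in at most `K` edges.
  mid-few : ∑³ (λ x y z → 𝟙 (midEdge? x y z)) ≤ NN * K
  mid-few = ≤-trans (∑-mono 𝕍 λ x → ≤-trans (∑-mono 𝕍 λ y → row x y) (≤-reflexive (∑-*ʳ 𝕍 K _))) (≤-reflexive (∑-*ʳ 𝕍 K _))
    where
    row : ∀ x y → # (midEdge? x y) ≤ 𝟙 (¬? (nice? (d x y))) * K
    row x y with mid? (d x y)
    ... | yes m@(¬nice , ≤K) = ≤-trans (∑-mono 𝕍 λ z → 𝟙-mono (H? x y z ×-dec yes m) (H? x y z) proj₁)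
        (≤-trans ≤K (≤-trans (≤-reflexive (sym (*-identityˡ K))) (≤-reflexive (cong (_* K) (sym (𝟙-yes (¬? (nice? (d x y))) ¬nice))))))
    ... | no q  = ≤-trans (∑-mono 𝕍 λ z → 𝟙≤ (H? x y z ×-dec no q) {0} λ r → contradiction (proj₂ r) q) (≤-trans (≤-reflexive (∑-zero 𝕍)) z≤n)

  exc-few : ∑³ (λ x y z → 𝟙 (exc? x y z)) ≤ N° + (Wst + 3 * NN * K)
  exc-few = begin
    ∑³ (λ x y z → 𝟙 (exc? x y z))
      ≤⟨ ∑³-mono (λ x y z → ≤-trans (𝟙-⊎ (exc? x y z) (bad? x y z) (rest₁? x y z) id) (+-monoʳ-≤ (𝟙 (bad? x y z))
           (≤-trans (𝟙-⊎ (rest₁? x y z) (waste? x y z) (rest₂? x y z) id) (+-monoʳ-≤ (𝟙 (waste? x y z))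
             (≤-trans (𝟙-⊎ (rest₂? x y z) (midEdge? x y z) (rest₃? x y z) id) (+-monoʳ-≤ (𝟙 (midEdge? x y z))
               (𝟙-⊎ (rest₃? x y z) (midEdge? x z y) (midEdge? y z x) id))))))) ⟩
    ∑³ (λ x y z → b x y z + (w x y z + (m x y z + (m x z y + m y z x))))
      ≡⟨ trans (∑³-+ b _) (cong (N° +_) (trans (∑³-+ w _) (cong (Wst +_) (trans (∑³-+ m _) (cong (∑³ m +_)
           (trans (∑³-+ (λ x y z → m x z y) _) (cong₂ _+_ (∑³-rot m) (trans (sym (∑³-cycle (λ x y z → m y z x))) refl)))))))) ⟩
    N° + (Wst + (∑³ m + (∑³ m + ∑³ m)))
      ≤⟨ +-monoʳ-≤ N° (+-monoʳ-≤ Wst (+-mono-≤ mid-few (+-mono-≤ mid-few mid-few))) ⟩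
    N° + (Wst + (NN * K + (NN * K + NN * K)))
      ≡⟨ cong (λ k → N° + (Wst + k)) (arith NN K) ⟩
    N° + (Wst + 3 * NN * K) ∎
    where
    open ≤-Reasoning
    b w m : V → V → V → ℕ
    b x y z = 𝟙 (bad? x y z)
    w x y z = 𝟙 (waste? x y z)
    m x y z = 𝟙 (midEdge? x y z)
    rest₃? : ∀ x y z → Dec (MidEdge x z y ⊎ MidEdge y z x)
    rest₃? x y z = midEdge? x z y ⊎-dec midEdge? y z x
    rest₂? : ∀ x y z → Dec (MidEdge x y z ⊎ MidEdge x z y ⊎ MidEdge y z x)
    rest₂? x y z = midEdge? x y z ⊎-dec rest₃? x y z
    rest₁? : ∀ x y z → Dec (Waste x y z ⊎ MidEdge x y z ⊎ MidEdge x z y ⊎ MidEdge y z x)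
    rest₁? x y z = waste? x y z ⊎-dec rest₂? x y z
    arith : ∀ e k → e * k + (e * k + e * k) ≡ 3 * e * k
    arith = solve-∀

  dirt-sum : ∑ 𝕍 dirt ≤ NN + (∑³ (λ x y z → 𝟙 (exc? x y z)) + (n * C₇ + n * C₇))
  dirt-sum = begin
    ∑ 𝕍 (λ c → ∑ 𝕍 λ x → 𝟙 (dirty? c x))
      ≤⟨ ∑-mono 𝕍 (λ c → ∑-mono 𝕍 λ x → 𝟙≤ (dirty? c x) λ ¬cl → point c x (dirty-cases ¬cl)) ⟩
    ∑ 𝕍 (λ c → ∑ 𝕍 λ x → g₁ c x + (g₂ c x + (g₃ c x + g₃ x c)))
      ≡⟨ trans (∑∑-+ g₁ _) (cong (NN +_) (trans (∑∑-+ g₂ _) (cong (∑ 𝕍 (λ c → ∑ 𝕍 (g₂ c)) +_)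
           (trans (∑∑-+ g₃ _) (cong (∑ 𝕍 (λ c → ∑ 𝕍 (g₃ c)) +_) (∑-swap 𝕍 𝕍 (λ c x → g₃ x c))))))) ⟩
    NN + (∑ 𝕍 (λ c → ∑ 𝕍 (g₂ c)) + (∑ 𝕍 (λ c → ∑ 𝕍 (g₃ c)) + ∑ 𝕍 (λ c → ∑ 𝕍 (g₃ c))))
      ≤⟨ +-monoʳ-≤ NN (+-monoʳ-≤ (∑ 𝕍 (λ c → ∑ 𝕍 (g₂ c))) (+-mono-≤ forks forks)) ⟩
    NN + (∑³ (λ x y z → 𝟙 (exc? x y z)) + (n * C₇ + n * C₇)) ∎
    where
    open ≤-Reasoning
    g₁ g₂ g₃ : V → V → ℕ
    g₁ c x = 𝟙 (¬? (nice? (d c x)))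
    g₂ c x = # (exc? c x)
    g₃ c x = 𝟙 (fork? c x)
    ∑∑-+ : ∀ (f g : V → V → ℕ) → ∑ 𝕍 (λ c → ∑ 𝕍 λ x → f c x + g c x) ≡ ∑ 𝕍 (λ c → ∑ 𝕍 (f c)) + ∑ 𝕍 (λ c → ∑ 𝕍 (g c))
    ∑∑-+ f g = trans (∑-cong 𝕍 λ c → ∑-+ 𝕍 (f c) (g c)) (∑-+ 𝕍 _ _)
    forks : ∑ 𝕍 (λ c → ∑ 𝕍 (g₃ c)) ≤ n * C₇
    forks = ≤-trans (∑-bound 𝕍 _ C₇ λ {c} _ → fork-few c) (≤-reflexive (cong (_* C₇) length-𝕍))
    point : ∀ c x → ¬ Nice (d c x) ⊎ (∃ λ y → Exc c x y) ⊎ Fork c x ⊎ Fork x c → 1 ≤ g₁ c x + (g₂ c x + (g₃ c x + g₃ x c))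
    point c x (inj₁ p) = ≤-trans (≤-reflexive (sym (𝟙-yes (¬? (nice? (d c x))) p))) (m≤m+n (g₁ c x) _)
    point c x (inj₂ (inj₁ (y , p))) = ≤-trans (#-pos (exc? c x) p) (≤-trans (m≤m+n (g₂ c x) _) (m≤n+m _ (g₁ c x)))
    point c x (inj₂ (inj₂ (inj₁ p))) = ≤-trans (≤-reflexive (sym (𝟙-yes (fork? c x) p)))
      (≤-trans (m≤m+n (g₃ c x) (g₃ x c)) (≤-trans (m≤n+m _ (g₂ c x)) (m≤n+m _ (g₁ c x))))
    point c x (inj₂ (inj₂ (inj₂ p))) = ≤-trans (≤-reflexive (sym (𝟙-yes (fork? x c) p)))
      (≤-trans (m≤n+m (g₃ x c) (g₃ c x)) (≤-trans (m≤n+m _ (g₂ c x)) (m≤n+m _ (g₁ c x))))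

  module _ {m : ℕ} (n≡ : n ≡ m + t) (dense : 3 * t * (m * m) ≤ N) where

    -- Imperfect pairs, exceptional edges and forks are each O(n), so on average a vertex has a
    -- bounded number of dirty partners.
    dirt-few : ∑ 𝕍 dirt ≤ C₆ * n
    dirt-few = begin
      ∑ 𝕍 dirt ≤⟨ dirt-sum ⟩
      NN + (∑³ (λ x y z → 𝟙 (exc? x y z)) + (n * C₇ + n * C₇)) ≤⟨ +-mono-≤ NN≤ (+-monoˡ-≤ _ exc-few) ⟩
      C₃ * n + (N° + (Wst + 3 * NN * K) + (n * C₇ + n * C₇)) ≤⟨ +-monoʳ-≤ (C₃ * n) (+-monoˡ-≤ _ (+-mono-≤ bad-few (+-mono-≤ Wst≤ (*-monoˡ-≤ K 3NN≤)))) ⟩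
      C₃ * n + (9 * (B₀ * B₀) * n + (C₃ * n + C₃ * n * K) + (n * C₇ + n * C₇)) ≡⟨ trans (arith C₃ n (9 * (B₀ * B₀)) K C₇) (cong (_* n) (sym C₆-def)) ⟩
      C₆ * n ∎
      where
      open ≤-Reasoning
      few : Wst + 3 * NN ≤ C₃ * n
      few = waste-few n≡ dense
      Wst≤ : Wst ≤ C₃ * n
      Wst≤ = ≤-trans (m≤m+n Wst _) few
      3NN≤ : 3 * NN ≤ C₃ * n
      3NN≤ = ≤-trans (m≤n+m _ Wst) few
      NN≤ : NN ≤ C₃ * n
      NN≤ = ≤-trans (m≤m+n NN _) 3NN≤
      arith : ∀ c n b k c₇ → c * n + (b * n + (c * n + c * n * k) + (n * c₇ + n * c₇)) ≡ (c + (b + (c + c * k)) + (c₇ + c₇)) * n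
      arith = solve-∀

  -- The kernel `T`.

  record Kernel : Set where
    field
      -- `Y` has positive density and bounded dirt. By the last two fields `T` consists of exactly
      -- the vertices that complete any clean pair inside `Y`.
      T Y : List V
      T-unique : Unique T
      T-length : length T ≡ t
      Y-unique : Unique Y
      Y-many   : n ≤ CY * length Y
      Y-dirt   : ∀ {x} → x ∈ Y → dirt x ≤ C₀
      Y-large  : ∀ {x l} → x ∈ Y → l ∈ T → K < d l x
      Y-clean  : ∀ {x y l} → x ∈ Y → y ∈ Y → Clean x y → l ∈ T → H x y l
      Y-only   : ∀ {x y l} → x ∈ Y → y ∈ Y → Clean x y → H x y l → l ∈ T

  0<d⇒≢ : ∀ {x y} → 0 < d x y → x ≢ y
  0<d⇒≢ {x} {y} lt with z , h , _ ← pick (H? x y) [] lt = irr h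

  clean⇒≢ : ∀ {x y} → Clean x y → x ≢ y
  clean⇒≢ (e , _) = 0<d⇒≢ (≤-trans 1≤t (≤-reflexive (sym e)))

  -- At a vertex l joined to x and y by large pairs, an edge-rich pair {x , y} missing
  -- from the link of l behaves like a bad edge.
  missing⇒strong : ∀ {l x y} → K < d l x → K < d l y → x ≢ y → t ≤ d x y → ¬ H x y l → Strong l x y
  missing⇒strong {l} {x} {y} lx ly x≢y le ¬h =
    0<d⇒≢ (≤-trans (s≤s z≤n) lx) ∘ sym , 0<d⇒≢ (≤-trans (s≤s z≤n) ly) ∘ sym , x≢y ,
    ≤-trans t≤3t 3x , ≤-trans t≤3t 3y ,
    ≤-trans le (#-mono (H? x y) (off? x y (l ∷ [])) λ h → h , λ { (here refl) → ¬h h }) ,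
    inj₁ (≤-trans 2t≤3t 3x) , inj₁ (≤-trans 2t≤3t 3x) , inj₁ (≤-trans 2t≤3t 3y) , inj₁ 3x
    where
    t≤3t : t ≤ 3t
    t≤3t = ≤-trans (m≤m+n t t) 2t≤3t
    3x : 3t ≤ # (off? l x (y ∷ []))
    3x = s≤s⁻¹ (≤-trans (s≤s 3t≤K) (≤-trans lx (d-off₁ l x y)))
    3y : 3t ≤ # (off? l y (x ∷ []))
    3y = s≤s⁻¹ (≤-trans (s≤s 3t≤K) (≤-trans ly (d-off₁ l y x)))

  abstract
    coverOf : V → List V
    coverOf l = proj₁ (strong-cover l)

    coverOf-length : ∀ l → length (coverOf l) ≤ B₀
    coverOf-length l = proj₁ (proj₂ (strong-cover l))

    coverOf-covers : ∀ {l x y} → Strong l x y → x ∈ coverOf l ⊎ y ∈ coverOf l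
    coverOf-covers {l} = proj₂ (proj₂ (strong-cover l))

  -- Otherwise the pair would be strong at `l`, hence covered.
  link-complete : ∀ {l x y} → K < d l x → K < d l y → x ≢ y → t ≤ d x y → x ∉ coverOf l → y ∉ coverOf l → H x y l
  link-complete {l} {x} {y} lx ly x≢y le x∉ y∉ with H? x y l
  ... | yes h = h
  ... | no ¬h = ⊥-elim ([ x∉ , y∉ ]′ (coverOf-covers (missing⇒strong lx ly x≢y le ¬h)))

  module _ (dirt-few : ∑ 𝕍 dirt ≤ C₆ * n) where

    typical? : ∀ x → Dec (¬ C₀ ≤ dirt x)
    typical? x = ¬? (C₀ ≤? dirt x)

    -- Markov's inequality: as `C₀` is twice `suc C₆`, at most half of the vertices have dirt `C₀`
    -- or more.
    typical-many : n ≤ 2 * # typical?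
    typical-many = linear 0 (+-mono-≤ (*-monoʳ-≤ 2 parts) few) (arith n (# typical?) (# (λ x → C₀ ≤? dirt x)))
      where
      parts : n ≤ # typical? + # (λ x → C₀ ≤? dirt x)
      parts = begin
        n ≡⟨ sym (trans (∑-const 𝕍 1) (trans (*-identityʳ _) length-𝕍)) ⟩
        ∑ 𝕍 (λ _ → 1) ≤⟨ ∑-mono 𝕍 (λ x → point x) ⟩
        ∑ 𝕍 (λ x → 𝟙 (typical? x) + 𝟙 (C₀ ≤? dirt x)) ≡⟨ ∑-+ 𝕍 _ _ ⟩
        # typical? + # (λ x → C₀ ≤? dirt x) ∎
        where
        open ≤-Reasoning
        point : ∀ x → 1 ≤ 𝟙 (typical? x) + 𝟙 (C₀ ≤? dirt x)
        point x with C₀ ≤? dirt x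
        ... | yes _ = s≤s z≤n
        ... | no _  = s≤s z≤n
      few : 2 * # (λ x → C₀ ≤? dirt x) ≤ n
      few = *-cancelˡ-≤ (suc C₆) (begin
        suc C₆ * (2 * # (λ x → C₀ ≤? dirt x))  ≡⟨ trans (arith′ C₆ (# (λ x → C₀ ≤? dirt x))) (cong (# (λ x → C₀ ≤? dirt x) *_) (sym C₀-def)) ⟩
        # (λ x → C₀ ≤? dirt x) * C₀ ≤⟨ markov dirt C₀ ⟩
        ∑ 𝕍 dirt ≤⟨ dirt-few ⟩
        C₆ * n ≤⟨ m≤n+m (C₆ * n) n ⟩
        suc C₆ * n ∎)
        where
        open ≤-Reasoning
        arith′ : ∀ c a → suc c * (2 * a) ≡ a * (2 * suc c)
        arith′ = solve-∀
      arith : ∀ n p a → n + (2 * (p + a) + n) + 0 ≡ 2 * p + (2 * n + 2 * a)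
      arith = solve-∀

    module _ (n-big : 4 * (2 ^ C₀ * (t * B₀) + C₀) < n) where

      n-large : 2 * C₀ < n
      n-large = ≤-trans (s≤s (≤-trans (*-monoˡ-≤ C₀ (m≤m+n 2 2)) (*-monoʳ-≤ 4 (m≤n+m C₀ (2 ^ C₀ * (t * B₀)))))) n-big

      module AtCentre (c : V) (c-typ : ¬ C₀ ≤ dirt c) where

        good? : ∀ x → Dec ((¬ C₀ ≤ dirt x) × Clean c x)
        good? x = typical? x ×-dec clean? c x

        X : List V
        X = elements good?

        X-many : n ≤ 2 * (length X + C₀)
        X-many = ≤-trans typical-many (*-monoʳ-≤ 2 (begin
          # typical? ≤⟨ #-⊎ typical? good? (dirty? c) split ⟩
          # good? + dirt c ≤⟨ +-mono-≤ (≤-reflexive (sym (length-elements good?))) (≰⇒≥ c-typ) ⟩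
          length X + C₀ ∎))
          where
          open ≤-Reasoning
          split : ∀ {x} → ¬ C₀ ≤ dirt x → ((¬ C₀ ≤ dirt x) × Clean c x) ⊎ ¬ Clean c x
          split {x} p with clean? c x
          ... | yes q = inj₁ (p , q)
          ... | no q  = inj₂ q

        -- For `x` in `X` the pair `c x` is clean, so the vertices completing it form large, hence
        -- dirty, pairs with `c` and lie in `Λ`. As `Λ` has at most `C₀` members, only boundedly
        -- many completing sets are possible, and `homogeneous` singles one out.
        Λ : List V
        Λ = elements (dirty? c)

        module FromHomogeneous (X′ : List V) (X′-unique : Unique X′) (X′⊆X : ∀ {x} → x ∈ X′ → x ∈ X)
          (X≤ : length X ≤ 2 ^ length Λ * length X′)
          (hom : ∀ {l x y} → l ∈ Λ → x ∈ X′ → y ∈ X′ → H c x l → H c y l) where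

          X≤′ : length X ≤ 2 ^ C₀ * length X′
          X≤′ = ≤-trans X≤ (*-monoˡ-≤ (length X′) (^-monoʳ-≤ 2 (≤-trans (≤-reflexive (length-elements (dirty? c))) (≰⇒≥ c-typ))))

          X′-nonempty : 0 < length X′
          X′-nonempty with length X′ | X≤′
          ... | suc _ | _  = s≤s z≤n
          ... | zero  | le = contradiction (≤-trans X-many (*-monoʳ-≤ 2 (+-monoˡ-≤ C₀ (≤-trans le (≤-reflexive (*-zeroʳ (2 ^ C₀)))))))
                               (<⇒≱ n-large)

          clean-c : ∀ {x} → x ∈ X′ → Clean c x
          clean-c x∈ = proj₂ (∈-elements⁻ good? (X′⊆X x∈))

          module FromMember (x₀ : V) (x₀∈ : x₀ ∈ X′) where

            T : List V
            T = elements (H? c x₀)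

            T-length : length T ≡ t
            T-length = trans (length-elements (H? c x₀)) (proj₁ (clean-c x₀∈))

            T-edge : ∀ {x l} → x ∈ X′ → l ∈ T → H c x l
            T-edge x∈ l∈ = hom (∈-elements⁺ (dirty? c) (large⇒dirty (proj₁ (proj₂ (clean-c x₀∈) _ h)))) x₀∈ x∈ h
              where h = ∈-elements⁻ (H? c x₀) l∈

            LT : List V
            LT = concatMap coverOf T

            LT-length : length LT ≤ t * B₀
            LT-length = ≤-trans (go T) (≤-reflexive (cong (_* B₀) T-length))
              where
              go : ∀ ls → length (concatMap coverOf ls) ≤ length ls * B₀
              go [] = z≤n
              go (l ∷ ls) = ≤-trans (≤-reflexive (length-++ (coverOf l))) (+-mono-≤ (coverOf-length l) (go ls))

            ∈-LT : ∀ {l x} ls → l ∈ ls → x ∈ coverOf l → x ∈ concatMap coverOf ls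
            ∈-LT (l ∷ ls) (here refl) x∈ = ∈-++⁺ˡ x∈
            ∈-LT (l ∷ ls) (there l∈)  x∈ = ∈-++⁺ʳ (coverOf l) (∈-LT ls l∈ x∈)

            out? : ∀ x → Dec (x ∉ LT)
            out? x = ¬? (x ∈? LT)

            Y : List V
            Y = filter out? X′

            Y⊆ : ∀ {x} → x ∈ Y → x ∈ X′ × x ∉ LT
            Y⊆ = ∈-filter⁻ out? {xs = X′}

            X′≤ : length X′ ≤ length Y + t * B₀
            X′≤ = begin
              length X′ ≡⟨ trans (sym (*-identityʳ _)) (sym (∑-const X′ 1)) ⟩
              ∑ X′ (λ _ → 1) ≤⟨ ∑-mono X′ point ⟩
              ∑ X′ (λ x → 𝟙 (out? x) + 𝟙 (x ∈? LT)) ≡⟨ trans (∑-+ X′ _ _) (cong (_+ ∑ X′ (λ x → 𝟙 (x ∈? LT))) (sym (length-filter out? X′))) ⟩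
              length Y + ∑ X′ (λ x → 𝟙 (x ∈? LT)) ≤⟨ +-monoʳ-≤ (length Y) (≤-trans (∑-∈? X′-unique LT) LT-length) ⟩
              length Y + t * B₀ ∎
              where
              open ≤-Reasoning
              point : ∀ x → 1 ≤ 𝟙 (out? x) + 𝟙 (x ∈? LT)
              point x with x ∈? LT
              ... | yes _ = s≤s z≤n
              ... | no _  = s≤s z≤n

            Y-large : ∀ {x l} → x ∈ Y → l ∈ T → K < d l x
            Y-large {x} {l} x∈ l∈ = subst (K <_) (d-sym x l) (proj₂ (proj₂ (clean-c x∈′) l (T-edge x∈′ l∈)))
              where x∈′ = proj₁ (Y⊆ x∈)

            -- `Y` avoids the covers of all `l` in `T`, so every `l` completes the pair. As the pair
            -- has codegree `t`, nothing else does, which is `Y-only`.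
            Y-clean : ∀ {x y l} → x ∈ Y → y ∈ Y → Clean x y → l ∈ T → H x y l
            Y-clean x∈ y∈ cl l∈ = link-complete (Y-large x∈ l∈) (Y-large y∈ l∈) (clean⇒≢ cl) (≤-reflexive (sym (proj₁ cl)))
              (proj₂ (Y⊆ x∈) ∘ ∈-LT T l∈) (proj₂ (Y⊆ y∈) ∘ ∈-LT T l∈)

            kernel : Kernel
            kernel = record
              { T = T ; Y = Y ; T-unique = elements-unique (H? c x₀) ; T-length = T-length
              ; Y-unique = Uniq.filter⁺ out? X′-unique
              -- By `n-big` the additive losses, from `C₀` and from the covers, amount to less than
              -- half of `n`; this doubles the factor `2 * 2 ^ C₀` to `CY`.
              ; Y-many = linear 0
                  (+-mono-≤ (*-monoʳ-≤ 2 (≤-trans X-many (*-monoʳ-≤ 2 (+-monoˡ-≤ C₀ (≤-trans X≤′ (*-monoʳ-≤ (2 ^ C₀) X′≤)))))) (<⇒≤ n-big))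
                  (trans (arith n (2 ^ C₀) (length Y) (t * B₀) C₀) (cong (λ k → k * length Y + (2 * n + 4 * (2 ^ C₀ * (t * B₀) + C₀))) (sym CY-def)))
              ; Y-dirt = λ x∈ → ≰⇒≥ (proj₁ (∈-elements⁻ good? (X′⊆X (proj₁ (Y⊆ x∈)))))
              ; Y-large = Y-large ; Y-clean = Y-clean
              ; Y-only = λ {x} {y} x∈ y∈ cl h → #-full (H? x y) (elements-unique (H? c x₀)) (Y-clean x∈ y∈ cl)
                           (≤-reflexive (trans (proj₁ cl) (sym T-length))) h }
              where
              arith : ∀ n p y b c → n + (2 * (2 * (p * (y + b) + c)) + n) + 0 ≡ 4 * p * y + (2 * n + 4 * (p * b + c))
              arith = solve-∀

      kernel : Kernel
      kernel = from-centre (pick typical? [] (*-cancelˡ-< 2 0 _ (≤-trans (≤-trans (s≤s z≤n) n-large) typical-many)))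
        where
        from-centre : (∃ λ c → (¬ C₀ ≤ dirt c) × c ∉ []) → Kernel
        from-centre (c , c-typ , _) = from-homogeneous (homogeneous (λ l x → H? c x l) Λ X (elements-unique good?))
          where
          open AtCentre c c-typ
          from-homogeneous : Homogeneous (λ l x → H? c x l) Λ X → Kernel
          from-homogeneous (X′ , u , sub , big , hom) = from-member (pickFrom u [] X′-nonempty)
            where
            open FromHomogeneous X′ u sub big hom
            from-member : (∃ λ x → x ∈ X′ × x ∉ []) → Kernel
            from-member (x₀ , x₀∈ , _) = FromMember.kernel x₀ x₀∈

    -- The exceptional vertices.

    module Exceptional (𝒦 : Kernel) where

      open Kernel 𝒦

      far? : ∀ l x → Dec (x ∈ Y × K < d l x)
      far? l x = (x ∈? Y) ×-dec (K <? d l x)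

      -- Two such vertices outside the cover of `l` that form a clean pair would be completed by
      -- `l`, forcing `l` into `T`. So, apart from the cover, all of them are dirty partners of any
      -- single one.
      large-few : ∀ {l} → l ∉ T → # (far? l) ≤ C₈
      large-few {l} l∉ = ≤-trans (≤-trans (#-minus (far? l) (coverOf l)) (+-mono-≤ rest (coverOf-length l))) (≤-reflexive (trans (+-comm C₀ B₀) (sym C₈-def)))
        where
        rest? : ∀ x → Dec ((x ∈ Y × K < d l x) × x ∉ coverOf l)
        rest? x = far? l x ×-dec ¬? (x ∈? coverOf l)
        rest : # rest? ≤ C₀
        rest with Fin.any? rest?
        ... | no ¬p = ≤-trans (∑-mono 𝕍 λ x → 𝟙≤ (rest? x) {0} λ p → contradiction (x , p) ¬p) (≤-trans (≤-reflexive (∑-zero 𝕍)) z≤n)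
        ... | yes (x , (x∈ , lx) , x∉) = ≤-trans (#-mono rest? (dirty? x) λ { ((y∈ , ly) , y∉) cl →
                l∉ (Y-only x∈ y∈ cl (link-complete lx ly (clean⇒≢ cl) (≤-reflexive (sym (proj₁ cl))) x∉ y∉)) }) (Y-dirt x∈)

      -- Summing over `Y` finds an `x` that forms a clean pair with `z` and no large pair with a
      -- dirty partner of `z` outside `T`. The `t` vertices completing `z x` form large pairs with
      -- both, so they lie in `T`, and therefore they are all of `T`.
      ordinary : ∀ {z} → dirt z * suc C₈ < length Y → ∀ {l} → l ∈ T → K < d z l
      ordinary {z} lt = conclude (∑-zero-∈ Y _ (≤-trans (s≤s sum≤) lt))
        where
        via? : ∀ l x → Dec ((¬ Clean z l × l ∉ T) × K < d l x)
        via? l x = (dirty? z l ×-dec ¬? (l ∈? T)) ×-dec (K <? d l x)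
        g : V → ℕ
        g x = 𝟙 (dirty? z x) + ∑ 𝕍 (λ l → 𝟙 (via? l x))
        sum≤ : ∑ Y g ≤ dirt z * suc C₈
        sum≤ = begin
          ∑ Y g ≡⟨ trans (∑-+ Y _ _) (cong (∑ Y (λ x → 𝟙 (dirty? z x)) +_) (∑-swap Y 𝕍 (λ x l → 𝟙 (via? l x)))) ⟩
          ∑ Y (λ x → 𝟙 (dirty? z x)) + ∑ 𝕍 (λ l → ∑ Y (λ x → 𝟙 (via? l x)))     ≤⟨ +-mono-≤ (∑-sub (dirty? z) Y-unique) (∑-mono 𝕍 row) ⟩
          dirt z + ∑ 𝕍 (λ l → 𝟙 (dirty? z l) * C₈) ≡⟨ cong (dirt z +_) (∑-*ʳ 𝕍 C₈ _) ⟩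
          dirt z + dirt z * C₈ ≡⟨ *-suc (dirt z) C₈ ⟨
          dirt z * suc C₈ ∎
          where
          open ≤-Reasoning
          row : ∀ l → ∑ Y (λ x → 𝟙 (via? l x)) ≤ 𝟙 (dirty? z l) * C₈
          row l with dirty? z l | l ∈? T
          ... | no _  | _     = ≤-reflexive (∑-zero Y)
          ... | yes _ | yes _ = ≤-trans (≤-reflexive (∑-zero Y)) z≤n
          ... | yes _ | no l∉ = ≤-trans (∑-mono∈ Y λ {x} x∈ → 𝟙-mono (yes _ ×-dec (K <? d l x)) (far? l x) λ p → x∈ , proj₂ p)
                                  (≤-trans (∑-sub (far? l) Y-unique) (≤-trans (large-few l∉) (≤-reflexive (sym (+-identityʳ C₈)))))
        conclude : (∃ λ x → x ∈ Y × g x ≡ 0) → ∀ {l} → l ∈ T → K < d z l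
        conclude (x , x∈ , gx≡0) {l} l∈ = proj₁ (proj₂ cl l (#-exhausts (H? z x) inside (≤-reflexive (trans T-length (sym (proj₁ cl)))) l∈))
          where
          cl : Clean z x
          cl = decidable-stable (clean? z x) λ p → contradiction (≤-trans (≤-reflexive (sym (𝟙-yes (dirty? z x) p))) (≤-trans (m≤m+n _ _) (≤-reflexive gx≡0))) λ ()
          inside : ∀ {l} → H z x l → l ∈ T
          inside {l} h with l ∈? T
          ... | yes p = p
          ... | no p  = contradiction (≤-trans (#-pos (λ l → via? l x) ((large⇒dirty (proj₁ (proj₂ cl l h)) , p) , subst (K <_) (d-sym x l) (proj₂ (proj₂ cl l h))))
                                        (≤-trans (m≤n+m _ (𝟙 (dirty? z x))) (≤-reflexive gx≡0))) λ ()

      -- The exceptional vertices of the overview.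
      Odd : V → Set
      Odd z = z ∉ T × (∃ λ l → l ∈ T × d z l ≤ K)

      odd? : ∀ z → Dec (Odd z)
      odd? z = ¬? (z ∈? T) ×-dec Fin.any? λ l → (l ∈? T) ×-dec (d z l ≤? K)

      -- By `ordinary` an odd vertex has dirt proportional to `length Y`, hence to `n`, while the
      -- total dirt is O(n).
      odd-few : 1 ≤ length Y → # odd? ≤ C₉
      odd-few 1≤Y = ≤-trans (#-mono odd? rough? sub) (cancel (length Y) 1≤Y (begin
        # rough? * length Y ≤⟨ markov (λ z → dirt z * suc C₈) (length Y) ⟩
        ∑ 𝕍 (λ z → dirt z * suc C₈) ≡⟨ ∑-*ʳ 𝕍 (suc C₈) dirt ⟩
        ∑ 𝕍 dirt * suc C₈ ≤⟨ *-monoˡ-≤ (suc C₈) (≤-trans dirt-few (*-monoʳ-≤ C₆ Y-many)) ⟩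
        C₆ * (CY * length Y) * suc C₈ ≡⟨ trans (arith C₆ CY (length Y) (suc C₈)) (cong (_* length Y) (sym C₉-def)) ⟩
        C₉ * length Y ∎))
        where
        open ≤-Reasoning
        rough? : ∀ z → Dec (length Y ≤ dirt z * suc C₈)
        rough? z = length Y ≤? dirt z * suc C₈
        sub : ∀ {z} → Odd z → length Y ≤ dirt z * suc C₈
        sub (_ , l , l∈ , le) = ≮⇒≥ λ lt → <⇒≱ (ordinary lt l∈) le
        cancel : ∀ k → 1 ≤ k → ∀ {a b} → a * k ≤ b * k → a ≤ b
        cancel (suc k) _ {a} {b} = *-cancelʳ-≤ a b (suc k)
        arith : ∀ a b y c → a * (b * y) * c ≡ a * b * c * y
        arith = solve-∀

  -- Edges disjoint from the kernel.

  module OffKernel (dirt≤ : ∑ 𝕍 dirt ≤ C₆ * n) (𝒦 : Kernel) (Y-rich : C₀ + K ≤ length (Kernel.Y 𝒦)) where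

    open Kernel 𝒦
    open Exceptional dirt≤ 𝒦

    Extension : V → List V → ℕ → Set
    Extension c U k = Σ (List (Triangle c)) λ τs → length τs ≡ k × Unique (concatMap corners τs ++ U)

    extension-fan : ∀ {c} → Extension c (c ∷ []) t → ⊥
    extension-fan {c} (τs , len , u) = free (c , τs , len , Unique-resp-↭ (↭-trans (Perm.shift c (concatMap corners τs) []) (prep c (Perm.++-identityʳ _))) u)

    prepend : ∀ {c U k} (τ : Triangle c) → Extension c (corners τ ++ U) k → Extension c U (suc k)
    prepend {U = U} τ (τs , len , u) = τ ∷ τs , cong suc len ,
      Unique-resp-↭ (↭-trans (Perm.shifts (concatMap corners τs) (corners τ)) (↭-sym (Perm.++-assoc (corners τ) (concatMap corners τs) U))) u

    private
      len+1 : ∀ (xs : List V) {y} ys → length (xs ++ y ∷ ys) ≡ suc (length (xs ++ ys))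
      len+1 xs {y} ys = Perm.↭-length (Perm.shift y xs ys)

    module Central (c : V) (c∈ : c ∈ T) where

      -- Each `l` expands a side `a b`, where `a` and `b` form a clean pair in `Y`; the large
      -- codegrees with `c` supply the other two expansion vertices. A triangle costs four vertices
      -- besides `l`. As `c` itself is in `T`, the other members of `T` yield `t - 1` triangles, and
      -- one more edge is needed for a fan.
      grow : ∀ ls U → (∀ {l} → l ∈ ls → l ∈ T) → Unique (ls ++ U) → length (ls ++ U) + 4 * length ls ≤ K →
             Extension c U (length ls)
      grow [] U ls⊆ u fits = [] , refl , u
      grow (l ∷ ls) U ls⊆ u fits = choose-a (pickFrom Y-unique Used (≤-trans (room 0 z≤n) (≤-trans (m≤n+m K C₀) Y-rich)))
        where
        Used : List V
        Used = l ∷ ls ++ U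
        room : ∀ i → i ≤ 3 → i + length Used < K
        room i i≤3 = ≤-trans (≤-trans (+-monoˡ-≤ (length Used) (s≤s i≤3)) (≤-trans (≤-reflexive (+-comm 4 (length Used)))
                       (+-monoʳ-≤ (length Used) (≤-trans (m≤m+n 4 (4 * length ls)) (≤-reflexive (sym (*-suc 4 (length ls)))))))) fits
        Result : Set
        Result = Extension c U (suc (length ls))
        choose-q : ∀ {a b p} → a ∈ Y → b ∈ Y → Clean a b → H c a p → Unique (p ∷ b ∷ a ∷ Used) →
                   (∃ λ q → H c b q × q ∉ p ∷ b ∷ a ∷ Used) → Result
        choose-q {a} {b} {p} a∈ b∈ cl hp u′ (q , hq , q∉) =
          prepend τ (grow ls (corners τ ++ U) (ls⊆ ∘ there)
            (Unique-resp-↭ (solve 7 (λ a b p q l L U → q ⊕ (p ⊕ (b ⊕ (a ⊕ (l ⊕ (L ⊕ U))))) ⊜ L ⊕ (a ⊕ (b ⊕ (p ⊕ (q ⊕ (l ⊕ U)))))) ↭-refl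
              (a ∷ []) (b ∷ []) (p ∷ []) (q ∷ []) (l ∷ []) ls U) (Unique-∷ q∉ u′))
            (≤-trans (≤-reflexive (trans (cong (_+ 4 * length ls)
              (trans (len+1 ls _) (cong suc (trans (len+1 ls _) (cong suc (trans (len+1 ls _) (cong suc (trans (len+1 ls _) (cong suc (len+1 ls _))))))))))
              (arith (length (ls ++ U)) (length ls)))) fits))
          where
          open import Algebra.Solver.CommutativeMonoid (Perm.++-commutativeMonoid {A = V})
          τ : Triangle c
          τ = triangle hp hq (Y-clean a∈ b∈ cl (ls⊆ (here refl)))
          arith : ∀ m k → suc (suc (suc (suc (suc m)))) + 4 * k ≡ suc m + 4 * suc k
          arith = solve-∀
        choose-p : ∀ {a b} → a ∈ Y → b ∈ Y → Clean a b → Unique (b ∷ a ∷ Used) → (∃ λ p → H c a p × p ∉ b ∷ a ∷ Used) → Result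
        choose-p {a} {b} a∈ b∈ cl u′ (p , hp , p∉) = choose-q a∈ b∈ cl hp (Unique-∷ p∉ u′)
          (pick (H? c b) (p ∷ b ∷ a ∷ Used) (<-trans (room 3 ≤-refl) (Y-large b∈ c∈)))
        choose-b : ∀ {a} → a ∈ Y → Unique (a ∷ Used) → (∃ λ b → b ∈ Y × b ∉ elements (dirty? a) ++ (a ∷ Used)) → Result
        choose-b {a} a∈ u′ (b , b∈ , b∉) = choose-p a∈ b∈ (decidable-stable (clean? a b) λ ¬cl → b∉ (∈-++⁺ˡ (∈-elements⁺ (dirty? a) ¬cl)))
          (Unique-∷ (b∉ ∘ ∈-++⁺ʳ (elements (dirty? a))) u′)
          (pick (H? c a) (b ∷ a ∷ Used) (<-trans (room 2 (n≤1+n 2)) (Y-large a∈ c∈)))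
        choose-a : (∃ λ a → a ∈ Y × a ∉ Used) → Result
        choose-a (a , a∈ , a∉) = choose-b a∈ (Unique-∷ a∉ u) (pickFrom Y-unique (elements (dirty? a) ++ (a ∷ Used))
          (≤-trans (s≤s (≤-reflexive (length-++ (elements (dirty? a)))))
            (≤-trans (≤-reflexive (sym (+-suc _ _)))
              (≤-trans (+-mono-≤ (≤-trans (≤-reflexive (length-elements (dirty? a))) (Y-dirt a∈)) (room 1 (s≤s z≤n))) Y-rich))))

    -- An edge x y w off T is the side {a₁ , b₁ , ab₁} of a fan centred at l ∈ T whose
    -- other sides {aᵢ , bᵢ , abᵢ} are completed by the rest of T.
    no-edge : ∀ {x y w l} → H x y w → x ∉ T → y ∉ T → w ∉ T → l ∈ T → K < d l x → K < d l y → ⊥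
    no-edge {x} {y} {w} {l} h x∉ y∉ w∉ l∈ lx ly = split (∈-∃++ l∈)
      where
      split : (∃ λ as → ∃ λ bs → T ≡ as ++ l ∷ bs) → ⊥
      split (as , bs , eq) = choose-p (pick (H? l x) A₀ (<-trans (small 4 (n≤1+n 4)) lx))
        where
        R : List V
        R = as ++ bs
        T↭ : T ↭ l ∷ R
        T↭ = subst (_↭ l ∷ R) (sym eq) (Perm.shift l as bs)
        R⊆ : ∀ {z} → z ∈ R → z ∈ T
        R⊆ z∈ = Perm.∈-resp-↭ (↭-sym T↭) (there z∈)
        suc-lenR : suc (length R) ≡ t
        suc-lenR = trans (sym (Perm.↭-length T↭)) T-length
        A₀ : List V
        A₀ = x ∷ y ∷ w ∷ l ∷ R
        small : ∀ i → i ≤ 5 → i + length R < K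
        small i i≤5 = ≤-trans (s≤s (+-mono-≤ i≤5 (≤-trans (n≤1+n _) (≤-reflexive suc-lenR)))) (≤-trans (m≤m+n (6 + t) (5 * t)) (≤-reflexive (arith t)))
          where
          arith : ∀ t → 6 + t + 5 * t ≡ 6 * t + 6
          arith = solve-∀
        u₀ : Unique A₀
        u₀ = Unique-∷ (λ { (here p) → irr h p ; (there (here p)) → irr′ h p ; (there (there p)) → x∉ (Perm.∈-resp-↭ (↭-sym T↭) p) })
               (Unique-∷ (λ { (here p) → irr″ h p ; (there p) → y∉ (Perm.∈-resp-↭ (↭-sym T↭) p) })
                 (Unique-∷ (w∉ ∘ Perm.∈-resp-↭ (↭-sym T↭)) (Unique-resp-↭ T↭ T-unique)))
        choose-q : ∀ {p} → H l x p → Unique (p ∷ A₀) → (∃ λ q → H l y q × q ∉ p ∷ A₀) → ⊥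
        choose-q {p} hp u (q , hq , q∉) = extension-fan (subst (Extension l (l ∷ [])) suc-lenR (prepend τ
          (Central.grow l l∈ R (corners τ ++ l ∷ []) R⊆
            (Unique-resp-↭ (solve 7 (λ x y p q w l R → q ⊕ (p ⊕ (x ⊕ (y ⊕ (w ⊕ (l ⊕ R))))) ⊜ R ⊕ (x ⊕ (y ⊕ (p ⊕ (q ⊕ (w ⊕ l)))))) ↭-refl
              (x ∷ []) (y ∷ []) (p ∷ []) (q ∷ []) (w ∷ []) (l ∷ []) R) (Unique-∷ q∉ u))
            (≤-trans (≤-reflexive (cong (_+ 4 * length R) (length-++ R))) (≤-trans (m≤m+n _ (length R + 6))
              (≤-trans (≤-reflexive (arith (length R))) (≤-reflexive (cong (λ t → 6 * t + 6) suc-lenR))))))))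
          where
          open import Algebra.Solver.CommutativeMonoid (Perm.++-commutativeMonoid {A = V})
          τ : Triangle l
          τ = triangle hp hq h
          arith : ∀ k → k + 6 + 4 * k + (k + 6) ≡ 6 * suc k + 6
          arith = solve-∀
        choose-p : (∃ λ p → H l x p × p ∉ A₀) → ⊥
        choose-p (p , hp , p∉) = choose-q hp (Unique-∷ p∉ u₀) (pick (H? l y) (p ∷ A₀) (<-trans (small 5 ≤-refl) ly))

    Plain : V → Set
    Plain y = y ∉ T × ¬ Odd y

    plain? : ∀ y → Dec (Plain y)
    plain? y = ¬? (y ∈? T) ×-dec ¬? (odd? y)

    plain-large : ∀ {y l} → Plain y → l ∈ T → K < d l y
    plain-large {y} {l} (y∉ , ¬odd) l∈ = subst (K <_) (d-sym y l) (≰⇒> λ le → ¬odd (y∉ , l , l∈ , le))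

    plainEdge? : ∀ z w y → Dec (H z w y × Plain y)
    plainEdge? z w y = H? z w y ×-dec plain? y

    -- A linear number of plain completions, written without division.
    Heavy : V → V → Set
    Heavy z w = n < C₁₀ * # (plainEdge? z w)

    heavy? : ∀ z w → Dec (Heavy z w)
    heavy? z w = n <? C₁₀ * # (plainEdge? z w)

    module Wide (1≤n : 1 ≤ n) (n-wide : 2 * C₁₀ * (B₀ + K + 2 * C₁₀ * C₆) ≤ n) where

      rough? : ∀ y → Dec (n ≤ 2 * C₁₀ * dirt y)
      rough? y = n ≤? 2 * C₁₀ * dirt y

      rough-few : # rough? ≤ 2 * C₁₀ * C₆
      rough-few = *-cancelʳ-≤ (# rough?) (2 * C₁₀ * C₆) n {{>-nonZero 1≤n}} (begin
        # rough? * n ≤⟨ markov (λ y → 2 * C₁₀ * dirt y) n ⟩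
        ∑ 𝕍 (λ y → 2 * C₁₀ * dirt y) ≡⟨ ∑-*ˡ 𝕍 (2 * C₁₀) dirt ⟩
        2 * C₁₀ * ∑ 𝕍 dirt ≤⟨ *-monoʳ-≤ (2 * C₁₀) dirt≤ ⟩
        2 * C₁₀ * (C₆ * n) ≡⟨ *-assoc (2 * C₁₀) C₆ n ⟨
        2 * C₁₀ * C₆ * n ∎)
        where open ≤-Reasoning

      heavy-many : ∀ {z w} → Heavy z w → B₀ + K + 2 * C₁₀ * C₆ < # (plainEdge? z w)
      heavy-many {z} {w} hv = ≰⇒> λ le → contradiction hv (≤⇒≯ (≤-trans (*-monoʳ-≤ C₁₀ le)
        (≤-trans (*-monoˡ-≤ (B₀ + K + 2 * C₁₀ * C₆) (m≤m+n C₁₀ (C₁₀ + 0))) n-wide)))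

      -- A heavy pair has over `n / C₁₀` plain completions. The dirt of a vertex that is not rough
      -- is below half of this, and `n-wide` bounds the constant part by the other half.
      heavy-more : ∀ {z w y} → Heavy z w → ¬ n ≤ 2 * C₁₀ * dirt y → dirt y + (B₀ + K) < # (plainEdge? z w)
      heavy-more {z} {w} {y} hv ¬rough = ≰⇒> λ le → contradiction (+-mono-≤ (≰⇒> ¬rough) (+-mono-≤ n-wide (*-monoʳ-≤ 2 (≤-trans hv (*-monoʳ-≤ C₁₀ le)))))
        (<⇒≱ (≤-trans (s≤s (m≤m+n _ (2 + 2 * C₁₀ * (2 * C₁₀ * C₆)))) (≤-reflexive (arith n C₁₀ (dirt y) (B₀ + K) (2 * C₁₀ * C₆)))))
        where
        arith : ∀ n c x b r → suc (n + (n + 2 * (c * (x + b))) + (2 + 2 * c * r)) ≡ suc (2 * c * x) + (2 * c * (b + r) + 2 * suc n)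
        arith = solve-∀

      module Peripheral (z : V) where

        -- Now `w₁` and `w₂` expand the sides `z y₁` and `z y₂`, and `l` expands `y₁ y₂`. The vertex
        -- `y₁` must not be rough, so that excluding its dirty partners leaves room for `y₂`.
        grow : ∀ ls ws U → length ws ≡ length ls * 2 → (∀ {l} → l ∈ ls → l ∈ T) → (∀ {w} → w ∈ ws → Heavy z w) →
               Unique (ls ++ (ws ++ U)) → length (ls ++ (ws ++ U)) + 2 * length ls ≤ K → Extension z U (length ls)
        grow [] [] U len ls⊆ hvs u fits = [] , refl , u
        grow (l ∷ ls) (w₁ ∷ w₂ ∷ ws) U len ls⊆ hvs u fits = choose-y₁ (pick (plainEdge? z w₁) (coverOf l ++ (elements rough? ++ Used))
          (≤-trans (s≤s (begin
            length (coverOf l ++ (elements rough? ++ Used)) ≡⟨ trans (length-++ (coverOf l)) (cong (length (coverOf l) +_) (length-++ (elements rough?))) ⟩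
            length (coverOf l) + (length (elements rough?) + length Used)
              ≤⟨ +-mono-≤ (coverOf-length l) (+-mono-≤ (≤-trans (≤-reflexive (length-elements rough?)) rough-few) (<⇒≤ (room 0 z≤n))) ⟩
            B₀ + (2 * C₁₀ * C₆ + K) ≡⟨ trans (cong (B₀ +_) (+-comm _ K)) (sym (+-assoc B₀ K _)) ⟩
            B₀ + K + 2 * C₁₀ * C₆ ∎)) (heavy-many (hvs (here refl)))))
          where
          open ≤-Reasoning
          Used : List V
          Used = l ∷ ls ++ (w₁ ∷ w₂ ∷ ws ++ U)
          room : ∀ i → i ≤ 1 → i + length Used < K
          room i i≤1 = ≤-trans (≤-trans (+-monoˡ-≤ (length Used) (s≤s i≤1)) (≤-trans (≤-reflexive (+-comm 2 (length Used)))
                         (+-monoʳ-≤ (length Used) (≤-trans (m≤m+n 2 (2 * length ls)) (≤-reflexive (sym (*-suc 2 (length ls)))))))) fits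
          Result : Set
          Result = Extension z U (suc (length ls))
          l∈ : l ∈ T
          l∈ = ls⊆ (here refl)
          choose-y₂ : ∀ {y₁} → H z w₁ y₁ × Plain y₁ → y₁ ∉ coverOf l → Unique (y₁ ∷ Used) →
                      (∃ λ y₂ → (H z w₂ y₂ × Plain y₂) × y₂ ∉ elements (dirty? y₁) ++ (coverOf l ++ (y₁ ∷ Used))) → Result
          choose-y₂ {y₁} (h₁ , pl₁) y₁∉ u′ (y₂ , (h₂ , pl₂) , y₂∉) =
            prepend τ (grow ls ws (corners τ ++ U) (suc-injective (suc-injective len)) (ls⊆ ∘ there) (hvs ∘ there ∘ there)
              (Unique-resp-↭ (solve 8 (λ y₁ y₂ w₁ w₂ l L W U → y₂ ⊕ (y₁ ⊕ (l ⊕ (L ⊕ (w₁ ⊕ (w₂ ⊕ (W ⊕ U)))))) ⊜ L ⊕ (W ⊕ (y₁ ⊕ (y₂ ⊕ (w₁ ⊕ (w₂ ⊕ (l ⊕ U))))))) ↭-refl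
                (y₁ ∷ []) (y₂ ∷ []) (w₁ ∷ []) (w₂ ∷ []) (l ∷ []) ls ws U) u″)
              (≤-trans (≤-reflexive (trans (cong (_+ 2 * length ls) (trans (sym (Perm.↭-length perm)) refl)) (arith (length Used) (length ls)))) fits))
            where
            open import Algebra.Solver.CommutativeMonoid (Perm.++-commutativeMonoid {A = V})
            cl : Clean y₁ y₂
            cl = decidable-stable (clean? y₁ y₂) λ ¬cl → y₂∉ (∈-++⁺ˡ (∈-elements⁺ (dirty? y₁) ¬cl))
            τ : Triangle z
            τ = triangle (rot h₁) (rot h₂) (link-complete (plain-large pl₁ l∈) (plain-large pl₂ l∈) (clean⇒≢ cl) (≤-reflexive (sym (proj₁ cl)))
                  y₁∉ (y₂∉ ∘ ∈-++⁺ʳ (elements (dirty? y₁)) ∘ ∈-++⁺ˡ))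
            u″ : Unique (y₂ ∷ y₁ ∷ Used)
            u″ = Unique-∷ (y₂∉ ∘ ∈-++⁺ʳ (elements (dirty? y₁)) ∘ ∈-++⁺ʳ (coverOf l)) u′
            perm : y₂ ∷ y₁ ∷ Used ↭ ls ++ (ws ++ (y₁ ∷ y₂ ∷ w₁ ∷ w₂ ∷ l ∷ U))
            perm = solve 8 (λ y₁ y₂ w₁ w₂ l L W U → y₂ ⊕ (y₁ ⊕ (l ⊕ (L ⊕ (w₁ ⊕ (w₂ ⊕ (W ⊕ U)))))) ⊜ L ⊕ (W ⊕ (y₁ ⊕ (y₂ ⊕ (w₁ ⊕ (w₂ ⊕ (l ⊕ U))))))) ↭-refl
                (y₁ ∷ []) (y₂ ∷ []) (w₁ ∷ []) (w₂ ∷ []) (l ∷ []) ls ws U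
            arith : ∀ m k → suc (suc m) + 2 * k ≡ m + 2 * suc k
            arith = solve-∀
          choose-y₁ : (∃ λ y₁ → (H z w₁ y₁ × Plain y₁) × y₁ ∉ coverOf l ++ (elements rough? ++ Used)) → Result
          choose-y₁ (y₁ , hp , y₁∉) = choose-y₂ hp (y₁∉ ∘ ∈-++⁺ˡ) (Unique-∷ (y₁∉ ∘ ∈-++⁺ʳ (coverOf l) ∘ ∈-++⁺ʳ (elements rough?)) u)
            (pick (plainEdge? z w₂) (elements (dirty? y₁) ++ (coverOf l ++ (y₁ ∷ Used))) (≤-trans (s≤s (begin
              length (elements (dirty? y₁) ++ (coverOf l ++ (y₁ ∷ Used)))   ≡⟨ trans (length-++ (elements (dirty? y₁))) (cong₂ _+_ (length-elements (dirty? y₁)) (length-++ (coverOf l))) ⟩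
              dirt y₁ + (length (coverOf l) + length (y₁ ∷ Used)) ≤⟨ +-monoʳ-≤ (dirt y₁) (+-mono-≤ (coverOf-length l) (<⇒≤ (room 1 ≤-refl))) ⟩
              dirt y₁ + (B₀ + K) ∎))
              (heavy-more {z} {w₂} {y₁} (hvs (there (here refl))) (y₁∉ ∘ ∈-++⁺ʳ (coverOf l) ∘ ∈-++⁺ˡ ∘ ∈-elements⁺ rough?))))

      heavyOdd? : ∀ z w → Dec (Odd w × Heavy z w)
      heavyOdd? z w = odd? w ×-dec heavy? z w

      -- Otherwise z is the centre of a fan with sides {z , aᵢ , wᵢ} and {z , bᵢ , wᵢ′} for 2t heavy
      -- partners wᵢ , wᵢ′, completed by T.
      heavy-few : ∀ {z} → z ∉ T → # (heavyOdd? z) < 2t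
      heavy-few {z} z∉ = ≰⇒> λ le → go (pickMany (heavyOdd? z) 2t le)
        where
        go : (∃ λ ws → length ws ≡ 2t × Unique ws × (∀ {w} → w ∈ ws → Odd w × Heavy z w)) → ⊥
        go (ws , len , u , all) = extension-fan (subst (Extension z (z ∷ [])) T-length
          (Peripheral.grow z T ws (z ∷ []) (trans len (trans (sym (arith t)) (cong (_* 2) (sym T-length)))) id (proj₂ ∘ all)
            (Uniq.++⁺ T-unique (Uniq.++⁺ u ([] ∷ []) λ { (w∈ , here refl) → z∉ws w∈ }) disjoint)
            (≤-trans (≤-reflexive (trans (cong₂ (λ a b → a + 2 * b)
              (trans (length-++ T) (cong₂ _+_ T-length (trans (length-++ ws) (cong (_+ 1) len)))) T-length) (arith₁ t)))
              (≤-trans (m≤m+n (5 * t + 1) (t + 5)) (≤-reflexive (arith₂ t))))))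
          where
          arith : ∀ t → t * 2 ≡ t + t
          arith = solve-∀
          arith₁ : ∀ t → t + (t + t + 1) + 2 * t ≡ 5 * t + 1
          arith₁ = solve-∀
          arith₂ : ∀ t → 5 * t + 1 + (t + 5) ≡ 6 * t + 6
          arith₂ = solve-∀
          z∉ws : z ∉ ws
          z∉ws z∈ with pick (plainEdge? z z) [] (≤-trans (s≤s z≤n) (heavy-many (proj₂ (all z∈))))
          ... | _ , (h , _) , _ = irr h refl
          disjoint : ∀ {x} → ¬ (x ∈ T × x ∈ ws ++ z ∷ [])
          disjoint (x∈T , x∈) with ∈-++⁻ ws x∈
          ... | inj₁ x∈ws = proj₁ (proj₁ (all x∈ws)) x∈T
          ... | inj₂ (here refl) = z∉ x∈T

      -- The final comparison of gained and missing triples.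

      module Counting (n-room : 8 * (t * (t + C₉ + K)) ≤ n) (n-cube : 4 * (C₉ * C₉) ≤ n) where

        τ ω π : V → ℕ
        τ x = 𝟙 (x ∈? T)
        ω x = 𝟙 (odd? x)
        π x = 𝟙 (plain? x)

        -- `μ` marks the loss: non-edges with one kernel, one exceptional and one plain vertex. `α`
        -- marks the gain: edges with two exceptional vertices and a plain one.
        h h̄ μ α : V → V → V → ℕ
        h x y z = 𝟙 (H? x y z)
        h̄ x y z = 𝟙 (¬? (H? x y z))
        μ l z y = τ l * ω z * π y * h̄ l z y
        α z w y = ω z * ω w * π y * h z w y

        Touching : V → V → V → Set
        Touching x y z = (x ≢ y × x ≢ z × y ≢ z) × (x ∈ T ⊎ y ∈ T ⊎ z ∈ T)

        touching? : ∀ x y z → Dec (Touching x y z)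
        touching? x y z = (¬? (x Fin.≟ y) ×-dec ¬? (x Fin.≟ z) ×-dec ¬? (y Fin.≟ z)) ×-dec ((x ∈? T) ⊎-dec (y ∈? T) ⊎-dec (z ∈? T))

        G O : ℕ
        G = ∑³ λ x y z → 𝟙 (touching? x y z)
        O = # odd?

        O≤ : O ≤ C₉
        O≤ = odd-few (≤-trans (≤-trans (m≤n+m 1 (6 * t + 5)) (≤-trans (≤-reflexive (arith t)) (m≤n+m K C₀))) Y-rich)
          where
          arith : ∀ t → 6 * t + 5 + 1 ≡ 6 * t + 6
          arith = solve-∀

        plain-many : n ≤ # plain? + (t + C₉)
        plain-many = begin
          n ≡⟨ sym (trans (∑-const 𝕍 1) (trans (*-identityʳ _) length-𝕍)) ⟩
          ∑ 𝕍 (λ _ → 1) ≤⟨ ∑-mono 𝕍 point ⟩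
          ∑ 𝕍 (λ x → π x + (τ x + ω x)) ≡⟨ trans (∑-+ 𝕍 π _) (cong (# plain? +_) (∑-+ 𝕍 τ ω)) ⟩
          # plain? + (# (_∈? T) + O) ≤⟨ +-monoʳ-≤ (# plain?) (+-mono-≤ (≤-trans (#-∈ T) (≤-reflexive T-length)) O≤) ⟩
          # plain? + (t + C₉) ∎
          where
          open ≤-Reasoning
          point : ∀ x → 1 ≤ π x + (τ x + ω x)
          point x with x ∈? T | odd? x
          ... | yes _ | _     = s≤s z≤n
          ... | no _  | yes _ = s≤s z≤n
          ... | no _  | no _  = s≤s z≤n

        cl : V → Fin 3
        cl x = class (x ∈? T) (odd? x)
          where
          class : Dec (x ∈ T) → Dec (Odd x) → Fin 3
          class (yes _) _ = 0F
          class (no _)  (yes _) = 1F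
          class (no _)  (no _)  = 2F

        cl-τ : ∀ x → τ x ≡ 𝟙 (cl x Fin.≟ 0F)
        cl-τ x with x ∈? T | odd? x
        ... | yes _ | _     = refl
        ... | no _  | yes _ = refl
        ... | no _  | no _  = refl

        cl-ω : ∀ x → ω x ≡ 𝟙 (cl x Fin.≟ 1F)
        cl-ω x with x ∈? T | odd? x
        ... | yes p | yes q = contradiction p (proj₁ q)
        ... | yes _ | no _  = refl
        ... | no _  | yes _ = refl
        ... | no _  | no _  = refl

        cl-π : ∀ x → π x ≡ 𝟙 (cl x Fin.≟ 2F)
        cl-π x with x ∈? T | odd? x
        ... | yes _ | _     = refl
        ... | no _  | yes _ = refl
        ... | no _  | no _  = refl

        cl-0 : ∀ {x} → cl x ≡ 0F → x ∈ T
        cl-0 {x} with x ∈? T | odd? x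
        ... | yes p | _     = λ _ → p
        ... | no _  | yes _ = λ ()
        ... | no _  | no _  = λ ()

        -- `no-edge` rules out two plain vertices, so at least two of the three are exceptional.
        off-T : ∀ {x y z} → H x y z → x ∉ T → y ∉ T → z ∉ T →
                1 ≤ α x y z + (α x z y + α y z x) + ω x * ω y * ω z
        off-T {x} {y} {z} e x∉ y∉ z∉ = go (odd? x) (odd? y) (odd? z)
          where
          l₀ : ∃ λ l → l ∈ T × l ∉ []
          l₀ = pickFrom T-unique [] (≤-trans 1≤t (≤-reflexive (sym T-length)))
          two-plain : ∀ {x y z} → H x y z → x ∉ T → y ∉ T → z ∉ T → ¬ Odd x → ¬ Odd y → ⊥
          two-plain e x∉ y∉ z∉ ¬x ¬y = let _ , l∈ , _ = l₀ in
            no-edge e x∉ y∉ z∉ l∈ (plain-large (x∉ , ¬x) l∈) (plain-large (y∉ , ¬y) l∈)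
          α≡1 : ∀ {x y z} → Odd x → Odd y → Plain z → H x y z → α x y z ≡ 1
          α≡1 {x} {y} {z} p q r e rewrite 𝟙-yes (odd? x) p | 𝟙-yes (odd? y) q | 𝟙-yes (plain? z) r | 𝟙-yes (H? x y z) e = refl
          R : ℕ
          R = α x y z + (α x z y + α y z x) + ω x * ω y * ω z
          go : Dec (Odd x) → Dec (Odd y) → Dec (Odd z) → 1 ≤ R
          go (no p)  (no q)  _ = ⊥-elim (two-plain e x∉ y∉ z∉ p q)
          go (no p)  (yes _) (no r)  = ⊥-elim (two-plain (rot e) x∉ z∉ y∉ p r)
          go (yes _) (no q)  (no r)  = ⊥-elim (two-plain (rot (flip e)) y∉ z∉ x∉ q r)
          go (yes p) (yes q) (no r)  = ≤-trans (≤-reflexive (sym (α≡1 p q (z∉ , r) e)))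
            (≤-trans (m≤m+n (α x y z) (α x z y + α y z x)) (m≤m+n _ (ω x * ω y * ω z)))
          go (yes p) (no q)  (yes r) = ≤-trans (≤-reflexive (sym (α≡1 p r (y∉ , q) (rot e))))
            (≤-trans (≤-trans (m≤m+n (α x z y) (α y z x)) (m≤n+m _ (α x y z))) (m≤m+n _ (ω x * ω y * ω z)))
          go (no p)  (yes q) (yes r) = ≤-trans (≤-reflexive (sym (α≡1 q r (x∉ , p) (rot (flip e)))))
            (≤-trans (≤-trans (m≤n+m (α y z x) (α x z y)) (m≤n+m _ (α x y z))) (m≤m+n _ (ω x * ω y * ω z)))
          go (yes p) (yes q) (yes r) = ≤-trans (≤-reflexive (sym ω≡1)) (m≤n+m (ω x * ω y * ω z) (α x y z + (α x z y + α y z x)))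
            where
            ω≡1 : ω x * ω y * ω z ≡ 1
            ω≡1 rewrite 𝟙-yes (odd? x) p | 𝟙-yes (odd? y) q | 𝟙-yes (odd? z) r = refl

        μ-sum : V → V → V → ℕ
        μ-sum x y z = μ x y z + (μ x z y + (μ y x z + (μ y z x + (μ z x y + μ z y x))))

        μ-sum≡ : ∀ x y z → μ-sum x y z ≡ patterns (cl x) (cl y) (cl z) * h̄ x y z
        μ-sum≡ x y z = trans (cong₂ _+_ (term x y z id id) (cong₂ _+_ (term x z y rot rot) (cong₂ _+_ (term y x z flip flip)
            (cong₂ _+_ (term y z x (flip ∘ rot) (rot ∘ flip)) (cong₂ _+_ (term z x y (rot ∘ flip) (flip ∘ rot)) (term z y x (flip ∘ rot ∘ flip) (flip ∘ rot ∘ flip)))))))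
          (sym (distrib (m (cl x) (cl y) (cl z)) (m (cl x) (cl z) (cl y)) (m (cl y) (cl x) (cl z)) (m (cl y) (cl z) (cl x)) (m (cl z) (cl x) (cl y)) (m (cl z) (cl y) (cl x)) (h̄ x y z)))
          where
          m = pattern₀₁₂
          term : ∀ a b c → (H a b c → H x y z) → (H x y z → H a b c) → μ a b c ≡ m (cl a) (cl b) (cl c) * h̄ x y z
          term a b c f g = cong₂ _*_ (cong₂ _*_ (cong₂ _*_ (cl-τ a) (cl-ω b)) (cl-π c))
            (𝟙-cong (¬? (H? a b c)) (¬? (H? x y z)) (_∘ g) (_∘ f))
          distrib : ∀ a b c d e f k → (a + (b + (c + (d + (e + f))))) * k ≡ a * k + (b * k + (c * k + (d * k + (e * k + f * k))))
          distrib = solve-∀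

        -- An edge meeting `T` is a touching triple; the other edges are handled by `off-T`. A
        -- triple marked by `μ` touches `T` too, and being no edge it has not been charged before.
        pointwise : ∀ x y z → h x y z + μ-sum x y z ≤ 𝟙 (touching? x y z) + (α x y z + (α x z y + α y z x) + ω x * ω y * ω z)
        pointwise x y z = ≤-trans (≤-reflexive (cong (h x y z +_) (μ-sum≡ x y z))) (go (H? x y z))
          where
          g R : ℕ
          g = 𝟙 (touching? x y z)
          R = α x y z + (α x z y + α y z x) + ω x * ω y * ω z
          meets? : Dec (x ∈ T ⊎ y ∈ T ⊎ z ∈ T)
          meets? = (x ∈? T) ⊎-dec (y ∈? T) ⊎-dec (z ∈? T)
          go : (h? : Dec (H x y z)) → 𝟙 h? + patterns (cl x) (cl y) (cl z) * 𝟙 (¬? h?) ≤ g + R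
          go (yes e) = ≤-trans (≤-reflexive (cong suc (*-zeroʳ (patterns (cl x) (cl y) (cl z))))) (meet meets?)
            where
            meet : Dec (x ∈ T ⊎ y ∈ T ⊎ z ∈ T) → 1 ≤ g + R
            meet (yes m) = ≤-trans (≤-reflexive (sym (𝟙-yes (touching? x y z) ((irr e , irr′ e , irr″ e) , m)))) (m≤m+n g R)
            meet (no ¬m) = ≤-trans (off-T e (¬m ∘ inj₁) (¬m ∘ inj₂ ∘ inj₁) (¬m ∘ inj₂ ∘ inj₂)) (m≤n+m R g)
          go (no _) = case (patterns-exclusive (cl x) (cl y) (cl z))
            where
            case : _ → patterns (cl x) (cl y) (cl z) * 1 ≤ g + R
            case (inj₁ p≡0) = ≤-trans (≤-reflexive (cong (_* 1) p≡0)) z≤n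
            case (inj₂ (p≤1 , x≢y , x≢z , y≢z , m)) = ≤-trans (*-monoˡ-≤ 1 p≤1) (≤-trans (≤-reflexive (sym (𝟙-yes (touching? x y z)
              ((x≢y ∘ cong cl , x≢z ∘ cong cl , y≢z ∘ cong cl) , Sum.map cl-0 (Sum.map cl-0 cl-0) m)))) (m≤m+n g R))

        -- The six arrangements of `μ` have equal sums, and so have the three of `α`, which is
        -- symmetric in its exceptional vertices.
        total : N + 6 * ∑³ μ ≤ G + (3 * ∑³ α + O * O * O)
        total = begin
          N + 6 * ∑³ μ ≡⟨ cong (N +_) (sym six) ⟩
          N + ∑³ μ-sum ≡⟨ ∑³-+ h μ-sum ⟨
          ∑³ (λ x y z → h x y z + μ-sum x y z) ≤⟨ ∑³-mono pointwise ⟩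
          ∑³ (λ x y z → 𝟙 (touching? x y z) + (α x y z + (α x z y + α y z x) + ω x * ω y * ω z))
            ≡⟨ trans (∑³-+ _ _) (cong (G +_) (trans (∑³-+ _ _) (cong₂ _+_ three cube))) ⟩
          G + (3 * ∑³ α + O * O * O) ∎
          where
          open ≤-Reasoning
          three : ∑³ (λ x y z → α x y z + (α x z y + α y z x)) ≡ 3 * ∑³ α
          three = trans (∑³-+ α _) (trans (cong (∑³ α +_) (trans (∑³-+ (λ x y z → α x z y) _)
            (cong₂ _+_ (∑³-rot α) (sym (∑³-cycle (λ x y z → α y z x)))))) (arith (∑³ α)))
            where
            arith : ∀ a → a + (a + a) ≡ 3 * a
            arith = solve-∀
          six : ∑³ μ-sum ≡ 6 * ∑³ μ
          six = trans (∑³-+ μ _) (trans (cong (∑³ μ +_) (trans (∑³-+ (λ x y z → μ x z y) _) (cong₂ _+_ (∑³-rot μ)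
            (trans (∑³-+ (λ x y z → μ y x z) _) (cong₂ _+_ (∑³-flip μ)
            (trans (∑³-+ (λ x y z → μ y z x) _) (cong₂ _+_ (sym (∑³-cycle (λ x y z → μ y z x)))
            (trans (∑³-+ (λ x y z → μ z x y) _) (cong₂ _+_ (∑³-cycle μ) (trans (sym (∑³-flip (λ x y z → μ z y x))) (∑³-cycle μ)))))))))))
            (arith (∑³ μ)))
            where
            arith : ∀ a → a + (a + (a + (a + (a + a)))) ≡ 6 * a
            arith = solve-∀
          cube : ∑³ (λ x y z → ω x * ω y * ω z) ≡ O * O * O
          cube = trans (∑-cong 𝕍 λ x → trans (∑-cong 𝕍 λ y → ∑-*ˡ 𝕍 (ω x * ω y) ω)
            (trans (∑-*ʳ 𝕍 O (λ y → ω x * ω y)) (cong (_* O) (∑-*ˡ 𝕍 (ω x) ω))))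
            (trans (∑-*ʳ 𝕍 O (λ x → ω x * O)) (cong (_* O) (∑-*ʳ 𝕍 O ω)))

        gain miss : V → ℕ
        gain z = ∑ 𝕍 λ w → ∑ 𝕍 λ y → α z w y
        miss z = ∑ 𝕍 λ l → ∑ 𝕍 λ y → μ l z y

        module _ {z : V} (z-odd : Odd z) where

          a b : V → ℕ
          a w = # (plainEdge? z w)
          b l = ∑ 𝕍 λ y → π y * h̄ l z y

          A≡ : gain z ≡ ∑ 𝕍 (λ w → ω w * a w)
          A≡ = ∑-cong 𝕍 λ w → trans (∑-cong 𝕍 λ y → trans (cong (λ o → o * ω w * π y * h z w y) (𝟙-yes (odd? z) z-odd))
            (trans (arith (ω w) (π y) (h z w y)) (cong (ω w *_) (sym (𝟙-× (H? z w y) (plain? y)))))) (∑-*ˡ 𝕍 (ω w) _)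
            where
            arith : ∀ o p h → 1 * o * p * h ≡ o * (h * p)
            arith = solve-∀

          M≡ : miss z ≡ ∑ 𝕍 (λ l → τ l * b l)
          M≡ = ∑-cong 𝕍 λ l → trans (∑-cong 𝕍 λ y → trans (cong (λ o → τ l * o * π y * h̄ l z y) (𝟙-yes (odd? z) z-odd))
            (arith (τ l) (π y) (h̄ l z y))) (∑-*ˡ 𝕍 (τ l) _)
            where
            arith : ∀ u p h → u * 1 * p * h ≡ u * (p * h)
            arith = solve-∀

          b-large : ∀ l → # plain? ≤ b l + d l z
          b-large l = ≤-trans (∑-mono 𝕍 point) (≤-reflexive (∑-+ 𝕍 _ _))
            where
            point : ∀ y → π y ≤ π y * h̄ l z y + h l z y
            point y with H? l z y
            ... | yes _ = ≤-trans (𝟙≤1 (plain? y)) (m≤n+m 1 _)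
            ... | no _  = ≤-trans (≤-reflexive (sym (*-identityʳ (π y)))) (m≤m+n _ 0)

          M-one : ∀ {l} → l ∈ T → d l z ≤ K → n ≤ miss z + (t + C₉ + K)
          M-one {l} l∈ le = begin
            n ≤⟨ plain-many ⟩
            # plain? + (t + C₉) ≤⟨ +-monoˡ-≤ (t + C₉) (≤-trans (b-large l) (+-mono-≤ bl≤ le)) ⟩
            miss z + K + (t + C₉) ≡⟨ arith (miss z) K (t + C₉) ⟩
            miss z + (t + C₉ + K) ∎
            where
            open ≤-Reasoning
            bl≤ : b l ≤ miss z
            bl≤ = begin
              b l ≡⟨ *-identityˡ (b l) ⟨
              1 * b l ≡⟨ cong (_* b l) (𝟙-yes (l ∈? T) l∈) ⟨
              τ l * b l ≤⟨ ∑-∈≤ (λ l → τ l * b l) (∈-allFin l) ⟩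
              ∑ 𝕍 (λ l → τ l * b l) ≡⟨ M≡ ⟨
              miss z ∎
            arith : ∀ m k c → m + k + c ≡ m + (c + k)
            arith = solve-∀

          M-all : (∀ {l} → l ∈ T → d l z ≤ K) → t * n ≤ miss z + t * (t + C₉ + K)
          M-all all≤ = begin
            t * n ≤⟨ *-monoʳ-≤ t plain-many ⟩
            t * (# plain? + (t + C₉)) ≡⟨ *-distribˡ-+ t (# plain?) (t + C₉) ⟩
            t * # plain? + t * (t + C₉) ≤⟨ +-monoˡ-≤ (t * (t + C₉)) part ⟩
            miss z + t * K + t * (t + C₉) ≡⟨ arith (miss z) t K (t + C₉) ⟩
            miss z + t * (t + C₉ + K) ∎
            where
            open ≤-Reasoning
            arith : ∀ m t k c → m + t * k + t * c ≡ m + t * (c + k)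
            arith = solve-∀
            point : ∀ l → τ l * # plain? ≤ τ l * b l + τ l * K
            point l with l ∈? T
            ... | no _   = z≤n
            ... | yes l∈ = ≤-trans (*-monoʳ-≤ 1 (≤-trans (b-large l) (+-monoʳ-≤ (b l) (all≤ l∈)))) (≤-reflexive (*-distribˡ-+ 1 (b l) K))
            part : t * # plain? ≤ miss z + t * K
            part = begin
              t * # plain? ≤⟨ *-monoˡ-≤ (# plain?) (≤-trans (≤-reflexive (sym T-length)) (length≤# (_∈? T) T-unique id)) ⟩
              # (_∈? T) * # plain? ≡⟨ ∑-*ʳ 𝕍 (# plain?) τ ⟨
              ∑ 𝕍 (λ l → τ l * # plain?) ≤⟨ ∑-mono 𝕍 point ⟩
              ∑ 𝕍 (λ l → τ l * b l + τ l * K) ≡⟨ trans (∑-+ 𝕍 _ _) (cong₂ _+_ (sym M≡) (∑-*ʳ 𝕍 K τ)) ⟩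
              miss z + # (_∈? T) * K ≤⟨ +-monoʳ-≤ (miss z) (*-monoˡ-≤ K (≤-trans (#-∈ T) (≤-reflexive T-length))) ⟩
              miss z + t * K ∎

          -- At most `2t - 1` heavy partners contribute at most `n` each. The others, at most `C₉`,
          -- contribute at most `n / C₁₀` each, together at most `n / 2` as `C₁₀` is twice `suc C₉`.
          -- So the gain stays `n / 2` below `2t * n`.
          A-bound : 2 * gain z + n ≤ 4 * (t * n)
          A-bound = linear 0 (+-mono-≤ cancelled (*-monoʳ-≤ (2 * n) (heavy-few (proj₁ z-odd))))
            (arith (gain z) n t hh)
            where
            open ≤-Reasoning
            hv? = heavyOdd? z
            hh = # hv?
            point : ∀ w → C₁₀ * (ω w * a w) ≤ C₁₀ * n * 𝟙 (hv? w) + n * ω w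
            point w with odd? w | heavy? z w
            ... | no _  | _ = ≤-trans (≤-reflexive (*-zeroʳ C₁₀)) z≤n
            ... | yes _ | yes _  = ≤-trans (*-monoʳ-≤ C₁₀ (≤-trans (≤-reflexive (*-identityˡ (a w))) (#≤n (plainEdge? z w))))
                                     (≤-trans (≤-reflexive (sym (*-identityʳ (C₁₀ * n)))) (m≤m+n _ _))
            ... | yes _ | no ¬hv = ≤-trans (≤-reflexive (cong (C₁₀ *_) (*-identityˡ (a w)))) (≤-trans (≮⇒≥ ¬hv)
                                     (≤-trans (≤-reflexive (sym (*-identityʳ n))) (m≤n+m _ _)))
            summed : C₁₀ * gain z ≤ C₁₀ * n * hh + n * C₉
            summed = begin
              C₁₀ * gain z ≡⟨ trans (cong (C₁₀ *_) A≡) (sym (∑-*ˡ 𝕍 C₁₀ _)) ⟩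
              ∑ 𝕍 (λ w → C₁₀ * (ω w * a w)) ≤⟨ ∑-mono 𝕍 point ⟩
              ∑ 𝕍 (λ w → C₁₀ * n * 𝟙 (hv? w) + n * ω w) ≡⟨ trans (∑-+ 𝕍 _ _) (cong₂ _+_ (∑-*ˡ 𝕍 (C₁₀ * n) _) (∑-*ˡ 𝕍 n ω)) ⟩
              C₁₀ * n * hh + n * O ≤⟨ +-monoʳ-≤ (C₁₀ * n * hh) (*-monoʳ-≤ n O≤) ⟩
              C₁₀ * n * hh + n * C₉ ∎
            cancelled : 2 * gain z ≤ 2 * n * hh + n
            cancelled = *-cancelˡ-≤ (suc C₉) (begin
              suc C₉ * (2 * gain z) ≡⟨ trans (arith₁ (suc C₉) (gain z)) (cong (_* gain z) (sym C₁₀-def)) ⟩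
              C₁₀ * gain z ≤⟨ summed ⟩
              C₁₀ * n * hh + n * C₉ ≤⟨ +-monoʳ-≤ (C₁₀ * n * hh) (*-monoʳ-≤ n (n≤1+n C₉)) ⟩
              C₁₀ * n * hh + n * suc C₉ ≡⟨ cong (λ c → c * n * hh + n * suc C₉) C₁₀-def ⟩
              2 * suc C₉ * n * hh + n * suc C₉ ≡⟨ arith₂ (suc C₉) n hh ⟩
              suc C₉ * (2 * n * hh + n) ∎)
              where
              arith₁ : ∀ c a → c * (2 * a) ≡ 2 * c * a
              arith₁ = solve-∀
              arith₂ : ∀ c n k → 2 * c * n * k + n * c ≡ c * (2 * n * k + n)
              arith₂ = solve-∀
            arith : ∀ a n t k → 2 * a + n + (2 * n * k + n + 2 * n * (t + t)) + 0 ≡ 4 * (t * n) + (2 * a + 2 * n * suc k)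
            arith = solve-∀

          -- Without gain, one small codegree of `z` with the kernel already leaves about `n`
          -- triples missing. With a gaining edge, `no-edge` makes all `t` codegrees with the kernel
          -- small, so about `t * n` triples are missing. In `total` a missing triple weighs twice
          -- as much as a gained one, which beats the gain of `A-bound`.
          odd-loss : 4 * gain z + n ≤ 8 * miss z
          odd-loss = go (Fin.any? λ w → Fin.any? λ y → odd? w ×-dec plainEdge? z w y)
            where
            go : Dec (∃ λ w → ∃ λ y → Odd w × H z w y × Plain y) → 4 * gain z + n ≤ 8 * miss z
            go (no ¬p) = ≤-trans (≤-reflexive (cong (λ a → 4 * a + n) A≡0)) (bound (proj₂ z-odd))
              where
              A≡0 : gain z ≡ 0
              A≡0 = trans A≡ (trans (∑-cong 𝕍 zero-at) (∑-zero 𝕍))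
                where
                zero-at : ∀ w → ω w * a w ≡ 0
                zero-at w with odd? w
                ... | no _  = refl
                ... | yes o = trans (+-identityʳ (a w)) (trans (∑-cong 𝕍 λ y → 𝟙-no (plainEdge? z w y) λ p → ¬p (w , y , o , p)) (∑-zero 𝕍))
              bound : (∃ λ l → l ∈ T × d z l ≤ K) → n ≤ 8 * miss z
              bound (l , l∈ , le) = linear (6 * n) (+-mono-≤ (*-monoʳ-≤ 8 (M-one l∈ (≤-trans (≤-reflexive (d-sym l z)) le)))
                  (≤-trans (*-monoʳ-≤ 8 (≤-trans (≤-reflexive (sym (*-identityˡ (t + C₉ + K)))) (*-monoˡ-≤ (t + C₉ + K) 1≤t))) n-room))
                (arith n (miss z) (t + C₉ + K))
                where
                arith : ∀ n m r → n + (8 * (m + r) + n) + 6 * n ≡ 8 * m + (8 * n + 8 * r)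
                arith = solve-∀
            go (yes (w , y , w-odd , e , pl)) = linear 0 (+-mono-≤ (*-monoʳ-≤ 2 A-bound) (+-mono-≤ (*-monoʳ-≤ 8 (M-all all≤)) n-room))
              (arith (gain z) n (miss z) t (t * (t + C₉ + K)))
              where
              all≤ : ∀ {l} → l ∈ T → d l z ≤ K
              all≤ l∈ = ≮⇒≥ λ lz → no-edge (rot e) (proj₁ z-odd) (proj₁ pl) (proj₁ w-odd) l∈ lz (plain-large pl l∈)
              arith : ∀ a n m t r → 4 * a + n + (2 * (4 * (t * n)) + (8 * (m + r) + n)) + 0 ≡ 8 * m + (2 * (2 * a + n) + (8 * (t * n) + 8 * r))
              arith = solve-∀

        loss : ∀ z → 4 * gain z + n * ω z ≤ 8 * miss z
        loss z = go (odd? z)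
          where
          go : Dec (Odd z) → 4 * gain z + n * ω z ≤ 8 * miss z
          go (yes o) = ≤-trans (≤-reflexive (cong (4 * gain z +_) (trans (cong (n *_) (𝟙-yes (odd? z) o)) (*-identityʳ n)))) (odd-loss o)
          go (no ¬o) = ≤-trans (≤-reflexive (cong₂ (λ a m → 4 * a + m) A≡0 (trans (cong (n *_) (𝟙-no (odd? z) ¬o)) (*-zeroʳ n)))) z≤n
            where
            A≡0 : gain z ≡ 0
            A≡0 = trans (∑-cong 𝕍 λ w → trans (∑-cong 𝕍 λ y → cong (λ o → o * ω w * π y * h z w y) (𝟙-no (odd? z) ¬o)) (∑-zero 𝕍)) (∑-zero 𝕍)

        loss-sum : 4 * ∑³ α + n * O ≤ 8 * ∑³ μ
        loss-sum = begin
          4 * ∑³ α + n * O ≡⟨ sym (trans (∑-+ 𝕍 _ _) (cong₂ _+_ (∑-*ˡ 𝕍 4 gain) (∑-*ˡ 𝕍 n ω))) ⟩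
          ∑ 𝕍 (λ z → 4 * gain z + n * ω z) ≤⟨ ∑-mono 𝕍 loss ⟩
          ∑ 𝕍 (λ z → 8 * miss z) ≡⟨ ∑-*ˡ 𝕍 8 miss ⟩
          8 * ∑ 𝕍 miss ≡⟨ cong (8 *_) (∑³-flip μ) ⟩
          8 * ∑³ μ ∎
          where open ≤-Reasoning

        -- Four times `total` plus three times `loss-sum`. The term `n * O` absorbs the triples
        -- inside the exceptional set, because `n` is at least `4 * (C₉ * C₉)`.
        N≤G : N ≤ G
        N≤G = *-cancelˡ-≤ 4 (linear (2 * (n * O)) (+-mono-≤ (*-monoʳ-≤ 4 total) (+-mono-≤ (*-monoʳ-≤ 3 loss-sum) cube≤))
                (arith N (∑³ μ) G (∑³ α) (O * O * O) (n * O)))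
          where
          cube≤ : 4 * (O * O * O) ≤ n * O
          cube≤ = ≤-trans (≤-reflexive (sym (*-assoc 4 (O * O) O))) (*-monoˡ-≤ O (≤-trans (*-monoʳ-≤ 4 (*-mono-≤ O≤ O≤)) n-cube))
          arith : ∀ N m G a c k → 4 * N + (4 * (G + (3 * a + c)) + (3 * (8 * m) + k)) + 2 * k ≡ 4 * G + (4 * (N + 6 * m) + (3 * (4 * a + k) + 4 * c))
          arith = solve-∀

-- Binomial coefficients and the number of distinct triples.

falling : ℕ → ℕ
falling k = k * (pred k * pred (pred k))

2*C2 : ∀ n → 2 * (n C 2) ≡ n * pred n
2*C2 zero = refl
2*C2 (suc n) = begin
  2 * (suc n C 2) ≡⟨ cong (2 *_) (nCk+nC[k+1]≡[n+1]C[k+1] n 1) ⟨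
  2 * (n C 1 + n C 2) ≡⟨ *-distribˡ-+ 2 (n C 1) (n C 2) ⟩
  2 * (n C 1) + 2 * (n C 2)    ≡⟨ cong₂ _+_ (cong (2 *_) (nC1≡n n)) (2*C2 n) ⟩
  2 * n + n * pred n ≡⟨ step n ⟩
  suc n * n ∎
  where
  open ≡-Reasoning
  step : ∀ n → 2 * n + n * pred n ≡ suc n * n
  step zero    = refl
  step (suc n) = arith n
    where
    arith : ∀ n → 2 * suc n + suc n * n ≡ suc (suc n) * suc n
    arith = solve-∀

6*C3 : ∀ n → 6 * (n C 3) ≡ falling n
6*C3 zero = refl
6*C3 (suc n) = begin
  6 * (suc n C 3) ≡⟨ cong (6 *_) (nCk+nC[k+1]≡[n+1]C[k+1] n 2) ⟨
  6 * (n C 2 + n C 3) ≡⟨ trans (*-distribˡ-+ 6 (n C 2) (n C 3)) (cong (_+ 6 * (n C 3)) (*-assoc 3 2 (n C 2))) ⟩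
  3 * (2 * (n C 2)) + 6 * (n C 3)    ≡⟨ cong₂ (λ a b → 3 * a + b) (2*C2 n) (6*C3 n) ⟩
  3 * (n * pred n) + falling n ≡⟨ step n ⟩
  falling (suc n) ∎
  where
  open ≡-Reasoning
  step : ∀ n → 3 * (n * pred n) + falling n ≡ falling (suc n)
  step zero = refl
  step (suc zero)    = refl
  step (suc (suc n)) = arith n
    where
    arith : ∀ n → 3 * (suc (suc n) * suc n) + suc (suc n) * (suc n * n) ≡ suc (suc (suc n)) * (suc (suc n) * suc n)
    arith = solve-∀

-- The difference of the two sides is `3mt(t - 2) + t(t - 1)(t - 2)`; this is where `t > 1` matters
-- for the density threshold.
falling-step : ∀ {m t} → 2 ≤ m → 2 ≤ t → 3 * t * (m * m) + falling m ≤ falling (m + t)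
falling-step {suc (suc k)} {suc (suc s)} (s≤s (s≤s z≤n)) (s≤s (s≤s z≤n)) =
  m+n≤o⇒m≤o _ {3 * (2 + k) * (2 + s) * s + (2 + s) * (1 + s) * s} (≤-reflexive (arith k s))
  where
  arith : ∀ k s → 3 * (2 + s) * ((2 + k) * (2 + k)) + (2 + k) * ((1 + k) * k) + (3 * (2 + k) * (2 + s) * s + (2 + s) * (1 + s) * s)
                ≡ (2 + k + (2 + s)) * ((1 + k + (2 + s)) * (k + (2 + s)))
  arith = solve-∀

module DistinctTriples {n : ℕ} where

  open Vertices {n} public
  open TripleSums {n} public

  module _ {P : V → Set} (P? : Decidable P) where

    #-remove : ∀ {x} → P x → # (λ y → P? y ×-dec ¬? (y Fin.≟ x)) ≡ pred (# P?)
    #-remove {x} px = sym (cong pred (≤-antisym upper lower))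
      where
      rest? : Decidable (λ y → P y × y ≢ x)
      rest? y = P? y ×-dec ¬? (y Fin.≟ x)
      upper : # P? ≤ suc (# rest?)
      upper = ≤-trans (#-⊎ P? (λ y → y ∈? (x ∷ [])) rest? split) (+-monoˡ-≤ (# rest?) (#-∈ (x ∷ [])))
        where
        split : ∀ {y} → P y → y ∈ x ∷ [] ⊎ (P y × y ≢ x)
        split {y} py with y Fin.≟ x
        ... | yes p = inj₁ (here p)
        ... | no q  = inj₂ (py , q)
      lower : suc (# rest?) ≤ # P?
      lower = subst (λ l → suc l ≤ # P?) (length-elements rest?)
        (length≤# P? (Unique-∷ (λ x∈ → proj₂ (∈-elements⁻ rest? x∈) refl) (elements-unique rest?))
          λ { (here refl) → px ; (there y∈) → proj₁ (∈-elements⁻ rest? y∈) })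

  Distinct : V → V → V → Set
  Distinct x y z = x ≢ y × x ≢ z × y ≢ z

  distinct? : ∀ x y z → Dec (Distinct x y z)
  distinct? x y z = ¬? (x Fin.≟ y) ×-dec ¬? (x Fin.≟ z) ×-dec ¬? (y Fin.≟ z)

  module _ {P : V → Set} (P? : Decidable P) where

    within? : ∀ x y z → Dec ((P x × P y × P z) × Distinct x y z)
    within? x y z = (P? x ×-dec P? y ×-dec P? z) ×-dec distinct? x y z

    distinct-count : ∑³ (λ x y z → 𝟙 (within? x y z)) ≡ falling (# P?)
    distinct-count = trans (∑-cong 𝕍 row) (∑-*ʳ 𝕍 (pred k * pred (pred k)) (λ x → 𝟙 (P? x)))
      where
      k = # P?
      row : ∀ x → ∑ 𝕍 (λ y → ∑ 𝕍 (λ z → 𝟙 (within? x y z))) ≡ 𝟙 (P? x) * (pred k * pred (pred k))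
      row x = go (P? x)
        where
        second? : Decidable (λ y → P y × y ≢ x)
        second? y = P? y ×-dec ¬? (y Fin.≟ x)
        go : (p? : Dec (P x)) → ∑ 𝕍 (λ y → ∑ 𝕍 (λ z → 𝟙 (within? x y z))) ≡ 𝟙 p? * (pred k * pred (pred k))
        go (no ¬p) = trans (∑-cong 𝕍 λ y → trans (∑-cong 𝕍 λ z → 𝟙-no (within? x y z) (¬p ∘ proj₁ ∘ proj₁)) (∑-zero 𝕍)) (∑-zero 𝕍)
        go (yes px) = trans (∑-cong 𝕍 λ y → inner y (second? y)) (trans (∑-*ʳ 𝕍 (pred (pred k)) (λ y → 𝟙 (second? y)))
          (trans (cong (_* pred (pred k)) (#-remove P? px)) (sym (*-identityˡ _))))
          where
          inner : ∀ y (s? : Dec (P y × y ≢ x)) → ∑ 𝕍 (λ z → 𝟙 (within? x y z)) ≡ 𝟙 s? * pred (pred k)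
          inner y (no ¬s) = trans (∑-cong 𝕍 λ z → 𝟙-no (within? x y z) λ { ((_ , py , _) , x≢y , _) → ¬s (py , x≢y ∘ sym) }) (∑-zero 𝕍)
          inner y (yes (py , y≢x)) = trans (∑-cong 𝕍 λ z → 𝟙-cong (within? x y z) (second? z ×-dec ¬? (z Fin.≟ y))
              (λ { ((_ , _ , pz) , _ , x≢z , y≢z) → (pz , x≢z ∘ sym) , y≢z ∘ sym })
              (λ { ((pz , z≢x) , z≢y) → (px , py , pz) , y≢x ∘ sym , z≢x ∘ sym , z≢y ∘ sym }))
            (trans (#-remove second? (py , y≢x)) (trans (cong pred (#-remove P? px)) (sym (*-identityˡ _))))

-- A sum of all lower bounds required of `n`, so that each of them follows by monotonicity.
threshold : ℕ → ℕ
threshold t = 1 + 4 * (2 ^ C₀ * (t * B₀) + C₀) + (1 + CY * (C₀ + K) + (2 * C₁₀ * (B₀ + K + 2 * C₁₀ * C₆)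
                + (8 * (t * (t + C₉ + K)) + (4 * (C₉ * C₉) + (2 + t)))))
  where open Constants t

-- Assembly of the upper bound for ternary relations.

module Upper {n t : ℕ} (𝒮 : Setting n t) (n≥n₀ : threshold t ≤ n) where

  open Core 𝒮
  open TripleSums {n}
  open DistinctTriples {n} using (Distinct; distinct?; within?; distinct-count)

  private
    x₁ = 1 + 4 * (2 ^ C₀ * (t * B₀) + C₀)
    x₂ = 1 + CY * (C₀ + K)
    x₃ = 2 * C₁₀ * (B₀ + K + 2 * C₁₀ * C₆)
    x₄ = 8 * (t * (t + C₉ + K))
    x₅ = 4 * (C₉ * C₉)

    ≤₂ : x₂ + (x₃ + (x₄ + (x₅ + (2 + t)))) ≤ n
    ≤₂ = ≤-trans (m≤n+m _ x₁) n≥n₀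
    ≤₃ : x₃ + (x₄ + (x₅ + (2 + t))) ≤ n
    ≤₃ = ≤-trans (m≤n+m _ x₂) ≤₂
    ≤₄ : x₄ + (x₅ + (2 + t)) ≤ n
    ≤₄ = ≤-trans (m≤n+m _ x₃) ≤₃
    ≤₅ : x₅ + (2 + t) ≤ n
    ≤₅ = ≤-trans (m≤n+m _ x₄) ≤₄
    ≤₆ : 2 + t ≤ n
    ≤₆ = ≤-trans (m≤n+m _ x₅) ≤₅

    n-big : x₁ ≤ n
    n-big = ≤-trans (m≤m+n x₁ _) n≥n₀
    n-rich : x₂ ≤ n
    n-rich = ≤-trans (m≤m+n x₂ _) ≤₂
    n-wide : x₃ ≤ n
    n-wide = ≤-trans (m≤m+n x₃ _) ≤₃
    n-room : x₄ ≤ n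
    n-room = ≤-trans (m≤m+n x₄ _) ≤₄
    n-cube : x₅ ≤ n
    n-cube = ≤-trans (m≤m+n x₅ _) ≤₅

    m : ℕ
    m = n ∸ t
    n≡ : n ≡ m + t
    n≡ = sym (m∸n+n≡m (≤-trans (m≤n+m t 2) ≤₆))
    2≤m : 2 ≤ m
    2≤m = +-cancelʳ-≤ t 2 m (≤-trans ≤₆ (≤-reflexive n≡))

  module _ (dense : 3 * t * (m * m) ≤ N) where

    dirt≤ : ∑ 𝕍 dirt ≤ C₆ * n
    dirt≤ = dirt-few n≡ dense

    -- The triples touching `T` and those avoiding it, `falling m` in number, are disjoint families
    -- of distinct triples.
    bounded : (𝒦 : Kernel) → N + falling m ≤ falling n
    bounded 𝒦 = begin
      N + falling m ≤⟨ +-monoˡ-≤ (falling m) N≤G ⟩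
      G + falling m ≡⟨ cong (λ k → G + falling k) (sym off-T-size) ⟩
      G + falling (# offT?) ≡⟨ cong (G +_) (distinct-count offT?) ⟨
      G + ∑³ (λ x y z → 𝟙 (within? offT? x y z)) ≡⟨ ∑³-+ _ _ ⟨
      ∑³ (λ x y z → 𝟙 (touching? x y z) + 𝟙 (within? offT? x y z)) ≤⟨ ∑³-mono split ⟩
      ∑³ (λ x y z → 𝟙 (within? every? x y z)) ≡⟨ distinct-count every? ⟩
      falling (# every?) ≤⟨ falling-mono (#≤n every?) ⟩
      falling n ∎
      where
      open ≤-Reasoning
      open Kernel 𝒦
      Y-rich : C₀ + K ≤ length Y
      Y-rich = ≮⇒≥ λ lt → contradiction n-rich (≤⇒≯ (≤-trans Y-many (*-monoʳ-≤ CY (<⇒≤ lt))))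
      open OffKernel dirt≤ 𝒦 Y-rich
      open Wide (≤-trans (s≤s z≤n) n-big) n-wide
      open Counting n-room n-cube
      offT? : Decidable (_∉ T)
      offT? x = ¬? (x ∈? T)
      every? : Decidable (λ (_ : V) → ⊤)
      every? _ = yes tt
      falling-mono : ∀ {a b} → a ≤ b → falling a ≤ falling b
      falling-mono a≤b = *-mono-≤ a≤b (*-mono-≤ (pred-mono-≤ a≤b) (pred-mono-≤ (pred-mono-≤ a≤b)))
      off-T-size : # offT? ≡ m
      off-T-size = +-cancelʳ-≡ t (# offT?) m (trans (trans (cong (# offT? +_) (sym T-size)) all) n≡)
        where
        T-size : # (_∈? T) ≡ t
        T-size = ≤-antisym (≤-trans (#-∈ T) (≤-reflexive T-length)) (≤-trans (≤-reflexive (sym T-length)) (length≤# (_∈? T) T-unique id))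
        all : # offT? + # (_∈? T) ≡ n
        all = trans (sym (∑-+ 𝕍 _ _)) (trans (∑-cong 𝕍 one) (trans (∑-const 𝕍 1) (trans (*-identityʳ _) length-𝕍)))
          where
          one : ∀ x → 𝟙 (offT? x) + 𝟙 (x ∈? T) ≡ 1
          one x with x ∈? T
          ... | yes _ = refl
          ... | no _  = refl
      split : ∀ x y z → 𝟙 (touching? x y z) + 𝟙 (within? offT? x y z) ≤ 𝟙 (within? every? x y z)
      split x y z = go (touching? x y z) (within? offT? x y z)
        where
        go : (p? : Dec (Touching x y z)) (q? : Dec ((x ∉ T × y ∉ T × z ∉ T) × Distinct x y z)) → 𝟙 p? + 𝟙 q? ≤ 𝟙 (within? every? x y z)
        go (yes (_ , mt)) (yes ((p , q , r) , _)) = ⊥-elim ([ p , [ q , r ]′ ]′ mt)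
        go (yes (dst , _)) (no _) = ≤-reflexive (sym (𝟙-yes (within? every? x y z) (_ , dst)))
        go (no _) (yes (_ , dst)) = ≤-reflexive (sym (𝟙-yes (within? every? x y z) (_ , dst)))
        go (no _) (no _) = z≤n

  upper : N + falling m ≤ falling n
  -- Below this density `falling-step` gives the bound at once, so the structure is needed only in
  -- the dense case.
  upper with 3 * t * (m * m) ≤? N
  ... | yes dense = bounded dense (kernel (dirt≤ dense) n-big)
  ... | no sparse = ≤-trans (+-monoˡ-≤ (falling m) (<⇒≤ (≰⇒> sparse)))
                      (≤-trans (falling-step 2≤m 1<t) (≤-reflexive (cong falling (sym n≡))))

open import Defs
import Data.Bool.Properties as Bool
open import Data.Fin using (zero; suc; toℕ; fromℕ<)
open import Data.Fin.Subset using (Subset; inside; outside; ∣_∣; ⁅_⁆; _∪_) renaming (_∈_ to _∈ₛ_; ⊥ to ∅)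
import Data.Fin.Subset.Properties as Sub
open import Data.Vec using ([]; _∷_)
import Data.Vec as Vec
import Data.Vec.Properties as Vec

-- From lists of 3-sets to symmetric ternary relations.

module _ {n : ℕ} where

  open DistinctTriples {n}

  _∈ₛ?_ : ∀ (x : V) (S : Subset n) → Dec (x ∈ₛ S)
  _∈ₛ?_ = Sub._∈?_

  triple-members : ∀ {x y z w : V} → w ∈ₛ triple x y z → w ∈ x ∷ y ∷ z ∷ []
  triple-members {x} {y} {z} {w} w∈ with Sub.x∈p∪q⁻ ⁅ x ⁆ (⁅ y ⁆ ∪ ⁅ z ⁆) w∈
  ... | inj₁ p = here (Sub.x∈⁅y⁆⇒x≡y x p)
  ... | inj₂ q with Sub.x∈p∪q⁻ ⁅ y ⁆ ⁅ z ⁆ q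
  ...   | inj₁ p = there (here (Sub.x∈⁅y⁆⇒x≡y y p))
  ...   | inj₂ p = there (there (here (Sub.x∈⁅y⁆⇒x≡y z p)))

  members-triple : ∀ {x y z w : V} → w ∈ x ∷ y ∷ z ∷ [] → w ∈ₛ triple x y z
  members-triple {x} (here refl) = Sub.x∈p∪q⁺ (inj₁ (Sub.x∈⁅x⁆ x))
  members-triple {y = y} (there (here refl)) = Sub.x∈p∪q⁺ (inj₂ (Sub.x∈p∪q⁺ (inj₁ (Sub.x∈⁅x⁆ y))))
  members-triple {z = z} (there (there (here refl))) = Sub.x∈p∪q⁺ (inj₂ (Sub.x∈p∪q⁺ (inj₂ (Sub.x∈⁅x⁆ z))))

  triple-cong : ∀ {x y z x′ y′ z′ : V} → x ∷ y ∷ z ∷ [] ↭ x′ ∷ y′ ∷ z′ ∷ [] → triple x y z ≡ triple x′ y′ z′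
  triple-cong p = Sub.⊆-antisym (λ w∈ → members-triple (Perm.∈-resp-↭ p (triple-members w∈)))
                                (λ w∈ → members-triple (Perm.∈-resp-↭ (↭-sym p) (triple-members w∈)))

∑-tabulate : ∀ {A : Set} {n} (g : Fin n → A) (f : A → ℕ) → ∑ (tabulate g) f ≡ ∑ (allFin n) (f ∘ g)
∑-tabulate {n = zero}  g f = refl
∑-tabulate {n = suc n} g f = cong (f (g zero) +_) (trans (∑-tabulate (g ∘ suc) f) (sym (∑-tabulate suc (f ∘ g))))

#-subset : ∀ {n} (S : Subset n) → Vertices.# (λ x → x ∈ₛ? S) ≡ ∣ S ∣
#-subset [] = refl
#-subset {suc n} (s ∷ S) = trans (cong (𝟙 (zero ∈ₛ? (s ∷ S)) +_) (trans (∑-tabulate suc (λ x → 𝟙 (x ∈ₛ? (s ∷ S))))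
  (trans (∑-cong (allFin n) λ x → 𝟙-cong (suc x ∈ₛ? (s ∷ S)) (x ∈ₛ? S) Sub.drop-there Vec.there) (#-subset S)))) (head s)
  where
  head : ∀ s → 𝟙 (zero ∈ₛ? (s ∷ S)) + ∣ S ∣ ≡ ∣ s ∷ S ∣
  head inside  = refl
  head outside = refl

∑-at-most-one : ∀ {A B : Set} {Q : A → Set} (Q? : Decidable Q) (b? : Dec B) {x₀} {xs : List A} → Unique xs →
                (∀ {x} → x ∈ xs → Q x → x ≡ x₀ × B) → ∑ xs (λ x → 𝟙 (Q? x)) ≤ 𝟙 b?
∑-at-most-one Q? b? [] _ = z≤n
∑-at-most-one {Q = Q} Q? b? {xs = x ∷ xs} (x∉ ∷ u) f with Q? x
... | no _  = ∑-at-most-one Q? b? u (f ∘ there)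
... | yes q = ≤-trans (≤-reflexive (cong suc (none xs x∉ (f ∘ there)))) (≤-reflexive (sym (𝟙-yes b? (proj₂ (f (here refl) q)))))
  where
  none : ∀ ys → All (x ≢_) ys → (∀ {y} → y ∈ ys → Q y → y ≡ _ × _) → ∑ ys (λ y → 𝟙 (Q? y)) ≡ 0
  none [] [] _ = refl
  none (y ∷ ys) (p ∷ ps) g = cong₂ _+_ (𝟙-no (Q? y) λ qy → p (trans (proj₁ (f (here refl) q)) (sym (proj₁ (g (here refl) qy))))) (none ys ps (g ∘ there))

unique-++⁻ : ∀ {A : Set} (xs : List A) {ys} → Unique (xs ++ ys) → Unique xs × Unique ys × (∀ {x} → x ∈ xs → x ∉ ys)
unique-++⁻ [] u = [] , u , λ ()
unique-++⁻ (x ∷ xs) (x∉ ∷ u) with ux , uy , dis ← unique-++⁻ xs u =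
  All.tabulate (λ y∈ → All.lookup x∉ (∈-++⁺ˡ y∈)) ∷ ux , uy ,
  λ { (here refl) x∈ → All.lookup x∉ (∈-++⁺ʳ xs x∈) refl ; (there p) → dis p }

lookup-injective : ∀ {A : Set} {xs : List A} → Unique xs → ∀ i j → lookup xs i ≡ lookup xs j → i ≡ j
lookup-injective (x∉ ∷ u) zero    zero    _  = refl
lookup-injective (x∉ ∷ u) zero    (suc j) eq = contradiction eq (All.lookup x∉ (∈-lookup j))
lookup-injective (x∉ ∷ u) (suc i) zero    eq = contradiction (sym eq) (All.lookup x∉ (∈-lookup i))
lookup-injective (x∉ ∷ u) (suc i) (suc j) eq = cong suc (lookup-injective u i j eq)

module FromGraph {n : ℕ} (𝒢 : 3Graph n) where

  open DistinctTriples {n}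

  H : V → V → V → Set
  H x y z = Distinct x y z × triple x y z ∈ edges 𝒢

  H? : ∀ x y z → Dec (H x y z)
  H? x y z = distinct? x y z ×-dec Any.any? (Vec.≡-dec Bool._≟_ (triple x y z)) (edges 𝒢)

  H-flip : ∀ {x y z} → H x y z → H y x z
  H-flip ((p , q , r) , e) = (p ∘ sym , r , q) , subst (_∈ edges 𝒢) (triple-cong (swap _ _ ↭-refl)) e

  H-rot : ∀ {x y z} → H x y z → H x z y
  H-rot ((p , q , r) , e) = (q , p , r ∘ sym) , subst (_∈ edges 𝒢) (triple-cong (prep _ (swap _ _ ↭-refl))) e

  -- Each 3-set has six orderings, and an ordered triple of distinct vertices lies in at most one
  -- listed set, because the list has no repetitions.
  edge-count : 6 * e 𝒢 ≤ ∑³ (λ x y z → 𝟙 (H? x y z))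
  edge-count = begin
    6 * e 𝒢 ≡⟨ trans (*-comm 6 (e 𝒢)) (sym (∑-const (edges 𝒢) 6)) ⟩
    ∑ (edges 𝒢) (λ _ → 6) ≤⟨ ∑-mono∈ (edges 𝒢) (λ {S} S∈ → ≤-reflexive (sym (six S∈))) ⟩
    ∑ (edges 𝒢) (λ S → ∑³ (λ x y z → 𝟙 (in? S x y z)))
      ≡⟨ trans (∑-swap (edges 𝒢) 𝕍 _) (∑-cong 𝕍 λ x → trans (∑-swap (edges 𝒢) 𝕍 _) (∑-cong 𝕍 λ y → ∑-swap (edges 𝒢) 𝕍 _)) ⟩
    ∑³ (λ x y z → ∑ (edges 𝒢) (λ S → 𝟙 (in? S x y z)))
      ≤⟨ ∑³-mono (λ x y z → ∑-at-most-one (λ S → in? S x y z) (H? x y z) {triple x y z} (distinct 𝒢) (only x y z)) ⟩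
    ∑³ (λ x y z → 𝟙 (H? x y z)) ∎
    where
    open ≤-Reasoning
    in? : ∀ S x y z → Dec ((x ∈ₛ S × y ∈ₛ S × z ∈ₛ S) × Distinct x y z)
    in? S = within? (λ x → x ∈ₛ? S)
    size : ∀ {S} → S ∈ edges 𝒢 → # (λ x → x ∈ₛ? S) ≡ 3
    size {S} S∈ = trans (#-subset S) (All.lookup (uniform 𝒢) S∈)
    six : ∀ {S} → S ∈ edges 𝒢 → ∑³ (λ x y z → 𝟙 (in? S x y z)) ≡ 6
    six {S} S∈ = trans (distinct-count (λ x → x ∈ₛ? S)) (cong falling (size S∈))
    only : ∀ x y z {S} → S ∈ edges 𝒢 → (x ∈ₛ S × y ∈ₛ S × z ∈ₛ S) × Distinct x y z → S ≡ triple x y z × H x y z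
    only x y z {S} S∈ ((p , q , r) , dst@(x≢y , x≢z , y≢z)) = S≡ , dst , subst (_∈ edges 𝒢) S≡ S∈
      where
      inS : ∀ {w} → w ∈ x ∷ y ∷ z ∷ [] → w ∈ₛ S
      inS (here refl) = p
      inS (there (here refl)) = q
      inS (there (there (here refl))) = r
      S≡ : S ≡ triple x y z
      S≡ = Sub.⊆-antisym (λ w∈ → members-triple (#-full (λ x → x ∈ₛ? S) ((x≢y ∷ x≢z ∷ []) ∷ (y≢z ∷ []) ∷ [] ∷ []) inS (≤-reflexive (size S∈)) w∈))
                         (λ w∈ → inS (triple-members w∈))

  open Fans H

  fan⇒contains : ∀ {t} → Fan t → ContainsExpandedFan t 𝒢
  fan⇒contains (c , τs , refl , c∉ ∷ u) = φ , φ-injective , λ i →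
    let open Triangle (lookup τs i) in proj₂ Hcap , proj₂ Hcbq , proj₂ Habr
    where
    slot : ∀ (τs : List (Triangle c)) → Fin (length τs) → Fin 5 → V
    slot τs i k = lookup (corners (lookup τs i)) k
    slot-∈ : ∀ τs i k → slot τs i k ∈ concatMap corners τs
    slot-∈ (τ ∷ τs) zero    k = ∈-++⁺ˡ (∈-lookup {xs = corners τ} k)
    slot-∈ (τ ∷ τs) (suc i) k = ∈-++⁺ʳ (corners τ) (slot-∈ τs i k)
    slot-injective : ∀ τs → Unique (concatMap corners τs) → ∀ i j k l → slot τs i k ≡ slot τs j l → (i , k) ≡ (j , l)
    slot-injective (τ ∷ τs) u i j k l eq with uτ , uτs , dis ← unique-++⁻ (corners τ) u = go i j eq
      where
      go : ∀ i j → slot (τ ∷ τs) i k ≡ slot (τ ∷ τs) j l → (i , k) ≡ (j , l)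
      go zero    zero    eq = cong (zero ,_) (lookup-injective uτ k l eq)
      go zero    (suc j) eq = contradiction (subst (_∈ concatMap corners τs) (sym eq) (slot-∈ τs j l)) (dis (∈-lookup {xs = corners τ} k))
      go (suc i) zero    eq = contradiction (subst (_∈ concatMap corners τs) eq (slot-∈ τs i k)) (dis (∈-lookup {xs = corners τ} l))
      go (suc i) (suc j) eq with refl ← slot-injective τs uτs i j k l eq = refl
    decode : Fin (length τs) × Fin 5 → FanVertex (length τs)
    decode (i , 0F) = a i
    decode (i , 1F) = b i
    decode (i , 2F) = ca i
    decode (i , 3F) = cb i
    decode (i , 4F) = ab i
    -- This view reduces the injectivity of `φ` to comparing the centre with slots, instead of all
    -- pairs of constructors.
    data Code : FanVertex (length τs) → Set where
      centre : Code center
      outer  : ∀ i k → Code (decode (i , k))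
    code : ∀ v → Code v
    code center = centre
    code (a i)  = outer i 0F
    code (b i)  = outer i 1F
    code (ca i) = outer i 2F
    code (cb i) = outer i 3F
    code (ab i) = outer i 4F
    φ : FanVertex (length τs) → V
    φ center = c
    φ (a i)  = slot τs i 0F
    φ (b i)  = slot τs i 1F
    φ (ca i) = slot τs i 2F
    φ (cb i) = slot τs i 3F
    φ (ab i) = slot τs i 4F
    φ-decode : ∀ i k → φ (decode (i , k)) ≡ slot τs i k
    φ-decode i 0F = refl
    φ-decode i 1F = refl
    φ-decode i 2F = refl
    φ-decode i 3F = refl
    φ-decode i 4F = refl
    off-centre : ∀ i k → c ≢ slot τs i k
    off-centre i k = All.lookup c∉ (slot-∈ τs i k)
    φ-injective : ∀ {v w} → φ v ≡ φ w → v ≡ w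
    φ-injective {v} {w} eq with code v | code w
    ... | centre    | centre    = refl
    ... | centre    | outer i k = contradiction (trans eq (φ-decode i k)) (off-centre i k)
    ... | outer i k | centre    = contradiction (trans (sym eq) (φ-decode i k)) (off-centre i k)
    ... | outer i k | outer j l = cong decode (slot-injective τs u i j k l (trans (sym (φ-decode i k)) (trans eq (φ-decode j l))))

  setting : ∀ {t} → 1 < t → ¬ ContainsExpandedFan t 𝒢 → Setting n t
  setting 1<t ¬fan = record
    { H = H ; H? = H? ; flip = H-flip ; rot = H-rot ; irr = proj₁ ∘ proj₁ ; 1<t = 1<t ; free = ¬fan ∘ fan⇒contains }

  upper-bound : ∀ {t} → 1 < t → threshold t ≤ n → ¬ ContainsExpandedFan t 𝒢 → e 𝒢 ≤ (n C 3) ∸ ((n ∸ t) C 3)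
  upper-bound {t} 1<t n≥n₀ ¬fan = m+n≤o⇒m≤o∸n (e 𝒢) (*-cancelˡ-≤ 6 (begin
    6 * (e 𝒢 + (n ∸ t) C 3) ≡⟨ *-distribˡ-+ 6 (e 𝒢) _ ⟩
    6 * e 𝒢 + 6 * ((n ∸ t) C 3) ≤⟨ +-mono-≤ edge-count (≤-reflexive (6*C3 (n ∸ t))) ⟩
    ∑³ (λ x y z → 𝟙 (H? x y z)) + falling (n ∸ t) ≤⟨ Upper.upper (setting 1<t ¬fan) n≥n₀ ⟩
    falling n ≡⟨ 6*C3 n ⟨
    6 * (n C 3) ∎))
    where open ≤-Reasoning

-- The lower bound.

subsets : (k n : ℕ) → List (Subset n)
subsets zero    n = ∅ ∷ []
subsets (suc k) zero    = []
subsets (suc k) (suc n) = map (inside ∷_) (subsets k n) ++ map (outside ∷_) (subsets (suc k) n)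

-- The triples meeting the first t vertices.
star : (t n : ℕ) → List (Subset n)
star zero    n = []
star (suc t) zero    = []
star (suc t) (suc n) = map (inside ∷_) (subsets 2 n) ++ map (outside ∷_) (star t n)

module _ {n : ℕ} where

  ∈-glue : ∀ (xs ys : List (Subset n)) {S} → S ∈ map (inside ∷_) xs ++ map (outside ∷_) ys →
           (∃ λ R → R ∈ xs × S ≡ inside ∷ R) ⊎ (∃ λ R → R ∈ ys × S ≡ outside ∷ R)
  ∈-glue xs ys S∈ with ∈-++⁻ (map (inside ∷_) xs) S∈
  ... | inj₁ p = inj₁ (∈-map⁻ (inside ∷_) p)
  ... | inj₂ p = inj₂ (∈-map⁻ (outside ∷_) p)

  glue-unique : ∀ {xs ys : List (Subset n)} → Unique xs → Unique ys → Unique (map (inside ∷_) xs ++ map (outside ∷_) ys)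
  glue-unique {xs} {ys} u v = Uniq.++⁺ (Uniq.map⁺ Vec.∷-injectiveʳ u) (Uniq.map⁺ Vec.∷-injectiveʳ v) disjoint
    where
    disjoint : ∀ {S} → ¬ (S ∈ map (inside ∷_) xs × S ∈ map (outside ∷_) ys)
    disjoint (p , q) with ∈-map⁻ (inside ∷_) p | ∈-map⁻ (outside ∷_) q
    ... | _ , _ , refl | _ , _ , ()

  glue-length : ∀ (xs ys : List (Subset n)) → length (map (inside ∷_) xs ++ map (outside ∷_) ys) ≡ length xs + length ys
  glue-length xs ys = trans (length-++ (map (inside ∷_) xs)) (cong₂ _+_ (length-map (inside ∷_) xs) (length-map (outside ∷_) ys))

subsets-size : ∀ k n {S} → S ∈ subsets k n → ∣ S ∣ ≡ k
subsets-size zero    n (here refl) = Sub.∣⊥∣≡0 n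
subsets-size (suc k) (suc n) S∈ with ∈-glue (subsets k n) (subsets (suc k) n) S∈
... | inj₁ (R , R∈ , refl) = cong suc (subsets-size k n R∈)
... | inj₂ (R , R∈ , refl) = subsets-size (suc k) n R∈

subsets-unique : ∀ k n → Unique (subsets k n)
subsets-unique zero    n = [] ∷ []
subsets-unique (suc k) zero    = []
subsets-unique (suc k) (suc n) = glue-unique (subsets-unique k n) (subsets-unique (suc k) n)

subsets-length : ∀ k n → length (subsets k n) ≡ n C k
subsets-length zero    n = refl
subsets-length (suc k) zero    = refl
subsets-length (suc k) (suc n) = trans (glue-length (subsets k n) (subsets (suc k) n))
  (trans (cong₂ _+_ (subsets-length k n) (subsets-length (suc k) n)) (nCk+nC[k+1]≡[n+1]C[k+1] n k))

star-size : ∀ t n {S} → S ∈ star t n → ∣ S ∣ ≡ 3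
star-size (suc t) (suc n) S∈ with ∈-glue (subsets 2 n) (star t n) S∈
... | inj₁ (R , R∈ , refl) = cong suc (subsets-size 2 n R∈)
... | inj₂ (R , R∈ , refl) = star-size t n R∈

star-unique : ∀ t n → Unique (star t n)
star-unique zero    n = []
star-unique (suc t) zero    = []
star-unique (suc t) (suc n) = glue-unique (subsets-unique 2 n) (star-unique t n)

-- Pascal's rule at each of the first `t` vertices, which contributes the pairs among the later
-- ones.
star-length : ∀ t n → length (star t n) + (n ∸ t) C 3 ≡ n C 3
star-length zero    n = refl
star-length (suc t) zero    = refl
star-length (suc t) (suc n) = begin
  length (star (suc t) (suc n)) + (n ∸ t) C 3 ≡⟨ cong (_+ (n ∸ t) C 3) (glue-length (subsets 2 n) (star t n)) ⟩
  length (subsets 2 n) + length (star t n) + (n ∸ t) C 3    ≡⟨ +-assoc (length (subsets 2 n)) _ _ ⟩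
  length (subsets 2 n) + (length (star t n) + (n ∸ t) C 3)  ≡⟨ cong₂ _+_ (subsets-length 2 n) (star-length t n) ⟩
  n C 2 + n C 3 ≡⟨ nCk+nC[k+1]≡[n+1]C[k+1] n 2 ⟩
  suc n C 3 ∎
  where open ≡-Reasoning

star-meets : ∀ t n {S} → S ∈ star t n → ∃ λ x → x ∈ₛ S × toℕ x < t
star-meets (suc t) (suc n) S∈ with ∈-glue (subsets 2 n) (star t n) S∈
... | inj₁ (R , R∈ , refl) = zero , Vec.here , s≤s z≤n
... | inj₂ (R , R∈ , refl) with x , x∈ , lt ← star-meets t n R∈ = suc x , Vec.there x∈ , s≤s lt

starGraph : ∀ t n → 3Graph n
starGraph t n = record { edges = star t n ; uniform = All.tabulate (star-size t n) ; distinct = star-unique t n }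

-- The t disjoint sides {aᵢ , bᵢ , abᵢ} and the two other sides of the first triangle force
-- t + 1 distinct vertices of the fan into the first t vertices.
star-fan-free : ∀ {t n} → 1 < t → ¬ ContainsExpandedFan t (starGraph t n)
star-fan-free {t@(suc _)} {n} _ (φ , inj , sides) = clash extra
  where
  Low : FanVertex t → Set
  Low v = toℕ (φ v) < t
  hit : ∀ {u v w} → triple (φ u) (φ v) (φ w) ∈ star t n → Low u ⊎ Low v ⊎ Low w
  hit S∈ with x , x∈ , lt ← star-meets t n S∈ with triple-members x∈
  ... | here refl = inj₁ lt
  ... | there (here refl) = inj₂ (inj₁ lt)
  ... | there (there (here refl)) = inj₂ (inj₂ lt)
  data Side (i : Fin t) : FanVertex t → Set where
    side-a  : Side i (a i)
    side-b  : Side i (b i)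
    side-ab : Side i (ab i)
  side : ∀ i → ∃ λ v → Side i v × Low v
  side i with hit {a i} {b i} {ab i} (proj₂ (proj₂ (sides i)))
  ... | inj₁ p = a i , side-a , p
  ... | inj₂ (inj₁ p) = b i , side-b , p
  ... | inj₂ (inj₂ p) = ab i , side-ab , p
  rep : Fin t → FanVertex t
  rep i = proj₁ (side i)
  side-disjoint : ∀ {i j v} → Side i v → Side j v → i ≡ j
  side-disjoint side-a  side-a  = refl
  side-disjoint side-b  side-b  = refl
  side-disjoint side-ab side-ab = refl
  extra : ∃ λ v → Low v × (∀ i → rep i ≢ v)
  extra with hit {center} {a zero} {ca zero} (proj₁ (sides zero)) | hit {center} {b zero} {cb zero} (proj₁ (proj₂ (sides zero)))
  ... | inj₁ p | _ = center , p , λ i eq → case subst (Side i) eq (proj₁ (proj₂ (side i))) of λ ()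
  ... | inj₂ (inj₂ p) | _ = ca zero , p , λ i eq → case subst (Side i) eq (proj₁ (proj₂ (side i))) of λ ()
  ... | inj₂ (inj₁ _) | inj₁ p = center , p , λ i eq → case subst (Side i) eq (proj₁ (proj₂ (side i))) of λ ()
  ... | inj₂ (inj₁ _) | inj₂ (inj₂ p) = cb zero , p , λ i eq → case subst (Side i) eq (proj₁ (proj₂ (side i))) of λ ()
  -- Both `a zero` and `b zero` are low, and at least one of them is not the representative of the
  -- first triangle.
  ... | inj₂ (inj₁ p) | inj₂ (inj₁ q) = other (rep zero) refl (proj₁ (proj₂ (side zero)))
    where
    only-zero : ∀ {v} → Side zero v → rep zero ≢ v → ∀ i → rep i ≢ v
    only-zero s ne i eq with refl ← side-disjoint (subst (Side i) eq (proj₁ (proj₂ (side i)))) s = ne eq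
    other : ∀ v → rep zero ≡ v → Side zero v → ∃ λ v → Low v × (∀ i → rep i ≢ v)
    other _ eq side-a  = b zero , q , only-zero side-b λ eq′ → case trans (sym eq) eq′ of λ ()
    other _ eq side-b  = a zero , p , only-zero side-a λ eq′ → case trans (sym eq) eq′ of λ ()
    other _ eq side-ab = a zero , p , only-zero side-a λ eq′ → case trans (sym eq) eq′ of λ ()
  clash : (∃ λ v → Low v × (∀ i → rep i ≢ v)) → ⊥
  clash (v , low , new) = let i , j , i<j , eq = Fin.pigeonhole (n<1+n t) g in absurd i j i<j eq
    where
    g : Fin (suc t) → Fin t
    g zero    = fromℕ< low
    g (suc i) = fromℕ< (proj₂ (proj₂ (side i)))
    same : ∀ {u w} (p : Low u) (q : Low w) → fromℕ< p ≡ fromℕ< q → u ≡ w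
    same p q eq = inj (Fin.toℕ-injective (Fin.fromℕ<-injective _ _ p q eq))
    absurd : ∀ i j → i Data.Fin.< j → g i ≡ g j → ⊥
    absurd zero    (suc j) _   eq = new j (sym (same low (proj₂ (proj₂ (side j))) eq))
    absurd (suc i) (suc j) i<j eq = Fin.<⇒≢ i<j (cong suc (side-disjoint
      (subst (Side i) (same (proj₂ (proj₂ (side i))) (proj₂ (proj₂ (side j))) eq) (proj₁ (proj₂ (side i)))) (proj₁ (proj₂ (side j)))))

theorem1 : (t : ℕ) → 1 < t → Σ ℕ λ n₀ → (n : ℕ) → n₀ ≤ n →
    ExFanIs t n ((n C 3) ∸ ((n ∸ t) C 3))
theorem1 t 1<t = threshold t , λ n n≥n₀ →
  (λ 𝒢 → FromGraph.upper-bound 𝒢 1<t n≥n₀) ,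
  starGraph t n , star-fan-free 1<t ,
  trans (sym (m+n∸n≡m (length (star t n)) ((n ∸ t) C 3))) (cong (_∸ (n ∸ t) C 3) (star-length t n))
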